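{- Let $\Gamma$ be a finite, simple, connected, bipartite $k$-regular graph with $n$ vertices whose adjacency spectrum is $\{[\pm k]^{1}, [\pm\theta]^{\frac{n}{2}-1}\}$, where $\frac{n}{2}-1\geq 1$ and the four displayed eigenvalues $k,-k,\theta,-\theta$ are pairwise distinct. Then $\Gamma$ is periodic if and only if $\Gamma$ is isomorphic to the cycle graph $C_6$ on $6$ vertices.
   Context: All graphs are finite, simple and connected. The adjacency spectrum of a graph is the multiset of eigenvalues of its adjacency matrix. The notation $\{[\pm k]^{1}, [\pm\theta]^{a}\}$ means that $k$ and $-k$ each have multiplicity $1$, and $\theta$ and $-\theta$ each have multiplicity $a$. Grover walk and periodicity: for a graph $\Gamma=(V,E)$, let $\mathcal{A}=\{(x,y),(y,x)\mid \{x,y\}\in E\}$ be its set of arcs; for $e=(x,y)\in\mathcal{A}$ write $t(e)=y$ for the terminus and $e^{ -1}=(y,x)$ for the inverse arc. The boundary matrix $d\in\mathbb{C}^{V\times\mathcal{A}}$ is $d_{x,e}=\frac{1}{\sqrt{\deg x}}\delta_{x,t(e)}$, the shift matrix $S\in\mathbb{C}^{\mathcal{A}\times\mathcal{A}}$ is $S_{e,f}=\delta_{e,f^{ -1}}$, and the time evolution matrix is $U=S(2d^*d-I)\in\mathbb{C}^{\mathcal{A}\times\mathcal{A}}$, where $d^*$ is the conjugate transpose of $d$ and $\delta$ is the Kronecker delta. The graph $\Gamma$ is called periodic if there exists a positive integer $\tau$ with $U^{\tau}=I$. -}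

module Defs where

open import Level using (0ℓ)
open import Algebra.Bundles.Raw using (RawRing)
import Algebra.Definitions.RawSemiring as RawSemiringDefs
open import Data.Bool.Base using (Bool; true; false; T; _∨_; if_then_else_)
open import Data.Bool.Properties using (∨-comm; T?)
open import Data.Empty using (⊥-elim)
open import Data.Fin.Base using (Fin; zero; suc; toℕ; punchIn)
import Data.Fin.Properties as Fin
open import Data.Integer.Base as ℤ using (+_; +[1+_]; +≤+; +<+)
import Data.Integer.Properties as ℤ
open import Data.List.Base as List using (List; []; _∷_; filter; length; allFin)
open import Data.Nat.Base as ℕ using (ℕ; zero; suc; z≤n; s≤s; _⊔_; _≡ᵇ_)
open import Data.Nat.DivMod using (_%_; m≤n⇒m%n≡m; n%n≡0)
import Data.Nat.Properties as ℕ
open import Data.Product.Base using (Σ; Σ-syntax; ∃-syntax; _×_; _,_)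
open import Data.Rational as ℚ using (ℚ; mkℚ; 0ℚ; 1ℚ; ½; toℚᵘ; fromℚᵘ)
import Data.Rational.Properties as ℚ
open import Data.Rational.Solver using (module +-*-Solver)
open import Data.Rational.Unnormalised.Base as ℚᵘ using (mkℚᵘ; *≤*; *<*; *≡*)
import Data.Rational.Unnormalised.Properties as ℚᵘ
open import Data.Sum.Base as Sum using (_⊎_; inj₁; inj₂)
open import Data.Sum.Function.Propositional using (_⊎-↔_)
open import Data.Unit.Base using (tt)
open import Function.Base using (_∘_)
open import Function.Bundles using (_↔_; Inverse; mk↔ₛ′)
open import Function.Construct.Composition using (_↔-∘_)
open import Function.Properties.Inverse using (↔-sym; ↔⇒↣)
open import Relation.Binary.Construct.Closure.ReflexiveTransitive using (Star)
open import Relation.Binary.Definitions using (DecidableEquality)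
open import Relation.Binary.PropositionalEquality
  using (_≡_; _≢_; refl; sym; trans; cong; cong₂; subst; subst₂)
open import Relation.Nullary.Decidable using (does; yes; no; True; via-injection)
open import Relation.Nullary.Negation using (¬_)

Eventually : (ℕ → Set) → Set
Eventually P = ∃[ N ] (∀ n → N ℕ.≤ n → P n)

IsCauchy : (ℕ → ℚ) → Set
IsCauchy s = ∀ ε → 0ℚ ℚ.< ε →
  ∃[ N ] (∀ m n → N ℕ.≤ m → N ℕ.≤ n → ℚ.∣ s m ℚ.- s n ∣ ℚ.< ε)

-- Real numbers as Cauchy sequences of rationals, up to the equivalence _≈ᴿ_.
record ℝ : Set where
  constructor mkℝ
  field
    seq    : ℕ → ℚ
    cauchy : IsCauchy seq

open ℝ public

infix 4 _≈ᴿ_ _≉ᴿ_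

_≈ᴿ_ : ℝ → ℝ → Set
x ≈ᴿ y = ∀ ε → 0ℚ ℚ.< ε → Eventually (λ n → ℚ.∣ seq x n ℚ.- seq y n ∣ ℚ.< ε)

_≉ᴿ_ : ℝ → ℝ → Set
x ≉ᴿ y = ¬ (x ≈ᴿ y)

module CauchyLemmas where
  open +-*-Solver using (solve; _:+_; _:*_; _:-_; :-_; _:=_; con)

  ½*-pos : ∀ {ε} → 0ℚ ℚ.< ε → 0ℚ ℚ.< ½ ℚ.* ε
  ½*-pos {ε} 0<ε = subst (ℚ._< ½ ℚ.* ε) (ℚ.*-zeroʳ ½) (ℚ.*-monoʳ-<-pos ½ 0<ε)

  ½+½ : ∀ ε → ½ ℚ.* ε ℚ.+ ½ ℚ.* ε ≡ ε
  ½+½ = solve 1 (λ e → con ½ :* e :+ con ½ :* e := e) refl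

  abstract
    const-cauchy : ∀ q → IsCauchy (λ _ → q)
    const-cauchy q ε 0<ε = 0 , λ _ _ _ _ →
      subst (λ d → ℚ.∣ d ∣ ℚ.< ε) (sym (ℚ.+-inverseʳ q)) 0<ε

  abstract
    +-cauchy : ∀ {s t} → IsCauchy s → IsCauchy t → IsCauchy (λ n → s n ℚ.+ t n)
    +-cauchy {s} {t} cs ct ε 0<ε
      with N , hN ← cs (½ ℚ.* ε) (½*-pos 0<ε)
         | M , hM ← ct (½ ℚ.* ε) (½*-pos 0<ε)
      = N ⊔ M , λ m n p q → begin-strict
        ℚ.∣ s m ℚ.+ t m ℚ.- (s n ℚ.+ t n) ∣
          ≡⟨ cong ℚ.∣_∣ (solve 4 (λ a b c d → a :+ b :- (c :+ d) := (a :- c) :+ (b :- d)) refl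
               (s m) (t m) (s n) (t n)) ⟩
        ℚ.∣ (s m ℚ.- s n) ℚ.+ (t m ℚ.- t n) ∣
          ≤⟨ ℚ.∣p+q∣≤∣p∣+∣q∣ (s m ℚ.- s n) (t m ℚ.- t n) ⟩
        ℚ.∣ s m ℚ.- s n ∣ ℚ.+ ℚ.∣ t m ℚ.- t n ∣
          <⟨ ℚ.+-mono-<
               (hN m n (ℕ.≤-trans (ℕ.m≤m⊔n N M) p) (ℕ.≤-trans (ℕ.m≤m⊔n N M) q))
               (hM m n (ℕ.≤-trans (ℕ.m≤n⊔m N M) p) (ℕ.≤-trans (ℕ.m≤n⊔m N M) q)) ⟩
        ½ ℚ.* ε ℚ.+ ½ ℚ.* ε
          ≡⟨ ½+½ ε ⟩
        ε ∎
      where open ℚ.≤-Reasoning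

  abstract
    neg-cauchy : ∀ {s} → IsCauchy s → IsCauchy (λ n → ℚ.- s n)
    neg-cauchy {s} cs ε 0<ε with N , hN ← cs ε 0<ε =
      N , λ m n p q → subst (ℚ._< ε)
        (trans (sym (ℚ.∣-p∣≡∣p∣ (s m ℚ.- s n)))
               (cong ℚ.∣_∣ (solve 2 (λ a b → :- (a :- b) := :- a :- :- b) refl (s m) (s n))))
        (hN m n p q)

  eventually-bounded : ∀ {s} → IsCauchy s →
    ∃[ B ] (0ℚ ℚ.< B × Eventually (λ n → ℚ.∣ s n ∣ ℚ.≤ B))
  eventually-bounded {s} cs with N , hN ← cs 1ℚ (ℚ.positive⁻¹ 1ℚ) =
    1ℚ ℚ.+ ℚ.∣ s N ∣
    , ℚ.+-mono-<-≤ (ℚ.positive⁻¹ 1ℚ) (ℚ.0≤∣p∣ (s N))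
    , N , λ n p → begin
      ℚ.∣ s n ∣
        ≡⟨ cong ℚ.∣_∣ (solve 2 (λ a b → a := (a :- b) :+ b) refl (s n) (s N)) ⟩
      ℚ.∣ (s n ℚ.- s N) ℚ.+ s N ∣
        ≤⟨ ℚ.∣p+q∣≤∣p∣+∣q∣ (s n ℚ.- s N) (s N) ⟩
      ℚ.∣ s n ℚ.- s N ∣ ℚ.+ ℚ.∣ s N ∣
        ≤⟨ ℚ.+-monoˡ-≤ ℚ.∣ s N ∣ (ℚ.<⇒≤ (hN n N p ℕ.≤-refl)) ⟩
      1ℚ ℚ.+ ℚ.∣ s N ∣ ∎
    where open ℚ.≤-Reasoning

  divide : ∀ B ε → 0ℚ ℚ.< B → 0ℚ ℚ.< ε → ∃[ δ ] (0ℚ ℚ.< δ × B ℚ.* δ ≡ ε)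
  divide B ε 0<B 0<ε = ℚ.1/ B ℚ.* ε
    , ℚ.positive⁻¹ (ℚ.1/ B ℚ.* ε) {{ℚ.pos*pos⇒pos (ℚ.1/ B) ε}}
    , trans (sym (ℚ.*-assoc B (ℚ.1/ B) ε))
        (trans (cong (ℚ._* ε) (ℚ.*-inverseʳ B)) (ℚ.*-identityˡ ε))
    where
    instance
      posB = ℚ.positive 0<B
      posε = ℚ.positive 0<ε
      nzB  = ℚ.pos⇒nonZero B
      pos1/B = ℚ.1/pos⇒pos B

  ∣*∣-bound : ∀ {B δ} p d → 0ℚ ℚ.< B → ℚ.∣ p ∣ ℚ.≤ B → ℚ.∣ d ∣ ℚ.< δ →
    ℚ.∣ p ℚ.* d ∣ ℚ.< B ℚ.* δ
  ∣*∣-bound {B} {δ} p d 0<B p≤B d<δ = begin-strict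
    ℚ.∣ p ℚ.* d ∣          ≡⟨ ℚ.∣p*q∣≡∣p∣*∣q∣ p d ⟩
    ℚ.∣ p ∣ ℚ.* ℚ.∣ d ∣    ≤⟨ ℚ.*-monoʳ-≤-nonNeg ℚ.∣ d ∣ {{ℚ.∣-∣-nonNeg d}} p≤B ⟩
    B ℚ.* ℚ.∣ d ∣          <⟨ ℚ.*-monoʳ-<-pos B {{ℚ.positive 0<B}} d<δ ⟩
    B ℚ.* δ                ∎
    where open ℚ.≤-Reasoning

  *-telescope : ∀ a b c d → a ℚ.* b ℚ.- c ℚ.* d ≡ a ℚ.* (b ℚ.- d) ℚ.+ d ℚ.* (a ℚ.- c)
  *-telescope a b c d = begin-equality
    a ℚ.* b ℚ.- c ℚ.* d
      ≡⟨ solve 3 (λ x y z → x :- z := (x :- y) :+ (y :- z)) refl (a ℚ.* b) (a ℚ.* d) (c ℚ.* d) ⟩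
    (a ℚ.* b ℚ.- a ℚ.* d) ℚ.+ (a ℚ.* d ℚ.- c ℚ.* d)
      ≡⟨ cong (λ x → (a ℚ.* b ℚ.- a ℚ.* d) ℚ.+ (x ℚ.- c ℚ.* d)) (ℚ.*-comm a d) ⟩
    (a ℚ.* b ℚ.- a ℚ.* d) ℚ.+ (d ℚ.* a ℚ.- c ℚ.* d)
      ≡⟨ cong (λ x → (a ℚ.* b ℚ.- a ℚ.* d) ℚ.+ (d ℚ.* a ℚ.- x)) (ℚ.*-comm c d) ⟩
    (a ℚ.* b ℚ.- a ℚ.* d) ℚ.+ (d ℚ.* a ℚ.- d ℚ.* c)
      ≡⟨ cong₂ ℚ._+_ (sym (*-distribˡ-- a b d)) (sym (*-distribˡ-- d a c)) ⟩
    a ℚ.* (b ℚ.- d) ℚ.+ d ℚ.* (a ℚ.- c) ∎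
    where
    open ℚ.≤-Reasoning
    *-distribˡ-- : ∀ x y z → x ℚ.* (y ℚ.- z) ≡ x ℚ.* y ℚ.- x ℚ.* z
    *-distribˡ-- x y z = trans (ℚ.*-distribˡ-+ x y (ℚ.- z))
      (cong (x ℚ.* y ℚ.+_) (sym (ℚ.neg-distribʳ-* x z)))

  *-close : ∀ {ε B C δ γ} a b c d → 0ℚ ℚ.< B → 0ℚ ℚ.< C →
    B ℚ.* δ ≡ ½ ℚ.* ε → C ℚ.* γ ≡ ½ ℚ.* ε →
    ℚ.∣ a ∣ ℚ.≤ B → ℚ.∣ d ∣ ℚ.≤ C → ℚ.∣ b ℚ.- d ∣ ℚ.< δ → ℚ.∣ a ℚ.- c ∣ ℚ.< γ →
    ℚ.∣ a ℚ.* b ℚ.- c ℚ.* d ∣ ℚ.< ε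
  *-close {ε} {B} {C} {δ} {γ} a b c d 0<B 0<C Bδ Cγ a≤B d≤C b~d a~c = begin-strict
    ℚ.∣ a ℚ.* b ℚ.- c ℚ.* d ∣
      ≡⟨ cong ℚ.∣_∣ (*-telescope a b c d) ⟩
    ℚ.∣ a ℚ.* (b ℚ.- d) ℚ.+ d ℚ.* (a ℚ.- c) ∣
      ≤⟨ ℚ.∣p+q∣≤∣p∣+∣q∣ (a ℚ.* (b ℚ.- d)) (d ℚ.* (a ℚ.- c)) ⟩
    ℚ.∣ a ℚ.* (b ℚ.- d) ∣ ℚ.+ ℚ.∣ d ℚ.* (a ℚ.- c) ∣
      <⟨ ℚ.+-mono-< (∣*∣-bound a (b ℚ.- d) 0<B a≤B b~d) (∣*∣-bound d (a ℚ.- c) 0<C d≤C a~c) ⟩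
    B ℚ.* δ ℚ.+ C ℚ.* γ
      ≡⟨ cong₂ ℚ._+_ Bδ Cγ ⟩
    ½ ℚ.* ε ℚ.+ ½ ℚ.* ε
      ≡⟨ ½+½ ε ⟩
    ε ∎
    where open ℚ.≤-Reasoning

  abstract
    *-cauchy : ∀ {s t} → IsCauchy s → IsCauchy t → IsCauchy (λ n → s n ℚ.* t n)
    *-cauchy {s} {t} cs ct ε 0<ε =
      let B , 0<B , N₁ , h₁ = eventually-bounded {s} cs
          C , 0<C , N₂ , h₂ = eventually-bounded {t} ct
          δ , 0<δ , Bδ = divide B (½ ℚ.* ε) 0<B (½*-pos 0<ε)
          γ , 0<γ , Cγ = divide C (½ ℚ.* ε) 0<C (½*-pos 0<ε)
          N₃ , h₃ = ct δ 0<δ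
          N₄ , h₄ = cs γ 0<γ
          ≤₁ = ℕ.≤-trans (ℕ.m≤m⊔n N₁ N₂) (ℕ.m≤m⊔n (N₁ ⊔ N₂) (N₃ ⊔ N₄))
          ≤₂ = ℕ.≤-trans (ℕ.m≤n⊔m N₁ N₂) (ℕ.m≤m⊔n (N₁ ⊔ N₂) (N₃ ⊔ N₄))
          ≤₃ = ℕ.≤-trans (ℕ.m≤m⊔n N₃ N₄) (ℕ.m≤n⊔m (N₁ ⊔ N₂) (N₃ ⊔ N₄))
          ≤₄ = ℕ.≤-trans (ℕ.m≤n⊔m N₃ N₄) (ℕ.m≤n⊔m (N₁ ⊔ N₂) (N₃ ⊔ N₄))
      in (N₁ ⊔ N₂) ⊔ (N₃ ⊔ N₄) , λ m n p q →
        *-close (s m) (t m) (s n) (t n) 0<B 0<C Bδ Cγ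
          (h₁ m (ℕ.≤-trans ≤₁ p)) (h₂ n (ℕ.≤-trans ≤₂ q))
          (h₃ m n (ℕ.≤-trans ≤₃ p) (ℕ.≤-trans ≤₃ q))
          (h₄ m n (ℕ.≤-trans ≤₄ p) (ℕ.≤-trans ≤₄ q))

open CauchyLemmas

fromℚ : ℚ → ℝ
fromℚ q = mkℝ (λ _ → q) (const-cauchy q)

fromℕ : ℕ → ℝ
fromℕ k = fromℚ (+ k ℚ./ 1)

ℝ-rawRing : RawRing 0ℓ 0ℓ
ℝ-rawRing = record
  { Carrier = ℝ
  ; _≈_ = _≈ᴿ_
  ; _+_ = λ x y → mkℝ (λ n → seq x n ℚ.+ seq y n) (+-cauchy {seq x} {seq y} (cauchy x) (cauchy y))
  ; _*_ = λ x y → mkℝ (λ n → seq x n ℚ.* seq y n) (*-cauchy {seq x} {seq y} (cauchy x) (cauchy y))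
  ; -_  = λ x → mkℝ (λ n → ℚ.- seq x n) (neg-cauchy {seq x} (cauchy x))
  ; 0#  = fromℚ 0ℚ
  ; 1#  = fromℚ 1ℚ
  }

module ℝ-ring = RawRing ℝ-rawRing

-- The largest j ≤ b with j² k ≤ N² (or 0 if there is none).
search : (k N b : ℕ) → ℕ
search k N zero    = 0
search k N (suc b) with suc b ℕ.* suc b ℕ.* k ℕ.≤? N ℕ.* N
... | yes _ = suc b
... | no  _ = search k N b

-- ⌊ N / √k ⌋, for k ≥ 1.
⌊_/√_⌋ : (N k : ℕ) → ℕ
⌊ N /√ k ⌋ = search k N N

-- Rational approximation of 1/√k with error less than 1/(i+1).
1/√-approx : (k : ℕ) → ℕ → ℚ
1/√-approx k i = + ⌊ suc i /√ k ⌋ ℚ./ suc i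

module InvSqrtLemmas where
  open CauchyLemmas
  open +-*-Solver using (solve; _:+_; _:-_; :-_; _:=_)

  search-lower : ∀ k N b → search k N b ℕ.* search k N b ℕ.* k ℕ.≤ N ℕ.* N
  search-lower k N zero = z≤n
  search-lower k N (suc b) with suc b ℕ.* suc b ℕ.* k ℕ.≤? N ℕ.* N
  ... | yes p = p
  ... | no _  = search-lower k N b

  search-upper : ∀ k N b → N ℕ.* N ℕ.< suc b ℕ.* suc b ℕ.* k →
    N ℕ.* N ℕ.< suc (search k N b) ℕ.* suc (search k N b) ℕ.* k
  search-upper k N zero h = h
  search-upper k N (suc b) h with suc b ℕ.* suc b ℕ.* k ℕ.≤? N ℕ.* N
  ... | yes _ = h
  ... | no ¬p = search-upper k N b (ℕ.≰⇒> ¬p)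

  ⌊/√⌋-upper : ∀ k N → N ℕ.* N ℕ.< suc ⌊ N /√ suc k ⌋ ℕ.* suc ⌊ N /√ suc k ⌋ ℕ.* suc k
  ⌊/√⌋-upper k N = search-upper (suc k) N N
    (ℕ.<-≤-trans (ℕ.*-mono-< (ℕ.n<1+n N) (ℕ.n<1+n N)) (ℕ.m≤m*n (suc N ℕ.* suc N) (suc k)))

  square-cancel-< : ∀ a b → a ℕ.* a ℕ.< b ℕ.* b → a ℕ.< b
  square-cancel-< a b h with a ℕ.<? b
  ... | yes p = p
  ... | no ¬p = ⊥-elim (ℕ.<⇒≱ h (ℕ.*-mono-≤ (ℕ.≮⇒≥ ¬p) (ℕ.≮⇒≥ ¬p)))

  open import Data.Nat.Solver using () renaming (module +-*-Solver to ℕ-Solver)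

  cross : ∀ k N M .{{_ : ℕ.NonZero M}} .{{_ : ℕ.NonZero N}} →
    ⌊ N /√ suc k ⌋ ℕ.* M ℕ.< suc ⌊ M /√ suc k ⌋ ℕ.* N
  cross k N M = square-cancel-< (i ℕ.* M) (j ℕ.* N)
    (ℕ.*-cancelʳ-< (suc k) (i ℕ.* M ℕ.* (i ℕ.* M)) (j ℕ.* N ℕ.* (j ℕ.* N)) (begin-strict
      i ℕ.* M ℕ.* (i ℕ.* M) ℕ.* suc k
        ≡⟨ ℕ-Solver.solve 3 (λ i m k → i ⊛ m ⊛ (i ⊛ m) ⊛ k ⊜ i ⊛ i ⊛ k ⊛ (m ⊛ m)) refl i M (suc k) ⟩
      i ℕ.* i ℕ.* suc k ℕ.* (M ℕ.* M)
        ≤⟨ ℕ.*-monoˡ-≤ (M ℕ.* M) (search-lower (suc k) N N) ⟩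
      N ℕ.* N ℕ.* (M ℕ.* M)
        <⟨ ℕ.*-monoʳ-< (N ℕ.* N) {{ℕ.m*n≢0 N N}} (⌊/√⌋-upper k M) ⟩
      N ℕ.* N ℕ.* (j ℕ.* j ℕ.* suc k)
        ≡⟨ ℕ-Solver.solve 3 (λ n j k → n ⊛ n ⊛ (j ⊛ j ⊛ k) ⊜ j ⊛ n ⊛ (j ⊛ n) ⊛ k) refl N j (suc k) ⟩
      j ℕ.* N ℕ.* (j ℕ.* N) ℕ.* suc k ∎))
    where
    open ℕ.≤-Reasoning
    open ℕ-Solver using () renaming (_:*_ to infixl 7 _⊛_; _:=_ to infix 4 _⊜_)
    i = ⌊ N /√ suc k ⌋
    j = suc ⌊ M /√ suc k ⌋

  approx-close : ∀ k m n →
    1/√-approx (suc k) m ℚ.< 1/√-approx (suc k) n ℚ.+ (+ 1 ℚ./ suc n)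
  approx-close k m n = ℚ.toℚᵘ-cancel-< (begin-strict
    toℚᵘ (+ i ℚ./ suc m)
      ≃⟨ ℚ.toℚᵘ-fromℚᵘ (mkℚᵘ (+ i) m) ⟩
    mkℚᵘ (+ i) m
      <⟨ *<* (subst₂ ℤ._<_ (ℤ.pos-* i (suc n)) (ℤ.pos-* (suc j) (suc m))
           (+<+ (cross k (suc m) (suc n)))) ⟩
    mkℚᵘ (+ suc j) n
      ≃⟨ sum-≃ ⟩
    mkℚᵘ (+ j) n ℚᵘ.+ mkℚᵘ (+ 1) n
      ≃⟨ ℚᵘ.+-cong (ℚᵘ.≃-sym (ℚ.toℚᵘ-fromℚᵘ (mkℚᵘ (+ j) n)))
                   (ℚᵘ.≃-sym (ℚ.toℚᵘ-fromℚᵘ (mkℚᵘ (+ 1) n))) ⟩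
    toℚᵘ (+ j ℚ./ suc n) ℚᵘ.+ toℚᵘ (+ 1 ℚ./ suc n)
      ≃⟨ ℚᵘ.≃-sym (ℚ.toℚᵘ-homo-+ (+ j ℚ./ suc n) (+ 1 ℚ./ suc n)) ⟩
    toℚᵘ ((+ j ℚ./ suc n) ℚ.+ (+ 1 ℚ./ suc n)) ∎)
    where
    open ℚᵘ.≤-Reasoning
    i = ⌊ suc m /√ suc k ⌋
    j = ⌊ suc n /√ suc k ⌋
    sum-≃ : mkℚᵘ (+ suc j) n ℚᵘ.≃ mkℚᵘ (+ j) n ℚᵘ.+ mkℚᵘ (+ 1) n
    sum-≃ = *≡* (trans
      (cong (ℤ._* (+ suc n ℤ.* + suc n)) (cong +_ (sym (ℕ.+-comm j 1))))
      (trans (sym (ℤ.*-assoc (+ j ℤ.+ + 1) (+ suc n) (+ suc n)))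
             (cong (ℤ._* + suc n) (ℤ.*-distribʳ-+ (+ suc n) (+ j) (+ 1)))))

  archimedean : ∀ ε → 0ℚ ℚ.< ε → ∃[ N ] (∀ n → N ℕ.≤ n → (+ 1 ℚ./ suc n) ℚ.≤ ε)
  archimedean (mkℚ +[1+ p ] d c) _ = d , λ n d≤n → ℚ.toℚᵘ-cancel-≤
    (ℚᵘ.≤-respˡ-≃ (ℚᵘ.≃-sym (ℚ.toℚᵘ-fromℚᵘ (mkℚᵘ (+ 1) n)))
      (*≤* (subst₂ ℤ._≤_ (ℤ.pos-* 1 (suc d)) (ℤ.pos-* (suc p) (suc n))
        (+≤+ (ℕ.*-mono-≤ {1} {suc p} (s≤s z≤n) (s≤s d≤n))))))
  archimedean (mkℚ (+ zero) d c) (ℚ.*<* (+<+ ()))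
  archimedean (mkℚ ℤ.-[1+ p ] d c) (ℚ.*<* ())

  abs-< : ∀ {ε} p q → p ℚ.- q ℚ.< ε → q ℚ.- p ℚ.< ε → ℚ.∣ p ℚ.- q ∣ ℚ.< ε
  abs-< {ε} p q u v = Sum.[ (λ e → subst (ℚ._< ε) (sym e) u)
    , (λ e → subst (ℚ._< ε) (trans (sym neg-diff) (sym e)) v) ]′
    (ℚ.∣p∣≡p∨∣p∣≡-p (p ℚ.- q))
    where
    neg-diff : ℚ.- (p ℚ.- q) ≡ q ℚ.- p
    neg-diff = solve 2 (λ x y → :- (x :- y) := y :- x) refl p q

  diff-< : ∀ {ε} p q r → p ℚ.< q ℚ.+ r → r ℚ.≤ ε → p ℚ.- q ℚ.< ε
  diff-< {ε} p q r p<q+r r≤ε = begin-strict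
    p ℚ.- q          <⟨ ℚ.+-monoˡ-< (ℚ.- q) p<q+r ⟩
    q ℚ.+ r ℚ.- q    ≡⟨ solve 2 (λ x y → x :+ y :- x := y) refl q r ⟩
    r                ≤⟨ r≤ε ⟩
    ε                ∎
    where open ℚ.≤-Reasoning

  abstract
    1/√-cauchy : ∀ k → IsCauchy (1/√-approx (suc k))
    1/√-cauchy k ε 0<ε =
      let a     = 1/√-approx (suc k)
          N , h = archimedean ε 0<ε
      in N , λ m n p q → abs-< (a m) (a n)
           (diff-< (a m) (a n) (+ 1 ℚ./ suc n) (approx-close k m n) (h n q))
           (diff-< (a n) (a m) (+ 1 ℚ./ suc m) (approx-close k n m) (h m p))

open InvSqrtLemmas

-- The positive real number 1/√k.  The value at k = 0 is a convention; it
-- does not affect the boundary matrix, whose rows at isolated vertices are 0.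
1/√ : ℕ → ℝ
1/√ zero    = fromℚ 0ℚ
1/√ (suc k) = mkℝ (1/√-approx (suc k)) (1/√-cauchy k)

infix 5 _+i_
record ℂ : Set where
  constructor _+i_
  field
    re im : ℝ

open ℂ public

ℂ-rawRing : RawRing 0ℓ 0ℓ
ℂ-rawRing = record
  { Carrier = ℂ
  ; _≈_ = λ z w → re z ≈ᴿ re w × im z ≈ᴿ im w
  ; _+_ = λ z w → (re z + re w) +i (im z + im w)
  ; _*_ = λ z w → (re z * re w + - (im z * im w)) +i (re z * im w + im z * re w)
  ; -_  = λ z → (- re z) +i (- im z)
  ; 0#  = 0# +i 0#
  ; 1#  = 1# +i 0#
  }
  where open ℝ-ring

module ℂ-ring = RawRing ℂ-rawRing

fromℝ : ℝ → ℂ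
fromℝ x = x +i ℝ-ring.0#

conj : ℂ → ℂ
conj z = re z +i (ℝ-ring.- im z)

record Finite (I : Set) : Set where
  field
    size        : ℕ
    enumeration : Fin size ↔ I

  _≟_ : DecidableEquality I
  _≟_ = via-injection (↔⇒↣ (↔-sym enumeration)) Fin._≟_

open Finite {{...}} public using (_≟_)

instance
  Finite-Fin : ∀ {n} → Finite (Fin n)
  Finite-Fin {n} = record { size = n ; enumeration = mk↔ₛ′ (λ i → i) (λ i → i) (λ _ → refl) (λ _ → refl) }

Finite-T : ∀ b → Finite (T b)
Finite-T true  = record { size = 1 ; enumeration = mk↔ₛ′ (λ _ → tt) (λ _ → zero) (λ _ → refl) (λ { zero → refl }) }
Finite-T false = record { size = 0 ; enumeration = mk↔ₛ′ (λ ()) (λ ()) (λ ()) (λ ()) }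

Finite-Σ : ∀ {n} {P : Fin n → Set} → (∀ i → Finite (P i)) → Finite (Σ (Fin n) P)
Finite-Σ {zero}  f = record { size = 0 ; enumeration = mk↔ₛ′ (λ ()) (λ ()) (λ ()) (λ ()) }
Finite-Σ {suc n} {P} f = record
  { size        = Finite.size head ℕ.+ Finite.size tail
  ; enumeration = cons ↔-∘ ((Finite.enumeration head ⊎-↔ Finite.enumeration tail)
      ↔-∘ Fin.+↔⊎ {Finite.size head})
  }
  where
  head = f zero
  tail = Finite-Σ (f ∘ suc)
  cons : (P zero ⊎ Σ (Fin n) (P ∘ suc)) ↔ Σ (Fin (suc n)) P
  cons = mk↔ₛ′
    (λ { (inj₁ p) → zero , p ; (inj₂ (i , p)) → suc i , p })
    (λ { (zero , p) → inj₁ p ; (suc i , p) → inj₂ (i , p) })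
    (λ { (zero , p) → refl ; (suc i , p) → refl })
    (λ { (inj₁ p) → refl ; (inj₂ (i , p)) → refl })

module Matrices (R : RawRing 0ℓ 0ℓ) where
  open RawRing R
  open RawSemiringDefs rawSemiring using (sum; _^_)

  Matrix : Set → Set → Set
  Matrix I J = I → J → Carrier

  infix 4 _≈ᴹ_
  _≈ᴹ_ : ∀ {I J} → Matrix I J → Matrix I J → Set
  A ≈ᴹ B = ∀ i j → A i j ≈ B i j

  δ : ∀ {I} {{_ : Finite I}} → I → I → Carrier
  δ i j = if does (i ≟ j) then 1# else 0#

  Id : ∀ {I} {{_ : Finite I}} → Matrix I I
  Id = δ

  infixl 6 _-ᴹ_
  _-ᴹ_ : ∀ {I J} → Matrix I J → Matrix I J → Matrix I J
  (A -ᴹ B) i j = A i j + - B i j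

  infixr 8 _•_
  _•_ : ∀ {I J} → Carrier → Matrix I J → Matrix I J
  (c • A) i j = c * A i j

  sumOver : ∀ {J} {{_ : Finite J}} → (J → Carrier) → Carrier
  sumOver {{F}} f = sum (f ∘ Inverse.to (Finite.enumeration F))

  infixl 7 _·_
  _·_ : ∀ {I J K} {{_ : Finite J}} → Matrix I J → Matrix J K → Matrix I K
  (A · B) i k = sumOver (λ j → A i j * B j k)

  infixr 8 _^ᴹ_
  _^ᴹ_ : ∀ {I} {{_ : Finite I}} → Matrix I I → ℕ → Matrix I I
  A ^ᴹ zero  = Id
  A ^ᴹ suc τ = A · (A ^ᴹ τ)

  -- Laplace expansion along the first row.
  det : ∀ {n} → Matrix (Fin n) (Fin n) → Carrier
  det {zero}  A = 1#
  det {suc n} A = sum λ j →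
    (- 1#) ^ toℕ j * (A zero j * det (λ i l → A (suc i) (punchIn j l)))

-- Polynomials as coefficient lists, constant term first, compared
-- coefficientwise (so trailing zeros are irrelevant).
module Polynomials (R : RawRing 0ℓ 0ℓ) where
  open RawRing R

  Poly : Set
  Poly = List Carrier

  coeff : Poly → ℕ → Carrier
  coeff []      _       = 0#
  coeff (a ∷ p) zero    = a
  coeff (a ∷ p) (suc i) = coeff p i

  infixl 6 _+ₚ_
  _+ₚ_ : Poly → Poly → Poly
  []      +ₚ q       = q
  (a ∷ p) +ₚ []      = a ∷ p
  (a ∷ p) +ₚ (b ∷ q) = a + b ∷ p +ₚ q

  infixl 7 _*ₚ_
  _*ₚ_ : Poly → Poly → Poly
  []      *ₚ q = []
  (a ∷ p) *ₚ q = List.map (a *_) q +ₚ (0# ∷ p *ₚ q)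

  polyRing : RawRing 0ℓ 0ℓ
  polyRing = record
    { Carrier = Poly
    ; _≈_ = λ p q → ∀ i → coeff p i ≈ coeff q i
    ; _+_ = _+ₚ_
    ; _*_ = _*ₚ_
    ; -_  = List.map (λ a → - a)
    ; 0#  = []
    ; 1#  = 1# ∷ []
    }

  X : Poly
  X = 0# ∷ 1# ∷ []

  C : Carrier → Poly
  C a = a ∷ []

module Spectrum where
  open Matrices ℝ-rawRing using (Matrix)
  open Polynomials ℝ-rawRing
  open RawRing polyRing
  open Matrices polyRing using (det; Id; _•_; _-ᴹ_)

  charPoly : ∀ {n} → Matrix (Fin n) (Fin n) → Poly
  charPoly A = det (X • Id -ᴹ (λ i j → C (A i j)))

  -- Λ lists the eigenvalues of A with algebraic multiplicity:
  -- det (X I − A) = ∏_{λ ∈ Λ} (X − λ).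
  HasSpectrum : ∀ {n} → Matrix (Fin n) (Fin n) → List ℝ → Set
  HasSpectrum A Λ = charPoly A ≈ List.foldr (λ a p → (X + - C a) * p) 1# Λ

open Spectrum public

record Graph (n : ℕ) : Set where
  field
    adj    : Fin n → Fin n → Bool
    symm   : ∀ x y → adj x y ≡ adj y x
    irrefl : ∀ x → adj x x ≡ false

  _~_ : Fin n → Fin n → Set
  x ~ y = T (adj x y)

  deg : Fin n → ℕ
  deg x = length (filter (λ y → T? (adj x y)) (allFin n))

open Graph public using (adj; deg)

module _ {n : ℕ} (Γ : Graph n) where
  open Graph Γ using (_~_)

  Connected : Set
  Connected = ∀ x y → Star _~_ x y

  Bipartite : Set
  Bipartite = Σ[ c ∈ (Fin n → Bool) ] (∀ x y → x ~ y → c x ≢ c y)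

  Regular : ℕ → Set
  Regular k = ∀ x → deg Γ x ≡ k

  adjacencyMatrix : Fin n → Fin n → ℝ
  adjacencyMatrix x y = if adj Γ x y then ℝ-ring.1# else ℝ-ring.0#

infix 4 _≅_
_≅_ : ∀ {n m} → Graph n → Graph m → Set
_≅_ {n} {m} Γ Δ = Σ[ f ∈ (Fin n ↔ Fin m) ]
  (∀ x y → adj Γ x y ≡ adj Δ (Inverse.to f x) (Inverse.to f y))

-- Vertices x and y are adjacent iff y ≡ x + 1 or x ≡ y + 1 modulo n.
cycle : ∀ n {_ : True (3 ℕ.≤? n)} → Graph n
cycle n@(suc (suc (suc m))) = record
  { adj    = λ x y → next x y ∨ next y x
  ; symm   = λ x y → ∨-comm (next x y) (next y x)
  ; irrefl = λ x → cong₂ _∨_ (next-irrefl x) (next-irrefl x)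
  }
  where
  next : Fin n → Fin n → Bool
  next x y = suc (toℕ x) % n ≡ᵇ toℕ y

  ≢⇒≡ᵇ-false : ∀ a b → a ≢ b → (a ≡ᵇ b) ≡ false
  ≢⇒≡ᵇ-false a b a≢b with a ≡ᵇ b in eq
  ... | false = refl
  ... | true  = ⊥-elim (a≢b (ℕ.≡ᵇ⇒≡ a b (subst T (sym eq) tt)))

  suc%≢ : ∀ a → a ℕ.< n → suc a % n ≢ a
  suc%≢ a (s≤s a≤) eq with ℕ.m≤n⇒m<n∨m≡n a≤
  ... | inj₁ a<  = ℕ.1+n≢n (trans (sym (m≤n⇒m%n≡m a<)) eq)
  ... | inj₂ refl with trans (sym (n%n≡0 n)) eq
  ...   | ()

  next-irrefl : ∀ x → next x x ≡ false
  next-irrefl x = ≢⇒≡ᵇ-false _ _ (suc%≢ (toℕ x) (Fin.toℕ<n x))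

record Arc {n : ℕ} (Γ : Graph n) : Set where
  constructor arc
  field
    origin terminus : Fin n
    isEdge          : T (adj Γ origin terminus)

module Grover {n : ℕ} (Γ : Graph n) where
  open Arc
  open Matrices ℂ-rawRing
  open ℂ-ring using (_*_; _+_; 1#)

  _⁻¹ : Arc Γ → Arc Γ
  arc x y e ⁻¹ = arc y x (subst T (Graph.symm Γ x y) e)

  instance
    Finite-Arc : Finite (Arc Γ)
    Finite-Arc = record
      { size        = Finite.size F
      ; enumeration = mk↔ₛ′ (λ { (x , y , e) → arc x y e }) (λ { (arc x y e) → x , y , e })
                                (λ _ → refl) (λ _ → refl)
                        ↔-∘ Finite.enumeration F
      }
      where
      F : Finite (Σ (Fin n) λ x → Σ (Fin n) λ y → T (adj Γ x y))
      F = Finite-Σ λ x → Finite-Σ λ y → Finite-T (adj Γ x y)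

  boundary : Matrix (Fin n) (Arc Γ)
  boundary x e = fromℝ (1/√ (deg Γ x)) * δ x (terminus e)

  boundary* : Matrix (Arc Γ) (Fin n)
  boundary* e x = conj (boundary x e)

  shift : Matrix (Arc Γ) (Arc Γ)
  shift e f = δ e (f ⁻¹)

  U : Matrix (Arc Γ) (Arc Γ)
  U = shift · ((1# + 1#) • (boundary* · boundary) -ᴹ Id)

  Periodic : Set
  Periodic = ∃[ τ ] (1 ℕ.≤ τ × U ^ᴹ τ ≈ᴹ Id)

open Grover public using (Periodic)

{-# OPTIONS --safe #-}
module Submission where

-- Reading det (X - A) det (- X - A) = det (A² - X²) off its top coefficients, the spectrum gives
-- n = 2 + 2 M and tr A² = n k = 2 k² + 2 M θ², where M = n / 2 - 1; so θ² is rational.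
-- For the walk, F₀ = d*, Fⱼ₊₁ = U Fⱼ satisfies Fⱼ₊₂ = 2 Fⱼ₊₁ (A / k) - Fⱼ, hence d Uʲ d* = Tⱼ (A / k) with Tⱼ
-- the Chebyshev polynomial.  If U^τ = 1, then (1 - T₂τ (θ / k)) · 1 is a multiple of the singular matrix
-- θ - A, so T₂τ (θ / k) = 1 and 4 θ² / k² is a rational algebraic integer, that is, an integer Y ≥ 1.
-- Then M Y k + 4 k = 4 + 4 M leaves k = 1 (where θ = ± k), k = 3 (where θ² = 9 / 4, although det A is an
-- integer), and k = 2 with n = 6, where following the edges of the graph closes up to a hexagon.
-- Conversely, on C₆ the walk is the permutation of the arcs that rotates the cycle, of order 6.

open import Defs
open import Algebra.Bundles using (CommutativeRing; RawRing)
import Algebra.Definitions.RawSemiring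
import Algebra.Morphism.Construct.Composition as Composition
import Algebra.Morphism.Construct.Identity as Identity
open import Algebra.Morphism.Structures using (module RingMorphisms)
import Algebra.Properties.Group
import Algebra.Properties.Ring
import Algebra.Properties.Semiring.Mult.TCOptimised
import Algebra.Properties.Semiring.Sum
import Algebra.Solver.Ring
open import Algebra.Solver.Ring.AlmostCommutativeRing using (fromCommutativeRing; _-Raw-AlmostCommutative⟶_)
open import Data.Bool.Base using (if_then_else_; true; false; Bool; T; not; _∨_)
import Data.Bool.Properties as Bool
open import Data.Bool.Properties using (T?; T-irrelevant)
open import Data.Empty using (⊥-elim; ⊥)
open import Data.Fin.Base using (Fin; zero; suc; toℕ; punchIn; punchOut; inject₁; splitAt)
open import Data.Fin.Patterns using (0F; 1F; 2F; 3F; 4F; 5F)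
import Data.Fin.Properties as Fin
open import Data.Integer.Base as ℤ using (ℤ; +_; -[1+_]; +<+; +≤+)
import Data.Integer.Properties as ℤ
open import Data.Integer.Solver using ()
  renaming (module +-*-Solver to ℤ-Solver)
open import Data.List.Base as List using (List; []; _∷_; foldr; length; filter; tabulate; allFin; _++_; replicate)
open import Data.List.Membership.Propositional using (_∈_)
open import Data.List.Membership.Propositional.Properties using (∈-filter⁺; ∈-filter⁻; ∈-allFin)
open import Data.List.Properties using (length-++; length-replicate; ++-identityʳ)
open import Data.List.Relation.Unary.All using ([]; _∷_)
open import Data.List.Relation.Unary.AllPairs using (AllPairs; []; _∷_)
open import Data.List.Relation.Unary.Any using (here; there; index)
open import Data.List.Relation.Unary.Any.Properties using (lookup-index)
import Data.List.Relation.Unary.Unique.Propositional.Properties as Unique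
open import Data.Maybe.Base using (Maybe; just; nothing)
open import Data.Nat.Base as ℕ using (ℕ; zero; suc; z≤n; s≤s; _⊔_; _≤_; _∸_; _/_)
open import Data.Nat.Coprimality using (Coprime; coprime-divisor)
  renaming (sym to coprime-sym; recompute to coprime-recompute)
import Data.Nat.Divisibility as ℕ
import Data.Nat.Properties as ℕ
open import Data.Nat.Solver using ()
  renaming (module +-*-Solver to ℕ-Solver)
open import Data.Product.Base using (_,_; Σ; ∃-syntax; _×_; proj₁; proj₂; Σ-syntax)
open import Data.Rational as ℚ using (ℚ; 0ℚ; 1ℚ; ½; toℚᵘ; mkℚ; ↥_; ↧_; ↧ₙ_)
import Data.Rational.Properties as ℚ
open import Data.Rational.Solver using ()
  renaming (module +-*-Solver to ℚ-Solver)
open import Data.Rational.Unnormalised.Base as ℚᵘ using (mkℚᵘ; *≤*; *<*; *≡*)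
import Data.Rational.Unnormalised.Properties as ℚᵘ
open import Data.Sum.Base as Sum using (inj₁; inj₂; _⊎_)
open import Data.Unit.Base using (tt)
open import Data.Vec.Functional using (Vector; insertAt)
  renaming (_∷_ to _∷ᵛ_)
open import Data.Vec.Functional.Properties using (insertAt-lookup; insertAt-punchIn)
open import Function.Base using (_∘_; id)
open import Function.Bundles using (Inverse; mk↔ₛ′; _⇔_; mk⇔)
open import Level using (0ℓ)
open import Relation.Binary.Bundles using (Setoid)
open import Relation.Binary.Construct.Closure.ReflexiveTransitive using (Star)
open import Relation.Binary.Definitions using (Tri; tri<; tri≈; tri>)
open import Relation.Binary.PropositionalEquality as ≡ using (_≡_; _≢_)
import Relation.Binary.Reasoning.Setoid
open import Relation.Nullary.Decidable using (yes; no; dec-true; dec-false; does; toSum; Dec; from-no; from-yes; _→-dec_; _⊎-dec_; _×-dec_; ¬?)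
open import Relation.Nullary.Negation using (¬_)

-- Equality of Cauchy reals cannot be decided and `≉ᴿ` is a bare negation, so no eigenvector is ever
-- chosen. The eigenvalue θ enters only as det (θ - A) = 0: from (1 - c) · 1 = (θ - A) C,
-- multiplicativity of the determinant gives (1 - c)ⁿ = 0, and for rational c this forces c = 1. The
-- doubled index is what makes c rational: T₂τ (x) = T_τ (2 x² - 1) sees θ only through θ², while θ
-- itself may be irrational. The product det (X - A) det (- X - A) is preferred to det (X - A)
-- because tr A² is, up to sign, its coefficient next to the top in powers of X²; in det (X - A) the
-- trace of A² appears only inside sums of 2 by 2 minors. Algebra is done over arbitrary commutative
-- rings and carried along homomorphisms between ℤ, ℚ, ℝ, ℂ and ℝ[X]. Of the reals themselves little
-- is used: rationals embed injectively, two factors that are not 0 have a product that is not 0,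
-- squares are not negative, and k (1/√k)² = 1.

double : ℕ → ℕ
double zero    = zero
double (suc n) = suc (suc (double n))

-- Ring identities with integer coefficients over any commutative ring.

module IntegerSolver (R : CommutativeRing 0ℓ 0ℓ) where
  open CommutativeRing R
  open Algebra.Properties.Ring ring
  open Algebra.Properties.Semiring.Mult.TCOptimised semiring renaming (_×_ to _·_)
  open Relation.Binary.Reasoning.Setoid setoid

  ⟦_⟧ : ℤ → Carrier
  ⟦ + n ⟧      = n · 1#
  ⟦ -[1+ n ] ⟧ = - (suc n · 1#)

  ⊖-homo : ∀ m n → ⟦ m ℤ.⊖ n ⟧ ≈ m · 1# - n · 1#
  ⊖-homo m zero = sym (trans (+-congˡ -0#≈0#) (+-identityʳ _))
  ⊖-homo zero (suc n) = sym (+-identityˡ _)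
  ⊖-homo (suc m) (suc n) = begin
    ⟦ suc m ℤ.⊖ suc n ⟧                       ≡⟨ ≡.cong ⟦_⟧ (ℤ.[1+m]⊖[1+n]≡m⊖n m n) ⟩
    ⟦ m ℤ.⊖ n ⟧                               ≈⟨ ⊖-homo m n ⟩
    m · 1# - n · 1#                           ≈⟨ +-congˡ (trans (sym (+-identityˡ _)) (+-congʳ (sym (-‿inverseʳ 1#)))) ⟩
    m · 1# + (1# - 1# - n · 1#)               ≈⟨ +-congˡ (trans (+-congˡ (sym (-‿+-comm 1# _))) (sym (+-assoc _ _ _))) ⟨
    m · 1# + (1# - (1# + n · 1#))             ≈⟨ +-assoc _ _ _ ⟨
    m · 1# + 1# - (1# + n · 1#)               ≈⟨ +-cong (trans (+-comm _ _) (sym (1+× m 1#))) (-‿cong (sym (1+× n 1#))) ⟩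
    suc m · 1# - suc n · 1#                   ∎

  -‿homo : ∀ i → ⟦ ℤ.- i ⟧ ≈ - ⟦ i ⟧
  -‿homo (+ zero)   = sym -0#≈0#
  -‿homo (+ suc n)  = refl
  -‿homo -[1+ n ]   = sym (-‿involutive _)

  +-homo : ∀ i j → ⟦ i ℤ.+ j ⟧ ≈ ⟦ i ⟧ + ⟦ j ⟧
  +-homo (+ m)    (+ n)    = ×-homo-+ 1# m n
  +-homo (+ m)    -[1+ n ] = ⊖-homo m (suc n)
  +-homo -[1+ m ] (+ n)    = trans (⊖-homo n (suc m)) (+-comm _ _)
  +-homo -[1+ m ] -[1+ n ] = begin
    - (suc (suc (m ℕ.+ n)) · 1#)       ≡⟨ ≡.cong (λ k → - (suc k · 1#)) (≡.sym (ℕ.+-suc m n)) ⟩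
    - ((suc m ℕ.+ suc n) · 1#)         ≈⟨ -‿cong (×-homo-+ 1# (suc m) (suc n)) ⟩
    - (suc m · 1# + suc n · 1#)        ≈⟨ -‿+-comm _ _ ⟨
    - (suc m · 1#) - (suc n · 1#)      ∎

  *-homo-+ : ∀ m j → ⟦ + m ℤ.* j ⟧ ≈ ⟦ + m ⟧ * ⟦ j ⟧
  *-homo-+ m (+ n) = trans (reflexive (≡.cong ⟦_⟧ (≡.sym (ℤ.pos-* m n)))) (×1-homo-* m n)
  *-homo-+ m -[1+ n ] = begin
    ⟦ + m ℤ.* -[1+ n ] ⟧       ≡⟨ ≡.cong ⟦_⟧ (ℤ.neg-distribʳ-* (+ m) (+ suc n)) ⟨
    ⟦ ℤ.- (+ m ℤ.* + suc n) ⟧  ≈⟨ -‿homo (+ m ℤ.* + suc n) ⟩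
    - ⟦ + m ℤ.* + suc n ⟧      ≈⟨ -‿cong (*-homo-+ m (+ suc n)) ⟩
    - (⟦ + m ⟧ * ⟦ + suc n ⟧)  ≈⟨ -‿distribʳ-* _ _ ⟩
    ⟦ + m ⟧ * - ⟦ + suc n ⟧    ∎

  *-homo : ∀ i j → ⟦ i ℤ.* j ⟧ ≈ ⟦ i ⟧ * ⟦ j ⟧
  *-homo (+ m) j = *-homo-+ m j
  *-homo -[1+ m ] j = begin
    ⟦ -[1+ m ] ℤ.* j ⟧         ≡⟨ ≡.cong ⟦_⟧ (ℤ.neg-distribˡ-* (+ suc m) j) ⟨
    ⟦ ℤ.- (+ suc m ℤ.* j) ⟧    ≈⟨ -‿homo (+ suc m ℤ.* j) ⟩
    - ⟦ + suc m ℤ.* j ⟧        ≈⟨ -‿cong (*-homo-+ (suc m) j) ⟩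
    - (⟦ + suc m ⟧ * ⟦ j ⟧)    ≈⟨ -‿distribˡ-* _ _ ⟩
    - ⟦ + suc m ⟧ * ⟦ j ⟧      ∎

  morphism : ℤ.+-*-rawRing -Raw-AlmostCommutative⟶ fromCommutativeRing R
  morphism = record
    { ⟦_⟧ = ⟦_⟧ ; +-homo = +-homo ; *-homo = *-homo ; -‿homo = -‿homo
    ; 0-homo = refl ; 1-homo = refl }

  -- Coefficients are compared in ℤ, so normal forms can cancel even over rings, such as the Cauchy
  -- reals, whose own equality cannot be tested.
  weaklyDecidable : ∀ i j → Maybe (⟦ i ⟧ ≈ ⟦ j ⟧)
  weaklyDecidable i j with i ℤ.≟ j
  ... | yes i≡j = just (reflexive (≡.cong ⟦_⟧ i≡j))
  ... | no _    = nothing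

  open Algebra.Solver.Ring ℤ.+-*-rawRing (fromCommutativeRing R) morphism weaklyDecidable public
    using (solve; _:+_; _:*_; _:-_; :-_; _:=_; con)

-- The determinant as the universal alternating multilinear form, and its multiplicativity.

module Determinants (R : CommutativeRing 0ℓ 0ℓ) where
  open CommutativeRing R hiding (zero)
  open Algebra.Properties.Ring ring
  open Algebra.Properties.Semiring.Sum semiring
  open Algebra.Definitions.RawSemiring (RawRing.rawSemiring rawRing) using (_^_)
  open IntegerSolver R using (solve; _:+_; _:*_; _:-_; :-_; _:=_; con)
  open Matrices rawRing using (Matrix; _≈ᴹ_; δ; Id; det; _·_)
  open Relation.Binary.Reasoning.Setoid setoid

  Row : ℕ → Set
  Row = Vector Carrier

  sum-zero : ∀ {n} {f : Row n} → (∀ i → f i ≈ 0#) → sum f ≈ 0#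
  sum-zero {n} f≈0 = trans (sum-cong-≋ f≈0) (sum-replicate-zero n)

  infixl 6 _[_↦_]
  _[_↦_] : ∀ {A : Set} {n} → Vector A n → Fin n → A → Vector A n
  (A [ zero  ↦ u ]) zero    = u
  (A [ zero  ↦ u ]) (suc i) = A (suc i)
  (A [ suc r ↦ u ]) zero    = A zero
  (A [ suc r ↦ u ]) (suc i) = (A ∘ suc [ r ↦ u ]) i

  ↦-lookup : ∀ {A : Set} {n} (M : Vector A n) r u → (M [ r ↦ u ]) r ≡ u
  ↦-lookup M zero u    = ≡.refl
  ↦-lookup M (suc r) u = ↦-lookup (M ∘ suc) r u

  ↦-map : ∀ {A B : Set} {n} (f : A → B) (M : Vector A n) r u i →
    f ((M [ r ↦ u ]) i) ≡ ((f ∘ M) [ r ↦ f u ]) i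
  ↦-map f M zero    u zero    = ≡.refl
  ↦-map f M zero    u (suc i) = ≡.refl
  ↦-map f M (suc r) u zero    = ≡.refl
  ↦-map f M (suc r) u (suc i) = ↦-map f (M ∘ suc) r u i

  ↦-congʳ : ∀ {k m} r (M : Matrix (Fin k) (Fin m)) {u v} → (∀ l → u l ≈ v l) → (M [ r ↦ u ]) ≈ᴹ (M [ r ↦ v ])
  ↦-congʳ zero    M u≈v zero    = u≈v
  ↦-congʳ zero    M u≈v (suc i) = λ _ → refl
  ↦-congʳ (suc r) M u≈v zero    = λ _ → refl
  ↦-congʳ (suc r) M u≈v (suc i) = ↦-congʳ r (M ∘ suc) u≈v i

  -- Rows and columns are counted separately so that fixing the first row gives a form of the same
  -- kind with one row less. Respect for `≈ᴹ` is a field because entries are compared by a setoid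
  -- equality.
  record Multilinear {k m} (D : Matrix (Fin k) (Fin m) → Carrier) : Set where
    field
      cong   : ∀ {A B} → A ≈ᴹ B → D A ≈ D B
      linear : ∀ r a u v A →
        D (A [ r ↦ (λ j → a * u j + v j) ]) ≈ a * D (A [ r ↦ u ]) + D (A [ r ↦ v ])

  -- Vanishing on equal rows is required instead of a change of sign under exchange, which is weaker
  -- when 2 may be a zero divisor.
  record Alternating {k m} (D : Matrix (Fin k) (Fin m) → Carrier) : Set where
    field
      multilinear : Multilinear D
      alternating : ∀ A {r s} → r ≢ s → (∀ j → A r j ≈ A s j) → D A ≈ 0#
    open Multilinear multilinear public

  ≈ᴹ-cons : ∀ {k m} {A B : Matrix (Fin (suc k)) (Fin m)} →
    (∀ j → A zero j ≈ B zero j) → (∀ i j → A (suc i) j ≈ B (suc i) j) → A ≈ᴹ B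
  ≈ᴹ-cons h t zero    = h
  ≈ᴹ-cons h t (suc i) = t i

  module _ {k m} {D : Matrix (Fin (suc k)) (Fin m) → Carrier} where

    fixRow : Multilinear D → ∀ u → Multilinear (λ A → D (u ∷ᵛ A))
    fixRow mult u = record
      { cong   = λ A≈B → cong (≈ᴹ-cons (λ _ → refl) A≈B)
      ; linear = λ r a v w A → begin
          D (u ∷ᵛ (A [ r ↦ _ ]))                             ≈⟨ eq r A _ ⟩
          D ((u ∷ᵛ A) [ suc r ↦ _ ])                         ≈⟨ linear (suc r) a v w (u ∷ᵛ A) ⟩
          a * D ((u ∷ᵛ A) [ suc r ↦ v ]) + D ((u ∷ᵛ A) [ suc r ↦ w ])
            ≈⟨ +-cong (*-congˡ (eq r A v)) (eq r A w) ⟨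
          a * D (u ∷ᵛ (A [ r ↦ v ])) + D (u ∷ᵛ (A [ r ↦ w ])) ∎
      }
      where
      open Multilinear mult
      eq : ∀ r A v → D (u ∷ᵛ (A [ r ↦ v ])) ≈ D ((u ∷ᵛ A) [ suc r ↦ v ])
      eq r A v = cong (≈ᴹ-cons (λ _ → refl) (λ _ _ → refl))

    fixRow-alternating : Alternating D → ∀ u → Alternating (λ A → D (u ∷ᵛ A))
    fixRow-alternating alt u = record
      { multilinear = fixRow multilinear u
      ; alternating = λ A r≢s Ar≈As → alternating (u ∷ᵛ A) (r≢s ∘ Fin.suc-injective) Ar≈As
      }
      where open Alternating alt

    module _ (mult : Multilinear D) where
      open Multilinear mult

      linearHead : ∀ a u v A → D ((λ j → a * u j + v j) ∷ᵛ A) ≈ a * D (u ∷ᵛ A) + D (v ∷ᵛ A)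
      linearHead a u v A = begin
        D ((λ j → a * u j + v j) ∷ᵛ A)                     ≈⟨ eq _ ⟩
        D ((u ∷ᵛ A) [ zero ↦ (λ j → a * u j + v j) ])      ≈⟨ linear zero a u v (u ∷ᵛ A) ⟩
        a * D ((u ∷ᵛ A) [ zero ↦ u ]) + D ((u ∷ᵛ A) [ zero ↦ v ])
          ≈⟨ +-cong (*-congˡ (eq u)) (eq v) ⟨
        a * D (u ∷ᵛ A) + D (v ∷ᵛ A) ∎
        where
        eq : ∀ w → D (w ∷ᵛ A) ≈ D ((u ∷ᵛ A) [ zero ↦ w ])
        eq w = cong (≈ᴹ-cons (λ _ → refl) (λ _ _ → refl))

      zeroHead : ∀ A → D ((λ _ → 0#) ∷ᵛ A) ≈ 0#
      zeroHead A = +-cancelˡ d d 0# (begin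
        d + d                ≈⟨ +-congʳ (*-identityˡ d) ⟨
        1# * d + d           ≈⟨ linearHead 1# (λ _ → 0#) (λ _ → 0#) A ⟨
        D ((λ _ → 1# * 0# + 0#) ∷ᵛ A)
          ≈⟨ cong (≈ᴹ-cons (λ _ → trans (+-identityʳ _) (zeroʳ 1#)) (λ _ _ → refl)) ⟩
        d                    ≈⟨ +-identityʳ d ⟨
        d + 0#               ∎)
        where d = D ((λ _ → 0#) ∷ᵛ A)

      sumHead : ∀ {l} (c : Row l) (u : Fin l → Row m) A →
        D ((λ j → sum (λ i → c i * u i j)) ∷ᵛ A) ≈ sum (λ i → c i * D (u i ∷ᵛ A))
      sumHead {zero}  c u A = zeroHead A
      sumHead {suc l} c u A = trans
        (linearHead (c zero) (u zero) (λ j → sum (λ i → c (suc i) * u (suc i) j)) A)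
        (+-congˡ (sumHead (c ∘ suc) (u ∘ suc) A))

  module _ {k m} {D : Matrix (Fin (suc (suc k))) (Fin m) → Carrier} (mult : Multilinear D)
           (alt : ∀ u A → D (u ∷ᵛ u ∷ᵛ A) ≈ 0#) where
    open Multilinear mult

    -- Polarisation: on the repeated row u + v only the two mixed terms survive. The assumption
    -- concerns just the two leading rows, since the determinant is fed into this lemma before it is
    -- known to be alternating.
    swap : ∀ u v A → D (u ∷ᵛ v ∷ᵛ A) ≈ - D (v ∷ᵛ u ∷ᵛ A)
    swap u v A = begin
      x                                    ≈⟨ solve 2 (λ x y → x := (x :+ y) :- y) refl x y ⟩
      x + y - y                            ≈⟨ +-congʳ x+y≈0 ⟩
      0# - y                               ≈⟨ +-identityˡ (- y) ⟩
      - y                                  ∎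
      where
      x = D (u ∷ᵛ v ∷ᵛ A)
      y = D (v ∷ᵛ u ∷ᵛ A)
      s : Row m
      s j = 1# * u j + v j
      expand : ∀ w → D (w ∷ᵛ s ∷ᵛ A) ≈ 1# * D (w ∷ᵛ u ∷ᵛ A) + D (w ∷ᵛ v ∷ᵛ A)
      expand w = linearHead (fixRow mult w) 1# u v A
      x+y≈0 : x + y ≈ 0#
      x+y≈0 = begin
        x + y
          ≈⟨ solve 2 (λ x y → x :+ y := con (+ 1) :* (con (+ 1) :* con (+ 0) :+ x) :+ (con (+ 1) :* y :+ con (+ 0))) refl x y ⟩
        1# * (1# * 0# + x) + (1# * y + 0#)
          ≈⟨ +-cong (*-congˡ (+-congʳ (*-congˡ (alt u A)))) (+-congˡ (alt v A)) ⟨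
        1# * (1# * D (u ∷ᵛ u ∷ᵛ A) + x) + (1# * y + D (v ∷ᵛ v ∷ᵛ A))
          ≈⟨ +-cong (*-congˡ (expand u)) (expand v) ⟨
        1# * D (u ∷ᵛ s ∷ᵛ A) + D (v ∷ᵛ s ∷ᵛ A)
          ≈⟨ linearHead mult 1# u v (s ∷ᵛ A) ⟨
        D (s ∷ᵛ s ∷ᵛ A)
          ≈⟨ alt s A ⟩
        0# ∎

  minor : ∀ {n} → Matrix (Fin (suc n)) (Fin (suc n)) → Fin (suc n) → Matrix (Fin n) (Fin n)
  minor A j i l = A (suc i) (punchIn j l)

  sgn : ∀ {n} → Fin n → Carrier
  sgn j = (- 1#) ^ toℕ j

  det-cong : ∀ {n} {A B : Matrix (Fin n) (Fin n)} → A ≈ᴹ B → det A ≈ det B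
  det-cong {zero}  A≈B = refl
  det-cong {suc n} A≈B = sum-cong-≋ λ j →
    *-congˡ {sgn j} (*-cong (A≈B zero j) (det-cong (λ i l → A≈B (suc i) (punchIn j l))))

  det-linear : ∀ {n} r a u v (A : Matrix (Fin n) (Fin n)) →
    det (A [ r ↦ (λ j → a * u j + v j) ]) ≈ a * det (A [ r ↦ u ]) + det (A [ r ↦ v ])
  det-linear {suc n} zero a u v A = begin
    sum (λ j → sgn j * ((a * u j + v j) * M j))
      ≈⟨ sum-cong-≋ (λ j → solve 5 (λ s a x y m → s :* ((a :* x :+ y) :* m) := a :* (s :* (x :* m)) :+ s :* (y :* m)) refl
           (sgn j) a (u j) (v j) (M j)) ⟩
    sum (λ j → a * (sgn j * (u j * M j)) + sgn j * (v j * M j))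
      ≈⟨ ∑-distrib-+ (λ j → a * (sgn j * (u j * M j))) (λ j → sgn j * (v j * M j)) ⟩
    sum (λ j → a * (sgn j * (u j * M j))) + sum (λ j → sgn j * (v j * M j))
      ≈⟨ +-congʳ (*-distribˡ-sum a (λ j → sgn j * (u j * M j))) ⟨
    a * sum (λ j → sgn j * (u j * M j)) + sum (λ j → sgn j * (v j * M j)) ∎
    where
    M : Fin (suc n) → Carrier
    M j = det (minor A j)
  det-linear {suc n} (suc r) a u v A = begin
    sum (λ j → sgn j * (A zero j * det (minor (A [ suc r ↦ w ]) j)))
      ≈⟨ sum-cong-≋ (λ j → *-congˡ {sgn j} (*-congˡ {A zero j} (trans (minor-↦ w j) (det-linear r a (u ∘ punchIn j) (v ∘ punchIn j) (minor A j))))) ⟩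
    sum (λ j → sgn j * (A zero j * (a * P j + Q j)))
      ≈⟨ sum-cong-≋ (λ j → solve 5 (λ s a x p q → s :* (x :* (a :* p :+ q)) := a :* (s :* (x :* p)) :+ s :* (x :* q)) refl
           (sgn j) a (A zero j) (P j) (Q j)) ⟩
    sum (λ j → a * (sgn j * (A zero j * P j)) + sgn j * (A zero j * Q j))
      ≈⟨ ∑-distrib-+ (λ j → a * (sgn j * (A zero j * P j))) (λ j → sgn j * (A zero j * Q j)) ⟩
    sum (λ j → a * (sgn j * (A zero j * P j))) + sum (λ j → sgn j * (A zero j * Q j))
      ≈⟨ +-congʳ (*-distribˡ-sum a (λ j → sgn j * (A zero j * P j))) ⟨
    a * sum (λ j → sgn j * (A zero j * P j)) + sum (λ j → sgn j * (A zero j * Q j))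
      ≈⟨ +-cong (*-congˡ (back u)) (back v) ⟨
    a * det (A [ suc r ↦ u ]) + det (A [ suc r ↦ v ]) ∎
    where
    w : Row (suc n)
    w j = a * u j + v j
    P Q : Fin (suc n) → Carrier
    P j = det (minor A j [ r ↦ u ∘ punchIn j ])
    Q j = det (minor A j [ r ↦ v ∘ punchIn j ])
    minor-↦ : ∀ x j → det (minor (A [ suc r ↦ x ]) j) ≈ det (minor A j [ r ↦ x ∘ punchIn j ])
    minor-↦ x j = det-cong (λ i l → reflexive (≡.cong (λ f → f l) (↦-map (_∘ punchIn j) (A ∘ suc) r x i)))
    back : ∀ x → det (A [ suc r ↦ x ]) ≈ sum (λ j → sgn j * (A zero j * det (minor A j [ r ↦ x ∘ punchIn j ])))
    back x = sum-cong-≋ (λ j → *-congˡ {sgn j} (*-congˡ {A zero j} (minor-↦ x j)))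

  det-multilinear : ∀ {n} → Multilinear (det {n})
  det-multilinear = record { cong = det-cong ; linear = det-linear }

  -- Expanding along two equal rows, the terms in which the columns (i, l) and (l, i) are
  -- removed, written with the shifted indices of punchIn, cancel.
  cancelling-sum : ∀ m (t : Fin (suc m) → Fin m → Carrier) →
    (∀ i l → toℕ i ℕ.≤ toℕ l → t (inject₁ i) l + t (suc l) i ≈ 0#) →
    sum (λ j → sum (t j)) ≈ 0#
  cancelling-sum zero t cancel = +-identityˡ 0#
  cancelling-sum (suc m) t cancel = begin
    sum (t zero) + sum (λ j → t (suc j) zero + sum (λ l → t (suc j) (suc l)))
      ≈⟨ +-congˡ (∑-distrib-+ (λ j → t (suc j) zero) (λ j → sum (λ l → t (suc j) (suc l)))) ⟩
    sum (t zero) + (sum (λ j → t (suc j) zero) + sum (λ j → sum (λ l → t (suc j) (suc l))))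
      ≈⟨ +-assoc _ _ _ ⟨
    sum (t zero) + sum (λ j → t (suc j) zero) + sum (λ j → sum (λ l → t (suc j) (suc l)))
      ≈⟨ +-cong (sym (∑-distrib-+ (t zero) (λ j → t (suc j) zero)))
                (cancelling-sum m (λ j l → t (suc j) (suc l)) (λ i l i≤l → cancel (suc i) (suc l) (s≤s i≤l))) ⟩
    sum (λ l → t zero l + t (suc l) zero) + 0#
      ≈⟨ +-identityʳ _ ⟩
    sum (λ l → t zero l + t (suc l) zero)
      ≈⟨ sum-zero (λ l → cancel zero l z≤n) ⟩
    0# ∎

  punchIn-inject₁ : ∀ {m} (i l : Fin m) → toℕ i ℕ.≤ toℕ l → punchIn (inject₁ i) l ≡ suc l
  punchIn-inject₁ zero    l       _         = ≡.refl
  punchIn-inject₁ (suc i) (suc l) (s≤s i≤l) = ≡.cong suc (punchIn-inject₁ i l i≤l)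

  punchIn-suc : ∀ {m} (i l : Fin m) → toℕ i ℕ.≤ toℕ l → punchIn (suc l) i ≡ inject₁ i
  punchIn-suc zero    l       _         = ≡.refl
  punchIn-suc (suc i) (suc l) (s≤s i≤l) = ≡.cong suc (punchIn-suc i l i≤l)

  -- Both sides skip the columns i and l + 1, removed in the two possible orders.
  punchIn-comm : ∀ {m} (i l : Fin (suc m)) → toℕ i ℕ.≤ toℕ l → ∀ s →
    punchIn (inject₁ i) (punchIn l s) ≡ punchIn (suc l) (punchIn i s)
  punchIn-comm zero    l       _         s       = ≡.refl
  punchIn-comm (suc i) (suc l) (s≤s i≤l) zero    = ≡.refl
  punchIn-comm {suc m} (suc i) (suc l) (s≤s i≤l) (suc s) = ≡.cong suc (punchIn-comm i l i≤l s)

  -- Expanding along both rows gives a sum over ordered pairs of removed columns. Exchanging the two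
  -- columns keeps the minor and the product of entries, but the index `suc l` brings in one more
  -- factor - 1.
  det-equalHeads : ∀ {n} u (A : Fin n → Row (suc (suc n))) → det (u ∷ᵛ u ∷ᵛ A) ≈ 0#
  det-equalHeads {n} u A = begin
    sum (λ j → sgn j * (u j * sum (λ l → sgn l * (u (punchIn j l) * N j l))))
      ≈⟨ sum-cong-≋ (λ j → trans (sym (*-assoc (sgn j) (u j) _))
           (*-distribˡ-sum (sgn j * u j) (λ l → sgn l * (u (punchIn j l) * N j l)))) ⟩
    sum (λ j → sum (t j))
      ≈⟨ cancelling-sum (suc n) t cancel ⟩
    0# ∎
    where
    N : Fin (suc (suc n)) → Fin (suc n) → Carrier
    N j l = det (λ i s → A i (punchIn j (punchIn l s)))
    t : Fin (suc (suc n)) → Fin (suc n) → Carrier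
    t j l = sgn j * u j * (sgn l * (u (punchIn j l) * N j l))
    cancel : ∀ i l → toℕ i ℕ.≤ toℕ l → t (inject₁ i) l + t (suc l) i ≈ 0#
    cancel i l i≤l = begin
      sgn (inject₁ i) * u (inject₁ i) * (sgn l * (u (punchIn (inject₁ i) l) * N (inject₁ i) l))
        + - 1# * sgn l * u (suc l) * (sgn i * (u (punchIn (suc l) i) * N (suc l) i))
        ≈⟨ +-cong (*-cong (*-congʳ (reflexive (≡.cong ((- 1#) ^_) (Fin.toℕ-inject₁ i))))
                    (*-congˡ (*-cong (reflexive (≡.cong u (punchIn-inject₁ i l i≤l)))
                      (det-cong (λ r s → reflexive (≡.cong (A r) (punchIn-comm i l i≤l s)))))))
                  (*-congˡ (*-congˡ (*-congʳ (reflexive (≡.cong u (punchIn-suc i l i≤l)))))) ⟩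
      sgn i * u (inject₁ i) * (sgn l * (u (suc l) * N (suc l) i))
        + - 1# * sgn l * u (suc l) * (sgn i * (u (inject₁ i) * N (suc l) i))
        ≈⟨ solve 5 (λ si sl x y d → si :* x :* (sl :* (y :* d)) :+ :- con (+ 1) :* sl :* y :* (si :* (x :* d)) := con (+ 0))
             refl (sgn i) (sgn l) (u (inject₁ i)) (u (suc l)) (N (suc l) i) ⟩
      0# ∎

  minors-zero : ∀ {n} (A : Matrix (Fin (suc n)) (Fin (suc n))) → (∀ j → det (minor A j) ≈ 0#) → det A ≈ 0#
  minors-zero A zeros = sum-zero λ j →
    trans (*-congˡ {sgn j} (trans (*-congˡ {A zero j} (zeros j)) (zeroʳ _))) (zeroʳ _)

  -- If the copy of the head row lies below the second row, exchanging the first two rows puts the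
  -- head into every minor of the expansion, where its copy is one row closer.
  det-equalToHead : ∀ {n} (A : Matrix (Fin (suc n)) (Fin (suc n))) s → (∀ j → A zero j ≈ A (suc s) j) → det A ≈ 0#
  det-equalToHead A zero A₀≈A₁ = trans
    (det-cong {A = A} {B = A zero ∷ᵛ A zero ∷ᵛ (λ i → A (suc (suc i)))}
      (≈ᴹ-cons (λ _ → refl) (≈ᴹ-cons (λ j → sym (A₀≈A₁ j)) (λ _ _ → refl))))
    (det-equalHeads (A zero) (λ i → A (suc (suc i))))
  det-equalToHead A (suc s) A₀≈As = begin
    det A
      ≈⟨ det-cong {A = A} {B = A zero ∷ᵛ A (suc zero) ∷ᵛ (λ i → A (suc (suc i)))}
           (≈ᴹ-cons (λ _ → refl) (≈ᴹ-cons (λ _ → refl) (λ _ _ → refl))) ⟩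
    det (A zero ∷ᵛ A (suc zero) ∷ᵛ (λ i → A (suc (suc i))))
      ≈⟨ swap det-multilinear det-equalHeads (A zero) (A (suc zero)) (λ i → A (suc (suc i))) ⟩
    - det A′
      ≈⟨ -‿cong (minors-zero A′ (λ j → det-equalToHead (minor A′ j) s (A₀≈As ∘ punchIn j))) ⟩
    - 0#
      ≈⟨ -0#≈0# ⟩
    0# ∎
    where
    A′ = A (suc zero) ∷ᵛ A zero ∷ᵛ (λ i → A (suc (suc i)))

  det-alternating : ∀ {n} (A : Matrix (Fin n) (Fin n)) {r s} → r ≢ s → (∀ j → A r j ≈ A s j) → det A ≈ 0#
  det-alternating A {zero}  {zero}  r≢s _     = ⊥-elim (r≢s ≡.refl)
  det-alternating A {zero}  {suc s} _   A₀≈As = det-equalToHead A s A₀≈As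
  det-alternating A {suc r} {zero}  _   Ar≈A₀ = det-equalToHead A r (λ j → sym (Ar≈A₀ j))
  det-alternating A {suc r} {suc s} r≢s Ar≈As =
    minors-zero A λ j → det-alternating (minor A j) (r≢s ∘ ≡.cong suc) (Ar≈As ∘ punchIn j)

  -- Rows of `A` are traded for rows of `B` one at a time. The surroundings of the traded row are
  -- then a mixture of both, hence the step is assumed for an arbitrary `M`.
  replaceAll : ∀ {k m} (G : Matrix (Fin k) (Fin m) → Carrier) → (∀ {A B} → A ≈ᴹ B → G A ≈ G B) →
    ∀ A B → (∀ r M → G (M [ r ↦ A r ]) ≈ G (M [ r ↦ B r ])) → G A ≈ G B
  replaceAll {zero}  G G-cong A B step = G-cong (λ ())
  replaceAll {suc k} G G-cong A B step = begin
    G A                        ≈⟨ G-cong (≈ᴹ-cons (λ _ → refl) (λ _ _ → refl)) ⟩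
    G (A [ zero ↦ A zero ])    ≈⟨ step zero A ⟩
    G (A [ zero ↦ B zero ])    ≈⟨ G-cong (≈ᴹ-cons (λ _ → refl) (λ _ _ → refl)) ⟩
    G (B zero ∷ᵛ A ∘ suc)
      ≈⟨ replaceAll (λ M → G (B zero ∷ᵛ M)) (λ A≈B → G-cong (≈ᴹ-cons (λ _ → refl) A≈B)) (A ∘ suc) (B ∘ suc)
           (λ r M → trans (G-cong (≈ᴹ-cons (λ _ → refl) (λ _ _ → refl)))
                     (trans (step (suc r) (B zero ∷ᵛ M)) (G-cong (≈ᴹ-cons (λ _ → refl) (λ _ _ → refl))))) ⟩
    G (B zero ∷ᵛ B ∘ suc)      ≈⟨ G-cong (≈ᴹ-cons (λ _ → refl) (λ _ _ → refl)) ⟩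
    G B ∎

  -- Row j bubbles to the top through j adjacent exchanges, each of which contributes a sign.
  moveToHead : ∀ {k m} {D : Matrix (Fin (suc k)) (Fin m) → Carrier} → Alternating D →
    ∀ j A → D (A j ∷ᵛ A ∘ punchIn j) ≈ sgn j * D A
  moveToHead alt zero A =
    trans (cong (≈ᴹ-cons (λ _ → refl) (λ _ _ → refl))) (sym (*-identityˡ _))
    where open Alternating alt
  moveToHead {suc k} {D = D} alt (suc j) A = begin
    D (A (suc j) ∷ᵛ A ∘ punchIn (suc j))
      ≈⟨ cong (≈ᴹ-cons (λ _ → refl) (≈ᴹ-cons (λ _ → refl) (λ _ _ → refl))) ⟩
    D (A (suc j) ∷ᵛ A zero ∷ᵛ A ∘ suc ∘ punchIn j)
      ≈⟨ swap multilinear (λ u B → alternating (u ∷ᵛ u ∷ᵛ B) {zero} {suc zero} (λ ()) (λ _ → refl)) _ _ _ ⟩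
    - D (A zero ∷ᵛ A (suc j) ∷ᵛ A ∘ suc ∘ punchIn j)
      ≈⟨ -‿cong (moveToHead (fixRow-alternating alt (A zero)) j (A ∘ suc)) ⟩
    - (sgn j * D (A zero ∷ᵛ A ∘ suc))
      ≈⟨ -‿cong (*-congˡ (cong (≈ᴹ-cons (λ _ → refl) (λ _ _ → refl)))) ⟩
    - (sgn j * D A)
      ≈⟨ solve 2 (λ s d → :- (s :* d) := :- con (+ 1) :* s :* d) refl (sgn j) (D A) ⟩
    - 1# * sgn j * D A ∎
    where open Alternating alt

  punchIn-cases : ∀ {n} (P : Fin (suc n) → Set) j → P j → (∀ s → P (punchIn j s)) → ∀ l → P l
  punchIn-cases P j Pj Pothers l with j Fin.≟ l
  ... | yes ≡.refl = Pj
  ... | no j≢l     = ≡.subst P (Fin.punchIn-punchOut j≢l) (Pothers (punchOut j≢l))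

  δ-refl : ∀ {I} {{_ : Finite I}} (i : I) → δ i i ≈ 1#
  δ-refl i = reflexive (≡.cong (if_then 1# else 0#) (dec-true (i ≟ i) ≡.refl))

  δ-≢ : ∀ {I} {{_ : Finite I}} {i j : I} → i ≢ j → δ i j ≈ 0#
  δ-≢ {i = i} {j} i≢j = reflexive (≡.cong (if_then 1# else 0#) (dec-false (i ≟ j) i≢j))

  δ-punchIn : ∀ {n} (j : Fin (suc n)) i s → δ (punchIn j i) (punchIn j s) ≈ δ i s
  δ-punchIn zero    i       s       = refl
  δ-punchIn (suc j) zero    zero    = refl
  δ-punchIn (suc j) zero    (suc s) = refl
  δ-punchIn (suc j) (suc i) zero    = refl
  δ-punchIn (suc j) (suc i) (suc s) = δ-punchIn j i s

  sum-δ : ∀ {n} (f : Row n) j → sum (λ i → f i * δ i j) ≈ f j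
  sum-δ {suc n} f zero = begin
    f zero * 1# + sum (λ i → f (suc i) * 0#) ≈⟨ +-cong (*-identityʳ _) (sum-zero (λ i → zeroʳ (f (suc i)))) ⟩
    f zero + 0#                              ≈⟨ +-identityʳ _ ⟩
    f zero                                   ∎
  sum-δ {suc n} f (suc j) = begin
    f zero * 0# + sum (λ i → f (suc i) * δ i j) ≈⟨ +-cong (zeroʳ _) (sum-δ (f ∘ suc) j) ⟩
    0# + f (suc j)                              ≈⟨ +-identityˡ _ ⟩
    f (suc j)                                   ∎

  pad : ∀ {n k} → Fin (suc n) → Matrix (Fin k) (Fin n) → Matrix (Fin k) (Fin (suc n))
  pad j A i = insertAt (A i) j 0#

  module _ {n} {D : Matrix (Fin (suc n)) (Fin (suc n)) → Carrier} (alt : Alternating D) (j : Fin (suc n)) where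
    open Alternating alt

    -- Row reduction against the head `δ j`: the part of a lower row in column j is a multiple of
    -- the head row, and alternation kills its contribution.
    clearColumn : ∀ (A : Matrix (Fin n) (Fin (suc n))) →
      D (δ j ∷ᵛ A) ≈ D (δ j ∷ᵛ pad j (λ i l → A i (punchIn j l)))
    clearColumn A = replaceAll (λ M → D (δ j ∷ᵛ M)) G.cong A (pad j A⁻) λ r M → begin
        D (δ j ∷ᵛ (M [ r ↦ A r ]))
          ≈⟨ G.cong (↦-congʳ r M (split r)) ⟩
        D (δ j ∷ᵛ (M [ r ↦ (λ l → A r j * δ j l + pad j A⁻ r l) ]))
          ≈⟨ G.linear r (A r j) (δ j) (pad j A⁻ r) M ⟩
        A r j * D (δ j ∷ᵛ (M [ r ↦ δ j ])) + D (δ j ∷ᵛ (M [ r ↦ pad j A⁻ r ]))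
          ≈⟨ +-congʳ (trans (*-congˡ (alternating (δ j ∷ᵛ (M [ r ↦ δ j ])) {zero} {suc r} (λ ())
               (λ l → reflexive (≡.cong (λ f → f l) (≡.sym (↦-lookup M r (δ j))))))) (zeroʳ _)) ⟩
        0# + D (δ j ∷ᵛ (M [ r ↦ pad j A⁻ r ]))
          ≈⟨ +-identityˡ _ ⟩
        D (δ j ∷ᵛ (M [ r ↦ pad j A⁻ r ])) ∎
      where
      module G = Multilinear (fixRow multilinear (δ j))
      A⁻ : Matrix (Fin n) (Fin n)
      A⁻ i l = A i (punchIn j l)
      split : ∀ r l → A r l ≈ A r j * δ j l + pad j A⁻ r l
      split r = punchIn-cases _ j
        (begin
          A r j                             ≈⟨ solve 1 (λ a → a := a :* con (+ 1) :+ con (+ 0)) refl (A r j) ⟩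
          A r j * 1# + 0#                   ≈⟨ +-cong (*-congˡ (δ-refl j)) (reflexive (insertAt-lookup (A⁻ r) j 0#)) ⟨
          A r j * δ j j + pad j A⁻ r j      ∎)
        (λ s → begin
          A⁻ r s                            ≈⟨ solve 2 (λ a b → a := b :* con (+ 0) :+ a) refl (A⁻ r s) (A r j) ⟩
          A r j * 0# + A⁻ r s
            ≈⟨ +-cong (*-congˡ (δ-≢ (Fin.punchInᵢ≢i j s ∘ ≡.sym))) (reflexive (insertAt-punchIn (A⁻ r) j 0# s)) ⟨
          A r j * δ j (punchIn j s) + pad j A⁻ r (punchIn j s) ∎)

    -- With column j cleared, the remaining block of size n is itself the argument of an alternating
    -- form, to which induction applies.
    pad-alternating : Alternating (λ A → D (δ j ∷ᵛ pad j A))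
    pad-alternating = record
      { multilinear = record
        { cong   = λ A≈B → G.cong (λ i → padCong (A≈B i))
        ; linear = λ r a u v A → begin
            D (δ j ∷ᵛ pad j (A [ r ↦ (λ l → a * u l + v l) ]))
              ≈⟨ G.cong (λ i l → reflexive (≡.cong (λ f → f l) (↦-map (λ w → insertAt w j 0#) A r _ i))) ⟩
            D (δ j ∷ᵛ (pad j A [ r ↦ insertAt (λ l → a * u l + v l) j 0# ]))
              ≈⟨ G.cong (↦-congʳ r (pad j A) (padLinear a u v)) ⟩
            D (δ j ∷ᵛ (pad j A [ r ↦ (λ l → a * insertAt u j 0# l + insertAt v j 0# l) ]))
              ≈⟨ G.linear r a (insertAt u j 0#) (insertAt v j 0#) (pad j A) ⟩
            a * D (δ j ∷ᵛ (pad j A [ r ↦ insertAt u j 0# ])) + D (δ j ∷ᵛ (pad j A [ r ↦ insertAt v j 0# ]))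
              ≈⟨ +-cong (*-congˡ (G.cong (λ i l → reflexive (≡.cong (λ f → f l) (↦-map (λ w → insertAt w j 0#) A r u i)))))
                        (G.cong (λ i l → reflexive (≡.cong (λ f → f l) (↦-map (λ w → insertAt w j 0#) A r v i)))) ⟨
            a * D (δ j ∷ᵛ pad j (A [ r ↦ u ])) + D (δ j ∷ᵛ pad j (A [ r ↦ v ])) ∎
        }
      ; alternating = λ A r≢s Ar≈As → Alternating.alternating (fixRow-alternating alt (δ j)) (pad j A) r≢s (padCong Ar≈As)
      }
      where
      module G = Multilinear (fixRow multilinear (δ j))
      padCong : ∀ {u v : Row n} → (∀ l → u l ≈ v l) → ∀ l → insertAt u j 0# l ≈ insertAt v j 0# l
      padCong {u} {v} u≈v = punchIn-cases _ j
        (reflexive (≡.trans (insertAt-lookup u j 0#) (≡.sym (insertAt-lookup v j 0#))))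
        (λ s → trans (reflexive (insertAt-punchIn u j 0# s)) (trans (u≈v s) (reflexive (≡.sym (insertAt-punchIn v j 0# s)))))
      padLinear : ∀ a u v l → insertAt (λ l → a * u l + v l) j 0# l ≈ a * insertAt u j 0# l + insertAt v j 0# l
      padLinear a u v = punchIn-cases _ j
        (begin
          insertAt (λ l → a * u l + v l) j 0# j  ≡⟨ insertAt-lookup (λ l → a * u l + v l) j 0# ⟩
          0#                                     ≈⟨ solve 1 (λ a → con (+ 0) := a :* con (+ 0) :+ con (+ 0)) refl a ⟩
          a * 0# + 0#
            ≈⟨ +-cong (*-congˡ (reflexive (insertAt-lookup u j 0#))) (reflexive (insertAt-lookup v j 0#)) ⟨
          a * insertAt u j 0# j + insertAt v j 0# j ∎)
        (λ s → begin
          insertAt (λ l → a * u l + v l) j 0# (punchIn j s)  ≡⟨ insertAt-punchIn (λ l → a * u l + v l) j 0# s ⟩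
          a * u s + v s
            ≈⟨ +-cong (*-congˡ (reflexive (insertAt-punchIn u j 0# s))) (reflexive (insertAt-punchIn v j 0# s)) ⟨
          a * insertAt u j 0# (punchIn j s) + insertAt v j 0# (punchIn j s) ∎)

    pad-Id : D (δ j ∷ᵛ pad j Id) ≈ sgn j * D Id
    pad-Id = trans
      (cong (≈ᴹ-cons (λ _ → refl) (λ i → punchIn-cases _ j
        (trans (reflexive (insertAt-lookup (δ i) j 0#)) (sym (δ-≢ (Fin.punchInᵢ≢i j i))))
        (λ s → trans (reflexive (insertAt-punchIn (δ i) j 0# s)) (sym (δ-punchIn j i s))))))
      (moveToHead alt j Id)

  -- Writing the head row in the basis `δ j`, clearing column j and applying induction to the
  -- remaining block reproduces the Laplace expansion term by term, with the value at the identity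
  -- as a common factor.
  det-unique : ∀ {n} {D : Matrix (Fin n) (Fin n) → Carrier} → Alternating D → ∀ A → D A ≈ det A * D Id
  det-unique {zero}  {D} alt A = trans (cong (λ ())) (sym (*-identityˡ _))
    where open Alternating alt
  det-unique {suc n} {D} alt A = begin
    D A
      ≈⟨ cong (≈ᴹ-cons (λ j → sym (sum-δ (A zero) j)) (λ _ _ → refl)) ⟩
    D ((λ l → sum (λ j → A zero j * δ j l)) ∷ᵛ A ∘ suc)
      ≈⟨ sumHead multilinear (A zero) δ (A ∘ suc) ⟩
    sum (λ j → A zero j * D (δ j ∷ᵛ A ∘ suc))
      ≈⟨ sum-cong-≋ (λ j → begin
           A zero j * D (δ j ∷ᵛ A ∘ suc)
             ≈⟨ *-congˡ (trans (clearColumn alt j (A ∘ suc)) (det-unique (pad-alternating alt j) (minor A j))) ⟩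
           A zero j * (det (minor A j) * D (δ j ∷ᵛ pad j Id))
             ≈⟨ *-congˡ (*-congˡ (pad-Id alt j)) ⟩
           A zero j * (det (minor A j) * (sgn j * D Id))
             ≈⟨ solve 4 (λ a m s d → a :* (m :* (s :* d)) := s :* (a :* m) :* d) refl
                  (A zero j) (det (minor A j)) (sgn j) (D Id) ⟩
           sgn j * (A zero j * det (minor A j)) * D Id ∎) ⟩
    sum (λ j → sgn j * (A zero j * det (minor A j)) * D Id)
      ≈⟨ *-distribʳ-sum (D Id) (λ j → sgn j * (A zero j * det (minor A j))) ⟨
    det A * D Id ∎
    where open Alternating alt

  -- The map sending M to det (M B) is alternating with value det B at the identity, so uniqueness
  -- is the product formula.
  det-* : ∀ {n} (A B : Matrix (Fin n) (Fin n)) → det (A · B) ≈ det A * det B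
  det-* {n} A B = trans (det-unique {D = λ M → det (M · B)} alt A)
    (*-congˡ (det-cong (λ i k → trans (sum-cong-≋ (λ j → *-congʳ (δ-sym i j)))
       (trans (sum-cong-≋ (λ j → *-comm (δ j i) (B j k))) (sum-δ (λ j → B j k) i)))))
    where
    δ-sym : ∀ {n} (i j : Fin n) → δ i j ≈ δ j i
    δ-sym zero    zero    = refl
    δ-sym zero    (suc j) = refl
    δ-sym (suc i) zero    = refl
    δ-sym (suc i) (suc j) = δ-sym i j
    rowTimes : Row n → Row n
    rowTimes u k = sum (λ j → u j * B j k)
    rowTimes-linear : ∀ a u v k → rowTimes (λ j → a * u j + v j) k ≈ a * rowTimes u k + rowTimes v k
    rowTimes-linear a u v k = begin
      sum (λ j → (a * u j + v j) * B j k)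
        ≈⟨ sum-cong-≋ (λ j → solve 4 (λ a x y b → (a :* x :+ y) :* b := a :* (x :* b) :+ y :* b) refl a (u j) (v j) (B j k)) ⟩
      sum (λ j → a * (u j * B j k) + v j * B j k)
        ≈⟨ ∑-distrib-+ (λ j → a * (u j * B j k)) (λ j → v j * B j k) ⟩
      sum (λ j → a * (u j * B j k)) + rowTimes v k
        ≈⟨ +-congʳ (*-distribˡ-sum a (λ j → u j * B j k)) ⟨
      a * rowTimes u k + rowTimes v k ∎
    mapRow : ∀ M r u → det ((M [ r ↦ u ]) · B) ≈ det ((M · B) [ r ↦ rowTimes u ])
    mapRow M r u = det-cong (λ i k → reflexive (≡.cong (λ f → f k) (↦-map rowTimes M r u i)))
    alt : Alternating (λ M → det (M · B))
    alt = record
      { multilinear = record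
        { cong   = λ A≈B → det-cong (λ i k → sum-cong-≋ (λ j → *-congʳ (A≈B i j)))
        ; linear = λ r a u v M → begin
            det ((M [ r ↦ (λ j → a * u j + v j) ]) · B)
              ≈⟨ mapRow M r _ ⟩
            det ((M · B) [ r ↦ rowTimes (λ j → a * u j + v j) ])
              ≈⟨ det-cong (↦-congʳ r (M · B) (rowTimes-linear a u v)) ⟩
            det ((M · B) [ r ↦ (λ k → a * rowTimes u k + rowTimes v k) ])
              ≈⟨ det-linear r a (rowTimes u) (rowTimes v) (M · B) ⟩
            a * det ((M · B) [ r ↦ rowTimes u ]) + det ((M · B) [ r ↦ rowTimes v ])
              ≈⟨ +-cong (*-congˡ (mapRow M r u)) (mapRow M r v) ⟨
            a * det ((M [ r ↦ u ]) · B) + det ((M [ r ↦ v ]) · B) ∎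
        }
      ; alternating = λ M r≢s Mr≈Ms → det-alternating (M · B) r≢s (λ k → sum-cong-≋ (λ j → *-congʳ (Mr≈Ms j)))
      }

-- Matrix algebra over finite index types.

module MatrixAlgebra (R : CommutativeRing 0ℓ 0ℓ) where
  open CommutativeRing R hiding (zero)
  open Algebra.Properties.Ring ring
  open Algebra.Properties.Semiring.Sum semiring
  open Algebra.Definitions.RawSemiring (RawRing.rawSemiring rawRing) using (_^_)
  open IntegerSolver R using (solve; _:+_; _:*_; _:-_; :-_; _:=_; con)
  open Matrices rawRing
  open Determinants R using (sum-zero; sum-δ; δ-refl; δ-≢; det-*)
  open Relation.Binary.Reasoning.Setoid setoid

  δ-sym : ∀ {I} {{_ : Finite I}} (i j : I) → δ i j ≈ δ j i
  δ-sym i j with toSum (i ≟ j)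
  ... | inj₁ ≡.refl = refl
  ... | inj₂ i≢j    = trans (δ-≢ i≢j) (sym (δ-≢ (i≢j ∘ ≡.sym)))

  module _ {J : Set} {{F : Finite J}} where
    open Finite F using (enumeration; size)
    private module E = Inverse enumeration

    sumOver-cong : ∀ {f g : J → Carrier} → (∀ j → f j ≈ g j) → sumOver f ≈ sumOver g
    sumOver-cong f≈g = sum-cong-≋ (f≈g ∘ E.to)

    sumOver-+ : ∀ (f g : J → Carrier) → sumOver (λ j → f j + g j) ≈ sumOver f + sumOver g
    sumOver-+ f g = ∑-distrib-+ (f ∘ E.to) (g ∘ E.to)

    *-distribˡ-sumOver : ∀ c (f : J → Carrier) → c * sumOver f ≈ sumOver (λ j → c * f j)
    *-distribˡ-sumOver c f = *-distribˡ-sum c (f ∘ E.to)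

    *-distribʳ-sumOver : ∀ c (f : J → Carrier) → sumOver f * c ≈ sumOver (λ j → f j * c)
    *-distribʳ-sumOver c f = *-distribʳ-sum c (f ∘ E.to)

    sumOver-neg : ∀ (f : J → Carrier) → sumOver (λ j → - f j) ≈ - sumOver f
    sumOver-neg f = begin
      sumOver (λ j → - f j)         ≈⟨ sumOver-cong (λ j → sym (-1*x≈-x (f j))) ⟩
      sumOver (λ j → - 1# * f j)    ≈⟨ *-distribˡ-sumOver (- 1#) f ⟨
      - 1# * sumOver f              ≈⟨ -1*x≈-x _ ⟩
      - sumOver f                   ∎

    sumOver-zero : sumOver {J} (λ _ → 0#) ≈ 0#
    sumOver-zero = sum-zero {size} (λ _ → refl)

    sumOver-δ : ∀ (f : J → Carrier) i → sumOver (λ j → f j * δ j i) ≈ f i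
    sumOver-δ f i = begin
      sum (λ a → f (E.to a) * δ (E.to a) i)
        ≈⟨ sum-cong-≋ (λ a → *-congˡ (eq a)) ⟩
      sum (λ a → f (E.to a) * δ a (E.from i))
        ≈⟨ sum-δ (f ∘ E.to) (E.from i) ⟩
      f (E.to (E.from i))
        ≡⟨ ≡.cong f (E.strictlyInverseˡ i) ⟩
      f i ∎
      where
      eq : ∀ (a : Fin size) → δ (E.to a) i ≈ δ a (E.from i)
      eq a with toSum (E.to a ≟ i)
      ... | inj₁ ≡i = trans (reflexive (≡.cong (δ (E.to a)) (≡.sym ≡i))) (trans (δ-refl (E.to a))
        (sym (trans (reflexive (≡.cong (δ a) (≡.trans (≡.cong E.from (≡.sym ≡i)) (E.strictlyInverseʳ a)))) (δ-refl a))))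
      ... | inj₂ ≢i = trans (δ-≢ ≢i) (sym (δ-≢ (λ a≡ → ≢i (≡.trans (≡.cong E.to a≡) (E.strictlyInverseˡ i)))))

  sumOver-comm : ∀ {I J : Set} {{_ : Finite I}} {{_ : Finite J}} (f : I → J → Carrier) →
    sumOver (λ i → sumOver (f i)) ≈ sumOver (λ j → sumOver (λ i → f i j))
  sumOver-comm {{F}} {{G}} f = ∑-comm (λ a b → f (Inverse.to (Finite.enumeration F) a) (Inverse.to (Finite.enumeration G) b))

  ≈ᴹ-refl : ∀ {I J} {A : Matrix I J} → A ≈ᴹ A
  ≈ᴹ-refl i j = refl

  ≈ᴹ-sym : ∀ {I J} {A B : Matrix I J} → A ≈ᴹ B → B ≈ᴹ A
  ≈ᴹ-sym p i j = sym (p i j)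

  ≈ᴹ-trans : ∀ {I J} {A B C : Matrix I J} → A ≈ᴹ B → B ≈ᴹ C → A ≈ᴹ C
  ≈ᴹ-trans p q i j = trans (p i j) (q i j)

  -ᴹ-cong : ∀ {I J} {A A′ B B′ : Matrix I J} → A ≈ᴹ A′ → B ≈ᴹ B′ → A -ᴹ B ≈ᴹ A′ -ᴹ B′
  -ᴹ-cong p q i j = +-cong (p i j) (-‿cong (q i j))

  module _ {I J K : Set} {{_ : Finite J}} where

    ·-cong : ∀ {A A′ : Matrix I J} {B B′ : Matrix J K} → A ≈ᴹ A′ → B ≈ᴹ B′ → A · B ≈ᴹ A′ · B′
    ·-cong p q i k = sumOver-cong (λ j → *-cong (p i j) (q j k))

    ·-distribˡ--ᴹ : ∀ (A : Matrix I J) (B C : Matrix J K) → A · (B -ᴹ C) ≈ᴹ A · B -ᴹ A · C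
    ·-distribˡ--ᴹ A B C i k = begin
      sumOver (λ j → A i j * (B j k - C j k))
        ≈⟨ sumOver-cong (λ j → solve 3 (λ a b c → a :* (b :- c) := a :* b :+ :- (a :* c)) refl (A i j) (B j k) (C j k)) ⟩
      sumOver (λ j → A i j * B j k + - (A i j * C j k))
        ≈⟨ sumOver-+ (λ j → A i j * B j k) (λ j → - (A i j * C j k)) ⟩
      (A · B) i k + sumOver (λ j → - (A i j * C j k))
        ≈⟨ +-congˡ (sumOver-neg (λ j → A i j * C j k)) ⟩
      (A · B) i k - (A · C) i k ∎

    ·-distribʳ--ᴹ : ∀ (A B : Matrix I J) (C : Matrix J K) → (A -ᴹ B) · C ≈ᴹ A · C -ᴹ B · C
    ·-distribʳ--ᴹ A B C i k = begin
      sumOver (λ j → (A i j - B i j) * C j k)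
        ≈⟨ sumOver-cong (λ j → solve 3 (λ a b c → (a :- b) :* c := a :* c :+ :- (b :* c)) refl (A i j) (B i j) (C j k)) ⟩
      sumOver (λ j → A i j * C j k + - (B i j * C j k))
        ≈⟨ sumOver-+ (λ j → A i j * C j k) (λ j → - (B i j * C j k)) ⟩
      (A · C) i k + sumOver (λ j → - (B i j * C j k))
        ≈⟨ +-congˡ (sumOver-neg (λ j → B i j * C j k)) ⟩
      (A · C) i k - (B · C) i k ∎

    •-·-assoc : ∀ c (A : Matrix I J) (B : Matrix J K) → (c • A) · B ≈ᴹ c • (A · B)
    •-·-assoc c A B i k = trans (sumOver-cong (λ j → *-assoc c (A i j) (B j k)))
      (sym (*-distribˡ-sumOver c (λ j → A i j * B j k)))

    ·-•-comm : ∀ c (A : Matrix I J) (B : Matrix J K) → A · (c • B) ≈ᴹ c • (A · B)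
    ·-•-comm c A B i k = trans
      (sumOver-cong (λ j → solve 3 (λ a b c → a :* (c :* b) := c :* (a :* b)) refl (A i j) (B j k) c))
      (sym (*-distribˡ-sumOver c (λ j → A i j * B j k)))

  ·-assoc : ∀ {I J K L : Set} {{_ : Finite J}} {{_ : Finite K}}
    (A : Matrix I J) (B : Matrix J K) (C : Matrix K L) → (A · B) · C ≈ᴹ A · (B · C)
  ·-assoc {J = J} {K} A B C i l = begin
    sumOver (λ k → sumOver (λ j → A i j * B j k) * C k l)
      ≈⟨ sumOver-cong (λ k → *-distribʳ-sumOver (C k l) (λ j → A i j * B j k)) ⟩
    sumOver (λ k → sumOver (λ j → A i j * B j k * C k l))
      ≈⟨ sumOver-comm (λ k j → A i j * B j k * C k l) ⟩
    sumOver (λ j → sumOver (λ k → A i j * B j k * C k l))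
      ≈⟨ sumOver-cong (λ j → trans (sumOver-cong (λ k → *-assoc (A i j) (B j k) (C k l)))
           (sym (*-distribˡ-sumOver (A i j) (λ k → B j k * C k l)))) ⟩
    sumOver (λ j → A i j * (B · C) j l) ∎

  ·-identityʳ : ∀ {I J} {{_ : Finite J}} (A : Matrix I J) → A · Id ≈ᴹ A
  ·-identityʳ A i k = sumOver-δ (A i) k

  ·-identityˡ : ∀ {I J} {{_ : Finite I}} (A : Matrix I J) → Id · A ≈ᴹ A
  ·-identityˡ A i k = trans
    (sumOver-cong (λ j → trans (*-congʳ (δ-sym i j)) (*-comm (δ j i) (A j k))))
    (sumOver-δ (λ j → A j k) i)

  module _ {n} (x : Carrier) (A : Matrix (Fin n) (Fin n)) where

    -- This is A² - x²: the terms linear in x cancel because x is scalar. For an indeterminate x the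
    -- entries off the diagonal become constants, which isolates the two top coefficients of the
    -- determinant on the diagonal.
    oppositeShifts : Matrix (Fin n) (Fin n)
    oppositeShifts = (x • Id -ᴹ A) · ((- x) • Id -ᴹ A)

    oppositeShifts-entry : ∀ i j → oppositeShifts i j ≈ (A · A) i j - x * x * δ i j
    oppositeShifts-entry i j = begin
      oppositeShifts i j
        ≈⟨ ·-distribʳ--ᴹ (x • Id) A N i j ⟩
      ((x • Id) · N) i j - (A · N) i j
        ≈⟨ +-cong (trans (•-·-assoc x Id N i j) (*-congˡ (·-identityˡ N i j)))
             (-‿cong (trans (·-distribˡ--ᴹ A ((- x) • Id) A i j)
               (+-congʳ (trans (·-•-comm (- x) A Id i j) (*-congˡ (·-identityʳ A i j)))))) ⟩
      x * (- x * δ i j - A i j) - (- x * A i j - (A · A) i j)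
        ≈⟨ solve 4 (λ x d a b → x :* (:- x :* d :- a) :- (:- x :* a :- b) := b :- x :* x :* d)
             refl x (δ i j) (A i j) ((A · A) i j) ⟩
      (A · A) i j - x * x * δ i j ∎
      where N = (- x) • Id -ᴹ A

    oppositeShifts-diagonal : ∀ {c} i → (A · A) i i ≈ c → oppositeShifts i i ≈ c - x * x
    oppositeShifts-diagonal i A²≈c = trans (oppositeShifts-entry i i)
      (+-cong A²≈c (-‿cong (trans (*-congˡ (δ-refl i)) (*-identityʳ _))))

    oppositeShifts-off : ∀ {c i j} → i ≢ j → (A · A) i j ≈ c → oppositeShifts i j ≈ c
    oppositeShifts-off {i = i} {j} i≢j A²≈c = trans (oppositeShifts-entry i j)
      (trans (+-cong A²≈c (trans (-‿cong (trans (*-congˡ (δ-≢ i≢j)) (zeroʳ _))) -0#≈0#)) (+-identityʳ _))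

    det-oppositeShifts : ∀ {p q} → det (x • Id -ᴹ A) ≈ p → det ((- x) • Id -ᴹ A) ≈ q → p * q ≈ det oppositeShifts
    det-oppositeShifts p≈ q≈ = trans (*-cong (sym p≈) (sym q≈)) (sym (det-* (x • Id -ᴹ A) ((- x) • Id -ᴹ A)))

  det-scalar : ∀ n c → det {n} (c • Id) ≈ c ^ n
  det-scalar zero    c = refl
  det-scalar (suc n) c = begin
    1# * (c * 1# * det {n} (c • Id)) + sum (λ j → sgn (suc j) * (c * 0# * M (suc j)))
      ≈⟨ +-cong (*-congˡ (*-congˡ (det-scalar n c)))
           (sum-zero (λ j → solve 3 (λ s c m → s :* (c :* con (+ 0) :* m) := con (+ 0)) refl (sgn (suc j)) c (M (suc j)))) ⟩
    1# * (c * 1# * c ^ n) + 0#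
      ≈⟨ solve 2 (λ c d → con (+ 1) :* (c :* con (+ 1) :* d) :+ con (+ 0) := c :* d) refl c (c ^ n) ⟩
    c * c ^ n ∎
    where
    open Determinants R using (sgn; minor)
    M : Fin (suc n) → Carrier
    M j = det (minor (c • Id) j)

-- Homomorphisms, the polynomial ring and evaluation of polynomials.

module DeterminantHomomorphism (S : RawRing 0ℓ 0ℓ) (R : CommutativeRing 0ℓ 0ℓ)
    {h : RawRing.Carrier S → CommutativeRing.Carrier R}
    (isHom : RingMorphisms.IsRingHomomorphism S (CommutativeRing.rawRing R) h) where
  open CommutativeRing R hiding (zero)
  open RingMorphisms.IsRingHomomorphism isHom
  open Algebra.Properties.Semiring.Sum semiring using (sum; sum-cong-≋)
  open Algebra.Definitions.RawSemiring (RawRing.rawSemiring rawRing) using (_^_)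
  private
    module S = RawRing S
    module SS = Algebra.Definitions.RawSemiring S.rawSemiring
    module MS = Matrices S
  open Matrices rawRing

  sum-homo : ∀ {n} (f : Fin n → S.Carrier) → h (SS.sum f) ≈ sum (h ∘ f)
  sum-homo {zero}  f = 0#-homo
  sum-homo {suc n} f = trans (+-homo _ _) (+-congˡ (sum-homo (f ∘ suc)))

  ^-homo : ∀ x n → h (x SS.^ n) ≈ h x ^ n
  ^-homo x zero    = 1#-homo
  ^-homo x (suc n) = trans (*-homo _ _) (*-congˡ (^-homo x n))

  δ-homo : ∀ {I} {{_ : Finite I}} (i j : I) → h (MS.δ i j) ≈ δ i j
  δ-homo i j with does (i ≟ j)
  ... | true  = 1#-homo
  ... | false = 0#-homo

  det-homo : ∀ {n} (A : MS.Matrix (Fin n) (Fin n)) → h (MS.det A) ≈ det (λ i j → h (A i j))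
  det-homo {zero}  A = 1#-homo
  det-homo {suc n} A = trans (sum-homo (λ j → (S.- S.1#) SS.^ toℕ j S.* (A zero j S.* MS.det (λ i l → A (suc i) (punchIn j l)))))
    (sum-cong-≋ λ j → trans (*-homo _ _) (*-cong
      (trans (^-homo (S.- S.1#) (toℕ j)) (^-cong (trans (-‿homo S.1#) (-‿cong 1#-homo)) (toℕ j)))
      (trans (*-homo (A zero j) _) (*-congˡ (det-homo (λ i l → A (suc i) (punchIn j l)))))))
    where
    ^-cong : ∀ {x y} → x ≈ y → ∀ n → x ^ n ≈ y ^ n
    ^-cong x≈y zero    = refl
    ^-cong x≈y (suc n) = *-cong x≈y (^-cong x≈y n)

module PolynomialRing (R : CommutativeRing 0ℓ 0ℓ) where
  open CommutativeRing R hiding (zero)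
  open Algebra.Properties.Ring ring
  open IntegerSolver R using (solve; _:+_; _:*_; _:-_; :-_; _:=_; con)
  open Polynomials rawRing
  open Relation.Binary.Reasoning.Setoid setoid

  coeff-+ : ∀ p q i → coeff (p +ₚ q) i ≈ coeff p i + coeff q i
  coeff-+ []      q       i       = sym (+-identityˡ _)
  coeff-+ (a ∷ p) []      i       = sym (+-identityʳ _)
  coeff-+ (a ∷ p) (b ∷ q) zero    = refl
  coeff-+ (a ∷ p) (b ∷ q) (suc i) = coeff-+ p q i

  coeff-map-* : ∀ a p i → coeff (List.map (a *_) p) i ≈ a * coeff p i
  coeff-map-* a []      i       = sym (zeroʳ a)
  coeff-map-* a (b ∷ p) zero    = refl
  coeff-map-* a (b ∷ p) (suc i) = coeff-map-* a p i

  coeff-neg : ∀ p i → coeff (List.map -_ p) i ≈ - coeff p i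
  coeff-neg []      i       = sym -0#≈0#
  coeff-neg (b ∷ p) zero    = refl
  coeff-neg (b ∷ p) (suc i) = coeff-neg p i

  Seq : Set
  Seq = ℕ → Carrier

  infixl 7 _⋆_
  -- The Cauchy product. The ring laws are proved for coefficient sequences, where trailing zeros of
  -- a list make no difference, and then transferred to lists.
  _⋆_ : Seq → Seq → Seq
  (f ⋆ g) zero    = f zero * g zero
  (f ⋆ g) (suc n) = f zero * g (suc n) + (f ∘ suc ⋆ g) n

  ⋆-cong : ∀ {f f′ g g′} → (∀ i → f i ≈ f′ i) → (∀ i → g i ≈ g′ i) → ∀ n → (f ⋆ g) n ≈ (f′ ⋆ g′) n
  ⋆-cong p q zero    = *-cong (p zero) (q zero)
  ⋆-cong p q (suc n) = +-cong (*-cong (p zero) (q (suc n))) (⋆-cong (p ∘ suc) q n)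

  ⋆-zeroˡ : ∀ {f} g → (∀ i → f i ≈ 0#) → ∀ n → (f ⋆ g) n ≈ 0#
  ⋆-zeroˡ g f≈0 zero    = trans (*-congʳ (f≈0 zero)) (zeroˡ _)
  ⋆-zeroˡ g f≈0 (suc n) =
    trans (+-cong (trans (*-congʳ (f≈0 zero)) (zeroˡ _)) (⋆-zeroˡ g (f≈0 ∘ suc) n)) (+-identityˡ 0#)

  -- The definition strips the first factor; stripping the second one instead is what yields
  -- commutativity.
  ⋆-unfoldʳ : ∀ f g n → (f ⋆ g) (suc n) ≈ f (suc n) * g zero + (f ⋆ g ∘ suc) n
  ⋆-unfoldʳ f g zero    = +-comm _ _
  ⋆-unfoldʳ f g (suc n) = begin
    f zero * g (suc (suc n)) + (f ∘ suc ⋆ g) (suc n)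
      ≈⟨ +-congˡ (⋆-unfoldʳ (f ∘ suc) g n) ⟩
    f zero * g (suc (suc n)) + (f (suc (suc n)) * g zero + (f ∘ suc ⋆ g ∘ suc) n)
      ≈⟨ solve 3 (λ a b c → a :+ (b :+ c) := b :+ (a :+ c)) refl _ _ _ ⟩
    f (suc (suc n)) * g zero + (f zero * g (suc (suc n)) + (f ∘ suc ⋆ g ∘ suc) n) ∎

  ⋆-comm : ∀ f g n → (f ⋆ g) n ≈ (g ⋆ f) n
  ⋆-comm f g zero    = *-comm _ _
  ⋆-comm f g (suc n) = trans (+-cong (*-comm _ _) (⋆-comm (f ∘ suc) g n)) (sym (⋆-unfoldʳ g f n))

  ⋆-distribʳ : ∀ a f g h n → ((λ i → a * f i + g i) ⋆ h) n ≈ a * (f ⋆ h) n + (g ⋆ h) n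
  ⋆-distribʳ a f g h zero = solve 4 (λ a f g h → (a :* f :+ g) :* h := a :* (f :* h) :+ g :* h) refl a (f 0) (g 0) (h 0)
  ⋆-distribʳ a f g h (suc n) = trans (+-congˡ (⋆-distribʳ a (f ∘ suc) (g ∘ suc) h n))
    (solve 6 (λ a f g h x y → (a :* f :+ g) :* h :+ (a :* x :+ y) := a :* (f :* h :+ x) :+ (g :* h :+ y)) refl
      a (f 0) (g 0) (h (suc n)) ((f ∘ suc ⋆ h) n) ((g ∘ suc ⋆ h) n))

  ⋆-assoc : ∀ f g h n → ((f ⋆ g) ⋆ h) n ≈ (f ⋆ (g ⋆ h)) n
  ⋆-assoc f g h zero    = *-assoc _ _ _
  ⋆-assoc f g h (suc n) = begin
    f 0 * g 0 * h (suc n) + ((λ i → f 0 * g (suc i) + (f ∘ suc ⋆ g) i) ⋆ h) n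
      ≈⟨ +-congˡ (trans (⋆-distribʳ (f 0) (g ∘ suc) (f ∘ suc ⋆ g) h n) (+-congˡ (⋆-assoc (f ∘ suc) g h n))) ⟩
    f 0 * g 0 * h (suc n) + (f 0 * (g ∘ suc ⋆ h) n + (f ∘ suc ⋆ (g ⋆ h)) n)
      ≈⟨ solve 5 (λ a b c d e → a :* b :* c :+ (a :* d :+ e) := a :* (b :* c :+ d) :+ e) refl (f 0) (g 0) (h (suc n)) _ _ ⟩
    f 0 * (g ⋆ h) (suc n) + (f ∘ suc ⋆ (g ⋆ h)) n ∎

  coeff-* : ∀ p q n → coeff (p *ₚ q) n ≈ (coeff p ⋆ coeff q) n
  coeff-* []      q n       = sym (⋆-zeroˡ (coeff q) (λ _ → refl) n)
  coeff-* (a ∷ p) q zero    = trans (coeff-+ (List.map (a *_) q) (0# ∷ p *ₚ q) zero)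
    (trans (+-identityʳ _) (coeff-map-* a q zero))
  coeff-* (a ∷ p) q (suc n) = trans (coeff-+ (List.map (a *_) q) (0# ∷ p *ₚ q) (suc n))
    (+-cong (coeff-map-* a q (suc n)) (coeff-* p q n))

  coeff-C* : ∀ a p i → coeff (C a *ₚ p) i ≈ a * coeff p i
  coeff-C* a p zero    = trans (coeff-* (C a) p zero) refl
  coeff-C* a p (suc i) = trans (coeff-* (C a) p (suc i)) (trans (+-congˡ (⋆-zeroˡ (coeff p) (λ _ → refl) i)) (+-identityʳ _))

  commutativeRing : CommutativeRing 0ℓ 0ℓ
  commutativeRing = record
    { Carrier = Poly
    ; _≈_ = λ p q → ∀ i → coeff p i ≈ coeff q i
    ; _+_ = _+ₚ_
    ; _*_ = _*ₚ_
    ; -_  = List.map (λ a → - a)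
    ; 0#  = []
    ; 1#  = 1# ∷ []
    ; isCommutativeRing = record
      { isRing = record
        { +-isAbelianGroup = record
          { isGroup = record
            { isMonoid = record
              { isSemigroup = record
                { isMagma = record
                  { isEquivalence = record
                    { refl = λ _ → refl ; sym = λ p i → sym (p i) ; trans = λ p q i → trans (p i) (q i) }
                  ; ∙-cong = λ {p} {p′} {q} {q′} p≈ q≈ i →
                      trans (coeff-+ p q i) (trans (+-cong (p≈ i) (q≈ i)) (sym (coeff-+ p′ q′ i)))
                  }
                ; assoc = λ p q r i → begin
                    coeff ((p +ₚ q) +ₚ r) i            ≈⟨ trans (coeff-+ (p +ₚ q) r i) (+-congʳ (coeff-+ p q i)) ⟩
                    coeff p i + coeff q i + coeff r i  ≈⟨ +-assoc _ _ _ ⟩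
                    coeff p i + (coeff q i + coeff r i) ≈⟨ trans (coeff-+ p (q +ₚ r) i) (+-congˡ (coeff-+ q r i)) ⟨
                    coeff (p +ₚ (q +ₚ r)) i            ∎
                }
              ; identity = (λ _ _ → refl) , (λ p i → trans (coeff-+ p [] i) (+-identityʳ _))
              }
            ; inverse = (λ p i → trans (coeff-+ (List.map -_ p) p i) (trans (+-congʳ (coeff-neg p i)) (-‿inverseˡ _)))
                      , (λ p i → trans (coeff-+ p (List.map -_ p) i) (trans (+-congˡ (coeff-neg p i)) (-‿inverseʳ _)))
            ; ⁻¹-cong = λ {p} {q} p≈q i → trans (coeff-neg p i) (trans (-‿cong (p≈q i)) (sym (coeff-neg q i)))
            }
          ; comm = λ p q i → trans (coeff-+ p q i) (trans (+-comm _ _) (sym (coeff-+ q p i)))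
          }
        ; *-cong = λ {p} {p′} {q} {q′} p≈ q≈ i →
            trans (coeff-* p q i) (trans (⋆-cong p≈ q≈ i) (sym (coeff-* p′ q′ i)))
        ; *-assoc = λ p q r i → begin
            coeff ((p *ₚ q) *ₚ r) i
              ≈⟨ trans (coeff-* (p *ₚ q) r i) (⋆-cong (coeff-* p q) (λ _ → refl) i) ⟩
            ((coeff p ⋆ coeff q) ⋆ coeff r) i
              ≈⟨ ⋆-assoc (coeff p) (coeff q) (coeff r) i ⟩
            (coeff p ⋆ (coeff q ⋆ coeff r)) i
              ≈⟨ trans (coeff-* p (q *ₚ r) i) (⋆-cong (λ _ → refl) (coeff-* q r) i) ⟨
            coeff (p *ₚ (q *ₚ r)) i ∎
        ; *-identity = identityˡ , (λ p i → trans (comm p (1# ∷ []) i) (identityˡ p i))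
        ; distrib = (λ p q r i → begin
            coeff (p *ₚ (q +ₚ r)) i        ≈⟨ comm p (q +ₚ r) i ⟩
            coeff ((q +ₚ r) *ₚ p) i        ≈⟨ distribʳ-* p q r i ⟩
            coeff (q *ₚ p +ₚ r *ₚ p) i     ≈⟨ trans (coeff-+ (q *ₚ p) (r *ₚ p) i) (+-cong (comm q p i) (comm r p i)) ⟩
            coeff (p *ₚ q) i + coeff (p *ₚ r) i ≈⟨ coeff-+ (p *ₚ q) (p *ₚ r) i ⟨
            coeff (p *ₚ q +ₚ p *ₚ r) i     ∎) , distribʳ-*
        }
      ; *-comm = comm
      }
    }
    where
    comm : ∀ p q i → coeff (p *ₚ q) i ≈ coeff (q *ₚ p) i
    comm p q i = trans (coeff-* p q i) (trans (⋆-comm (coeff p) (coeff q) i) (sym (coeff-* q p i)))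
    identityˡ : ∀ p i → coeff ((1# ∷ []) *ₚ p) i ≈ coeff p i
    identityˡ p i = trans (coeff-C* 1# p i) (*-identityˡ _)
    distribʳ-* : ∀ p q r i → coeff ((q +ₚ r) *ₚ p) i ≈ coeff (q *ₚ p +ₚ r *ₚ p) i
    distribʳ-* p q r i = begin
      coeff ((q +ₚ r) *ₚ p) i
        ≈⟨ trans (coeff-* (q +ₚ r) p i) (⋆-cong (λ j → trans (coeff-+ q r j) (+-congʳ (sym (*-identityˡ _)))) (λ _ → refl) i) ⟩
      ((λ j → 1# * coeff q j + coeff r j) ⋆ coeff p) i
        ≈⟨ ⋆-distribʳ 1# (coeff q) (coeff r) (coeff p) i ⟩
      1# * (coeff q ⋆ coeff p) i + (coeff r ⋆ coeff p) i
        ≈⟨ +-cong (trans (*-identityˡ _) (sym (coeff-* q p i))) (sym (coeff-* r p i)) ⟩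
      coeff (q *ₚ p) i + coeff (r *ₚ p) i
        ≈⟨ coeff-+ (q *ₚ p) (r *ₚ p) i ⟨
      coeff (q *ₚ p +ₚ r *ₚ p) i ∎

  C-isRingHomomorphism : RingMorphisms.IsRingHomomorphism rawRing polyRing C
  C-isRingHomomorphism = record
    { isSemiringHomomorphism = record
      { isNearSemiringHomomorphism = record
        { +-isMonoidHomomorphism = record
          { isMagmaHomomorphism = record
            { isRelHomomorphism = record { cong = λ { a≈b zero → a≈b ; a≈b (suc i) → refl } }
            ; homo = λ { a b zero → refl ; a b (suc i) → refl } }
          ; ε-homo = λ { zero → refl ; (suc i) → refl } }
        ; *-homo = λ { a b zero → sym (coeff-C* a (C b) zero) ; a b (suc i) → sym (trans (coeff-C* a (C b) (suc i)) (zeroʳ a)) } }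
      ; 1#-homo = λ _ → refl }
    ; -‿homo = λ _ _ → refl }

module Evaluation (R S : CommutativeRing 0ℓ 0ℓ)
    {g : CommutativeRing.Carrier R → CommutativeRing.Carrier S}
    (isHom : RingMorphisms.IsRingHomomorphism (CommutativeRing.rawRing R) (CommutativeRing.rawRing S) g)
    (s : CommutativeRing.Carrier S) where
  private module R = CommutativeRing R
  open Polynomials R.rawRing
  open CommutativeRing S hiding (zero)
  open Algebra.Properties.Ring ring
  open IntegerSolver S using (solve; _:+_; _:*_; _:-_; :-_; _:=_; con)
  open RingMorphisms.IsRingHomomorphism isHom
  open Relation.Binary.Reasoning.Setoid setoid

  -- Horner's scheme with coefficients carried along `g`. The target ring is free, so that one
  -- construction substitutes `X` and its negative in ℝ[X], the eigenvalue θ in ℂ, and 0 in ℝ.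
  eval : Poly → Carrier
  eval = foldr (λ a v → g a + s * v) 0#

  eval-zero : ∀ p → (∀ i → coeff p i R.≈ R.0#) → eval p ≈ 0#
  eval-zero []      p≈0 = refl
  eval-zero (a ∷ p) p≈0 = trans
    (+-cong (trans (⟦⟧-cong (p≈0 zero)) 0#-homo) (trans (*-congˡ (eval-zero p (p≈0 ∘ suc))) (zeroʳ s)))
    (+-identityˡ 0#)

  eval-cong : ∀ p q → (∀ i → coeff p i R.≈ coeff q i) → eval p ≈ eval q
  eval-cong []      q       p≈q = sym (eval-zero q (λ i → R.sym (p≈q i)))
  eval-cong (a ∷ p) []      p≈q = eval-zero (a ∷ p) p≈q
  eval-cong (a ∷ p) (b ∷ q) p≈q = +-cong (⟦⟧-cong (p≈q zero)) (*-congˡ (eval-cong p q (p≈q ∘ suc)))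

  eval-+ : ∀ p q → eval (p +ₚ q) ≈ eval p + eval q
  eval-+ []      q       = sym (+-identityˡ _)
  eval-+ (a ∷ p) []      = sym (+-identityʳ _)
  eval-+ (a ∷ p) (b ∷ q) = trans (+-cong (+-homo a b) (*-congˡ (eval-+ p q)))
    (solve 5 (λ a b s p q → a :+ b :+ s :* (p :+ q) := a :+ s :* p :+ (b :+ s :* q)) refl (g a) (g b) s (eval p) (eval q))

  eval-map-* : ∀ a p → eval (List.map (a R.*_) p) ≈ g a * eval p
  eval-map-* a []      = sym (zeroʳ _)
  eval-map-* a (b ∷ p) = trans (+-cong (*-homo a b) (*-congˡ (eval-map-* a p)))
    (solve 4 (λ a b s p → a :* b :+ s :* (a :* p) := a :* (b :+ s :* p)) refl (g a) (g b) s (eval p))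

  eval-* : ∀ p q → eval (p *ₚ q) ≈ eval p * eval q
  eval-* []      q = sym (zeroˡ _)
  eval-* (a ∷ p) q = begin
    eval (List.map (a R.*_) q +ₚ (R.0# ∷ p *ₚ q))
      ≈⟨ eval-+ (List.map (a R.*_) q) (R.0# ∷ p *ₚ q) ⟩
    eval (List.map (a R.*_) q) + (g R.0# + s * eval (p *ₚ q))
      ≈⟨ +-cong (eval-map-* a q) (+-cong 0#-homo (*-congˡ (eval-* p q))) ⟩
    g a * eval q + (0# + s * (eval p * eval q))
      ≈⟨ solve 4 (λ a s p q → a :* q :+ (con (+ 0) :+ s :* (p :* q)) := (a :+ s :* p) :* q) refl (g a) s (eval p) (eval q) ⟩
    (g a + s * eval p) * eval q ∎

  eval-neg : ∀ p → eval (List.map (λ a → R.- a) p) ≈ - eval p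
  eval-neg []      = sym -0#≈0#
  eval-neg (a ∷ p) = trans (+-cong (-‿homo a) (*-congˡ (eval-neg p)))
    (solve 3 (λ a s p → :- a :+ s :* :- p := :- (a :+ s :* p)) refl (g a) s (eval p))

  eval-C : ∀ a → eval (C a) ≈ g a
  eval-C a = trans (+-congˡ (zeroʳ s)) (+-identityʳ _)

  eval-X : eval X ≈ s
  eval-X = begin
    g R.0# + s * (g R.1# + s * 0#) ≈⟨ +-cong 0#-homo (*-congˡ (+-congʳ 1#-homo)) ⟩
    0# + s * (1# + s * 0#)         ≈⟨ solve 1 (λ s → con (+ 0) :+ s :* (con (+ 1) :+ s :* con (+ 0)) := s) refl s ⟩
    s ∎

  eval-isRingHomomorphism : RingMorphisms.IsRingHomomorphism polyRing rawRing eval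
  eval-isRingHomomorphism = record
    { isSemiringHomomorphism = record
      { isNearSemiringHomomorphism = record
        { +-isMonoidHomomorphism = record
          { isMagmaHomomorphism = record
            { isRelHomomorphism = record { cong = λ {p} {q} → eval-cong p q }
            ; homo = eval-+ }
          ; ε-homo = refl }
        ; *-homo = eval-* }
      ; 1#-homo = trans (eval-C R.1#) 1#-homo }
    ; -‿homo = eval-neg }

-- The commutative rings of Cauchy reals and of complex numbers.

open CauchyLemmas
open InvSqrtLemmas

pointwise : ∀ {x y} → (∀ n → seq x n ≡ seq y n) → x ≈ᴿ y
pointwise {x} {y} eq ε 0<ε = 0 , λ n _ →
  ≡.subst (λ d → ℚ.∣ d ∣ ℚ.< ε) (≡.sym (≡.trans (≡.cong (ℚ._- seq y n) (eq n)) (ℚ.+-inverseʳ (seq y n)))) 0<ε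

≈ᴿ-sym : ∀ {x y} → x ≈ᴿ y → y ≈ᴿ x
≈ᴿ-sym {x} {y} x≈y ε 0<ε with N , h ← x≈y ε 0<ε = N , λ n p → ≡.subst (ℚ._< ε)
  (≡.trans (≡.sym (ℚ.∣-p∣≡∣p∣ (seq x n ℚ.- seq y n)))
    (≡.cong ℚ.∣_∣ (solve 2 (λ a b → :- (a :- b) := b :- a) ≡.refl (seq x n) (seq y n)))) (h n p)
  where open ℚ-Solver

eventually-× : ∀ {P Q : ℕ → Set} → Eventually P → Eventually Q → Eventually (λ n → P n × Q n)
eventually-× (N , p) (M , q) = N ⊔ M , λ n h → p n (ℕ.≤-trans (ℕ.m≤m⊔n N M) h) , q n (ℕ.≤-trans (ℕ.m≤n⊔m N M) h)

mapEventually : ∀ {P Q : ℕ → Set} → (∀ n → P n → Q n) → Eventually P → Eventually Q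
mapEventually f (N , p) = N , λ n h → f n (p n h)

∣+∣-< : ∀ {ε} p q → ℚ.∣ p ∣ ℚ.< ½ ℚ.* ε → ℚ.∣ q ∣ ℚ.< ½ ℚ.* ε → ℚ.∣ p ℚ.+ q ∣ ℚ.< ε
∣+∣-< {ε} p q p< q< = begin-strict
  ℚ.∣ p ℚ.+ q ∣              ≤⟨ ℚ.∣p+q∣≤∣p∣+∣q∣ p q ⟩
  ℚ.∣ p ∣ ℚ.+ ℚ.∣ q ∣        <⟨ ℚ.+-mono-< p< q< ⟩
  ½ ℚ.* ε ℚ.+ ½ ℚ.* ε        ≡⟨ ½+½ ε ⟩
  ε ∎
  where open ℚ.≤-Reasoning

≈ᴿ-trans : ∀ {x y z} → x ≈ᴿ y → y ≈ᴿ z → x ≈ᴿ z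
≈ᴿ-trans {x} {y} {z} x≈y y≈z ε 0<ε = mapEventually
  (λ { n (p , q) → ≡.subst (λ d → ℚ.∣ d ∣ ℚ.< ε)
    (solve 3 (λ a b c → (a :- b) :+ (b :- c) := a :- c) ≡.refl (seq x n) (seq y n) (seq z n))
    (∣+∣-< (seq x n ℚ.- seq y n) (seq y n ℚ.- seq z n) p q) })
  (eventually-× (x≈y (½ ℚ.* ε) (½*-pos 0<ε)) (y≈z (½ ℚ.* ε) (½*-pos 0<ε)))
  where open ℚ-Solver

module _ where
  open ℝ-ring
  open ℚ-Solver

  +ᴿ-cong : ∀ {x x′ y y′} → x ≈ᴿ x′ → y ≈ᴿ y′ → (x + y) ≈ᴿ (x′ + y′)
  +ᴿ-cong {x} {x′} {y} {y′} x≈ y≈ ε 0<ε = mapEventually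
    (λ { n (p , q) → ≡.subst (λ d → ℚ.∣ d ∣ ℚ.< ε)
      (solve 4 (λ a b c d → (a :- b) :+ (c :- d) := (a :+ c) :- (b :+ d)) ≡.refl (seq x n) (seq x′ n) (seq y n) (seq y′ n))
      (∣+∣-< (seq x n ℚ.- seq x′ n) (seq y n ℚ.- seq y′ n) p q) })
    (eventually-× (x≈ (½ ℚ.* ε) (½*-pos 0<ε)) (y≈ (½ ℚ.* ε) (½*-pos 0<ε)))

  -ᴿ-cong : ∀ {x y} → x ≈ᴿ y → (- x) ≈ᴿ (- y)
  -ᴿ-cong {x} {y} x≈y ε 0<ε = mapEventually
    (λ n p → ≡.subst (ℚ._< ε) (≡.trans (≡.sym (ℚ.∣-p∣≡∣p∣ (seq x n ℚ.- seq y n)))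
      (≡.cong ℚ.∣_∣ (solve 2 (λ a b → :- (a :- b) := :- a :- :- b) ≡.refl (seq x n) (seq y n)))) p)
    (x≈y ε 0<ε)

  *ᴿ-cong : ∀ {x x′ y y′} → x ≈ᴿ x′ → y ≈ᴿ y′ → (x * y) ≈ᴿ (x′ * y′)
  *ᴿ-cong {x} {x′} {y} {y′} x≈ y≈ ε 0<ε =
    let B , 0<B , hx = eventually-bounded {seq x} (cauchy x)
        C , 0<C , hy = eventually-bounded {seq y′} (cauchy y′)
        d , 0<d , Bd = divide B (½ ℚ.* ε) 0<B (½*-pos 0<ε)
        c , 0<c , Cc = divide C (½ ℚ.* ε) 0<C (½*-pos 0<ε)
    in mapEventually
      (λ { n ((x≤B , y≤C) , (y~ , x~)) →
        *-close (seq x n) (seq y n) (seq x′ n) (seq y′ n) 0<B 0<C Bd Cc x≤B y≤C y~ x~ })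
      (eventually-× (eventually-× hx hy) (eventually-× (y≈ d 0<d) (x≈ c 0<c)))

  ℝ-commutativeRing : CommutativeRing 0ℓ 0ℓ
  ℝ-commutativeRing = record
    { Carrier = ℝ ; _≈_ = _≈ᴿ_ ; _+_ = _+_ ; _*_ = _*_ ; -_ = -_ ; 0# = 0# ; 1# = 1#
    ; isCommutativeRing = record
      { isRing = record
        { +-isAbelianGroup = record
          { isGroup = record
            { isMonoid = record
              { isSemigroup = record
                { isMagma = record
                  { isEquivalence = record { refl = λ {x} → pointwise {x} {x} (λ _ → ≡.refl)
                                           ; sym = λ {x} {y} → ≈ᴿ-sym {x} {y} ; trans = λ {x} {y} {z} → ≈ᴿ-trans {x} {y} {z} }
                  ; ∙-cong = λ {x} {x′} {y} {y′} → +ᴿ-cong {x} {x′} {y} {y′} }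
                ; assoc = λ x y z → pointwise {(x + y) + z} {x + (y + z)} (λ n → ℚ.+-assoc (seq x n) (seq y n) (seq z n)) }
              ; identity = (λ x → pointwise {0# + x} {x} (λ n → ℚ.+-identityˡ (seq x n)))
                         , (λ x → pointwise {x + 0#} {x} (λ n → ℚ.+-identityʳ (seq x n))) }
            ; inverse = (λ x → pointwise {(- x) + x} {0#} (λ n → ℚ.+-inverseˡ (seq x n)))
                      , (λ x → pointwise {x + (- x)} {0#} (λ n → ℚ.+-inverseʳ (seq x n)))
            ; ⁻¹-cong = λ {x} {y} → -ᴿ-cong {x} {y} }
          ; comm = λ x y → pointwise {x + y} {y + x} (λ n → ℚ.+-comm (seq x n) (seq y n)) }
        ; *-cong = λ {x} {x′} {y} {y′} → *ᴿ-cong {x} {x′} {y} {y′}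
        ; *-assoc = λ x y z → pointwise {(x * y) * z} {x * (y * z)} (λ n → ℚ.*-assoc (seq x n) (seq y n) (seq z n))
        ; *-identity = (λ x → pointwise {1# * x} {x} (λ n → ℚ.*-identityˡ (seq x n)))
                     , (λ x → pointwise {x * 1#} {x} (λ n → ℚ.*-identityʳ (seq x n)))
        ; distrib = (λ x y z → pointwise {x * (y + z)} {x * y + x * z} (λ n → ℚ.*-distribˡ-+ (seq x n) (seq y n) (seq z n)))
                  , (λ x y z → pointwise {(y + z) * x} {y * x + z * x} (λ n → ℚ.*-distribʳ-+ (seq x n) (seq y n) (seq z n))) }
      ; *-comm = λ x y → pointwise {x * y} {y * x} (λ n → ℚ.*-comm (seq x n) (seq y n)) } }

module ℝ-CR = CommutativeRing ℝ-commutativeRing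

-- The identities behind the real and imaginary parts are solved in an abstract ring, so that the
-- solver never meets the Cauchy sequences of ℝ.
module ComplexIdentities (R : CommutativeRing 0ℓ 0ℓ) where
  open CommutativeRing R
  open IntegerSolver R using (solve; _:+_; _:*_; _:-_; :-_; _:=_; con)

  re-assoc : ∀ a b c d e f → (a * c + - (b * d)) * e + - ((a * d + b * c) * f) ≈ a * (c * e + - (d * f)) + - (b * (c * f + d * e))
  re-assoc = solve 6 (λ a b c d e f → (a :* c :+ :- (b :* d)) :* e :+ :- ((a :* d :+ b :* c) :* f)
    := a :* (c :* e :+ :- (d :* f)) :+ :- (b :* (c :* f :+ d :* e))) refl

  im-assoc : ∀ a b c d e f → (a * c + - (b * d)) * f + (a * d + b * c) * e ≈ a * (c * f + d * e) + b * (c * e + - (d * f))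
  im-assoc = solve 6 (λ a b c d e f → (a :* c :+ :- (b :* d)) :* f :+ (a :* d :+ b :* c) :* e
    := a :* (c :* f :+ d :* e) :+ b :* (c :* e :+ :- (d :* f))) refl

  re-distribˡ : ∀ a b c d e f → a * (c + e) + - (b * (d + f)) ≈ (a * c + - (b * d)) + (a * e + - (b * f))
  re-distribˡ = solve 6 (λ a b c d e f → a :* (c :+ e) :+ :- (b :* (d :+ f)) := (a :* c :+ :- (b :* d)) :+ (a :* e :+ :- (b :* f))) refl

  im-distribˡ : ∀ a b c d e f → a * (d + f) + b * (c + e) ≈ (a * d + b * c) + (a * f + b * e)
  im-distribˡ = solve 6 (λ a b c d e f → a :* (d :+ f) :+ b :* (c :+ e) := (a :* d :+ b :* c) :+ (a :* f :+ b :* e)) refl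

  re-distribʳ : ∀ a b c d e f → (c + e) * a + - ((d + f) * b) ≈ (c * a + - (d * b)) + (e * a + - (f * b))
  re-distribʳ = solve 6 (λ a b c d e f → (c :+ e) :* a :+ :- ((d :+ f) :* b) := (c :* a :+ :- (d :* b)) :+ (e :* a :+ :- (f :* b))) refl

  im-distribʳ : ∀ a b c d e f → (c + e) * b + (d + f) * a ≈ (c * b + d * a) + (e * b + f * a)
  im-distribʳ = solve 6 (λ a b c d e f → (c :+ e) :* b :+ (d :+ f) :* a := (c :* b :+ d :* a) :+ (e :* b :+ f :* a)) refl

  re-comm : ∀ a b c d → a * c + - (b * d) ≈ c * a + - (d * b)
  re-comm = solve 4 (λ a b c d → a :* c :+ :- (b :* d) := c :* a :+ :- (d :* b)) refl

  im-comm : ∀ a b c d → a * d + b * c ≈ c * b + d * a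
  im-comm = solve 4 (λ a b c d → a :* d :+ b :* c := c :* b :+ d :* a) refl

  re-identityˡ : ∀ a b → 1# * a + - (0# * b) ≈ a
  re-identityˡ = solve 2 (λ a b → con (+ 1) :* a :+ :- (con (+ 0) :* b) := a) refl

  im-identityˡ : ∀ a b → 1# * b + 0# * a ≈ b
  im-identityˡ = solve 2 (λ a b → con (+ 1) :* b :+ con (+ 0) :* a := b) refl

  re-identityʳ : ∀ a b → a * 1# + - (b * 0#) ≈ a
  re-identityʳ = solve 2 (λ a b → a :* con (+ 1) :+ :- (b :* con (+ 0)) := a) refl

  im-identityʳ : ∀ a b → a * 0# + b * 1# ≈ b
  im-identityʳ = solve 2 (λ a b → a :* con (+ 0) :+ b :* con (+ 1) := b) refl

  re-real : ∀ a b → a * b ≈ a * b + - (0# * 0#)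
  re-real = solve 2 (λ a b → a :* b := a :* b :+ :- (con (+ 0) :* con (+ 0))) refl

  im-real : ∀ a b → 0# ≈ a * 0# + 0# * b
  im-real = solve 2 (λ a b → con (+ 0) := a :* con (+ 0) :+ con (+ 0) :* b) refl

module _ where
  open ℂ-ring
  open ComplexIdentities ℝ-commutativeRing
  private module A = ℝ-CR

  ℂ-commutativeRing : CommutativeRing 0ℓ 0ℓ
  ℂ-commutativeRing = record
    { Carrier = ℂ ; _≈_ = _≈_ ; _+_ = _+_ ; _*_ = _*_ ; -_ = -_ ; 0# = 0# ; 1# = 1#
    ; isCommutativeRing = record
      { isRing = record
        { +-isAbelianGroup = record
          { isGroup = record
            { isMonoid = record
              { isSemigroup = record
                { isMagma = record
                  { isEquivalence = record
                    { refl = λ {x} → A.refl {re x} , A.refl {im x}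
                    ; sym = λ {x} {y} (p , q) → A.sym {re x} {re y} p , A.sym {im x} {im y} q
                    ; trans = λ {x} {y} {z} (p , q) (r , s) → A.trans {re x} {re y} {re z} p r , A.trans {im x} {im y} {im z} q s }
                  ; ∙-cong = λ {x} {x′} {y} {y′} (p , q) (r , s) →
                      A.+-cong {re x} {re x′} {re y} {re y′} p r , A.+-cong {im x} {im x′} {im y} {im y′} q s }
                ; assoc = λ x y z → A.+-assoc (re x) (re y) (re z) , A.+-assoc (im x) (im y) (im z) }
              ; identity = (λ x → A.+-identityˡ (re x) , A.+-identityˡ (im x))
                         , (λ x → A.+-identityʳ (re x) , A.+-identityʳ (im x)) }
            ; inverse = (λ x → A.-‿inverseˡ (re x) , A.-‿inverseˡ (im x))
                      , (λ x → A.-‿inverseʳ (re x) , A.-‿inverseʳ (im x))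
            ; ⁻¹-cong = λ {x} {y} (p , q) → A.-‿cong {re x} {re y} p , A.-‿cong {im x} {im y} q }
          ; comm = λ x y → A.+-comm (re x) (re y) , A.+-comm (im x) (im y) }
        ; *-cong = λ {x} {x′} {y} {y′} (p , q) (r , s) →
               A.+-cong {re x A.* re y} {re x′ A.* re y′} {A.- (im x A.* im y)} {A.- (im x′ A.* im y′)}
                 (A.*-cong {re x} {re x′} {re y} {re y′} p r)
                 (A.-‿cong {im x A.* im y} {im x′ A.* im y′} (A.*-cong {im x} {im x′} {im y} {im y′} q s))
             , A.+-cong {re x A.* im y} {re x′ A.* im y′} {im x A.* re y} {im x′ A.* re y′}
                 (A.*-cong {re x} {re x′} {im y} {im y′} p s) (A.*-cong {im x} {im x′} {re y} {re y′} q r)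
        ; *-assoc = λ x y z → re-assoc (re x) (im x) (re y) (im y) (re z) (im z) , im-assoc (re x) (im x) (re y) (im y) (re z) (im z)
        ; *-identity = (λ x → re-identityˡ (re x) (im x) , im-identityˡ (re x) (im x))
                     , (λ x → re-identityʳ (re x) (im x) , im-identityʳ (re x) (im x))
        ; distrib = (λ x y z → re-distribˡ (re x) (im x) (re y) (im y) (re z) (im z) , im-distribˡ (re x) (im x) (re y) (im y) (re z) (im z))
                  , (λ x y z → re-distribʳ (re x) (im x) (re y) (im y) (re z) (im z) , im-distribʳ (re x) (im x) (re y) (im y) (re z) (im z)) }
      ; *-comm = λ x y → re-comm (re x) (im x) (re y) (im y) , im-comm (re x) (im x) (re y) (im y) } }

  fromℝ-isRingHomomorphism : RingMorphisms.IsRingHomomorphism ℝ-rawRing ℂ-rawRing fromℝ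
  fromℝ-isRingHomomorphism = record
    { isSemiringHomomorphism = record
      { isNearSemiringHomomorphism = record
        { +-isMonoidHomomorphism = record
          { isMagmaHomomorphism = record
            { isRelHomomorphism = record { cong = λ p → p , A.refl {A.0#} }
            ; homo = λ x y → A.refl {x A.+ y} , A.sym {A.0# A.+ A.0#} {A.0#} (A.+-identityˡ A.0#) }
          ; ε-homo = A.refl {A.0#} , A.refl {A.0#} }
        ; *-homo = λ x y → re-real x y , im-real x y }
      ; 1#-homo = A.refl {A.1#} , A.refl {A.0#} }
    ; -‿homo = λ x → A.refl {A.- x} , A.refl {A.0#} }

fromℚ-isRingHomomorphism : RingMorphisms.IsRingHomomorphism ℚ.+-*-rawRing ℝ-rawRing fromℚ
fromℚ-isRingHomomorphism = record
  { isSemiringHomomorphism = record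
    { isNearSemiringHomomorphism = record
      { +-isMonoidHomomorphism = record
        { isMagmaHomomorphism = record
          { isRelHomomorphism = record { cong = λ {p} p≡q → A.reflexive (≡.cong fromℚ p≡q) }
          ; homo = λ p q → pointwise {fromℚ (p ℚ.+ q)} {fromℚ p A.+ fromℚ q} (λ _ → ≡.refl) }
        ; ε-homo = A.refl {A.0#} }
      ; *-homo = λ p q → pointwise {fromℚ (p ℚ.* q)} {fromℚ p A.* fromℚ q} (λ _ → ≡.refl) }
    ; 1#-homo = A.refl {A.1#} }
  ; -‿homo = λ p → pointwise {fromℚ (ℚ.- p)} {A.- fromℚ p} (λ _ → ≡.refl) }
  where module A = ℝ-CR

-- Two different constants stay at distance |p - q|, which refutes convergence for that ε. Equations
-- derived in ℝ or ℂ return to ℚ through this lemma.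
fromℚ-injective : ∀ {p q} → fromℚ p ≈ᴿ fromℚ q → p ≡ q
fromℚ-injective {p} {q} p≈q with p ℚ.≟ q
... | yes p≡q = p≡q
... | no p≢q = let N , h = p≈q ℚ.∣ p ℚ.- q ∣ 0<d in ⊥-elim (ℚ.<-irrefl ≡.refl (h N ℕ.≤-refl))
  where
  open ℚ-Solver
  0≢d : 0ℚ ≢ ℚ.∣ p ℚ.- q ∣
  0≢d eq = p≢q (≡.trans (solve 2 (λ a b → a := (a :- b) :+ b) ≡.refl p q)
    (≡.trans (≡.cong (ℚ._+ q) (ℚ.∣p∣≡0⇒p≡0 (p ℚ.- q) (≡.sym eq))) (ℚ.+-identityˡ q)))
  0<d : 0ℚ ℚ.< ℚ.∣ p ℚ.- q ∣
  0<d = ℚ.≰⇒> (λ d≤0 → 0≢d (ℚ.≤-antisym (ℚ.0≤∣p∣ (p ℚ.- q)) d≤0))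

BoundedAway : ℝ → Set
BoundedAway x = ∃[ c ] (0ℚ ℚ.< c × Eventually (λ n → c ℚ.≤ ℚ.∣ seq x n ∣))

-- A negated equality yields apartness from 0 only under a double negation. For each ε take N with
-- oscillation below ε / 4: if the N-th term is below ε / 2, the tail is below ε; if not, the tail
-- stays above ε / 4, which was assumed impossible.
≉0⇒¬¬BoundedAway : ∀ {x} → x ≉ᴿ ℝ-ring.0# → ¬ ¬ BoundedAway x
≉0⇒¬¬BoundedAway {x} x≉0 ¬away = x≉0 λ ε 0<ε →
  let N , h = cauchy x (½ ℚ.* (½ ℚ.* ε)) (½*-pos (½*-pos 0<ε)) in close ε N h (ℚ.∣ seq x N ∣ ℚ.<? ½ ℚ.* ε) 0<ε
  where
  open ℚ-Solver
  open ℚ.≤-Reasoning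
  close : ∀ ε N → (∀ m n → N ℕ.≤ m → N ℕ.≤ n → ℚ.∣ seq x m ℚ.- seq x n ∣ ℚ.< ½ ℚ.* (½ ℚ.* ε)) →
    Dec (ℚ.∣ seq x N ∣ ℚ.< ½ ℚ.* ε) → 0ℚ ℚ.< ε →
    Eventually (λ n → ℚ.∣ seq x n ℚ.- 0ℚ ∣ ℚ.< ε)
  close ε N h (yes small) 0<ε = N , λ n p → ≡.subst (λ d → ℚ.∣ d ∣ ℚ.< ε)
    (solve 2 (λ a b → (a :- b) :+ b := a :- con 0ℚ) ≡.refl (seq x n) (seq x N))
    (∣+∣-< (seq x n ℚ.- seq x N) (seq x N) (ℚ.<-trans (h n N p ℕ.≤-refl) c<2c) small)
    where
    c<2c : ½ ℚ.* (½ ℚ.* ε) ℚ.< ½ ℚ.* ε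
    c<2c = begin-strict
      ½ ℚ.* (½ ℚ.* ε)                        ≡⟨ ℚ.+-identityʳ _ ⟨
      ½ ℚ.* (½ ℚ.* ε) ℚ.+ 0ℚ                 <⟨ ℚ.+-monoʳ-< (½ ℚ.* (½ ℚ.* ε)) (½*-pos (½*-pos 0<ε)) ⟩
      ½ ℚ.* (½ ℚ.* ε) ℚ.+ ½ ℚ.* (½ ℚ.* ε)    ≡⟨ ½+½ (½ ℚ.* ε) ⟩
      ½ ℚ.* ε                                ∎
  close ε N h (no large) 0<ε = ⊥-elim (¬away (½ ℚ.* (½ ℚ.* ε) , ½*-pos (½*-pos 0<ε) , N , λ n p →
    ℚ.≮⇒≥ λ x< → large (≡.subst (λ d → ℚ.∣ d ∣ ℚ.< ½ ℚ.* ε)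
      (solve 2 (λ a b → (a :- b) :+ b := a) ≡.refl (seq x N) (seq x n))
      (∣+∣-< (seq x N ℚ.- seq x n) (seq x n) (h N n ℕ.≤-refl p) x<))))

-- Lower bounds c and d for the factors contradict convergence of the product to 0 at ε = c d. As
-- the goal is absurdity, the doubly negated bounds may be opened.
noZeroDivisors : ∀ {x y} → x ℝ-ring.* y ≈ᴿ ℝ-ring.0# → x ≉ᴿ ℝ-ring.0# → y ≉ᴿ ℝ-ring.0# → ⊥
noZeroDivisors {x} {y} xy≈0 x≉0 y≉0 =
  ≉0⇒¬¬BoundedAway {x} x≉0 λ { (c , 0<c , hx) →
  ≉0⇒¬¬BoundedAway {y} y≉0 λ { (d , 0<d , hy) →
  absurd c d 0<c 0<d (eventually-× (eventually-× hx hy) (xy≈0 (c ℚ.* d) (0<cd c d 0<c 0<d))) } }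
  where
  open ℚ.≤-Reasoning
  0<cd : ∀ c d → 0ℚ ℚ.< c → 0ℚ ℚ.< d → 0ℚ ℚ.< c ℚ.* d
  0<cd c d 0<c 0<d = ≡.subst (ℚ._< c ℚ.* d) (ℚ.*-zeroʳ c) (ℚ.*-monoʳ-<-pos c {{ℚ.positive 0<c}} 0<d)
  absurd : ∀ c d → 0ℚ ℚ.< c → 0ℚ ℚ.< d → Eventually (λ n → (c ℚ.≤ ℚ.∣ seq x n ∣ × d ℚ.≤ ℚ.∣ seq y n ∣) ×
    ℚ.∣ seq x n ℚ.* seq y n ℚ.- 0ℚ ∣ ℚ.< c ℚ.* d) → ⊥
  absurd c d 0<c 0<d (N , h) = ℚ.<-irrefl ≡.refl (begin-strict
    c ℚ.* d                                  ≤⟨ ℚ.*-monoˡ-≤-nonNeg c {{ℚ.pos⇒nonNeg c {{ℚ.positive 0<c}}}} (proj₂ (proj₁ (h N ℕ.≤-refl))) ⟩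
    c ℚ.* ℚ.∣ seq y N ∣                      ≤⟨ ℚ.*-monoʳ-≤-nonNeg ℚ.∣ seq y N ∣ {{ℚ.∣-∣-nonNeg (seq y N)}} (proj₁ (proj₁ (h N ℕ.≤-refl))) ⟩
    ℚ.∣ seq x N ∣ ℚ.* ℚ.∣ seq y N ∣          ≡⟨ ℚ.∣p*q∣≡∣p∣*∣q∣ (seq x N) (seq y N) ⟨
    ℚ.∣ seq x N ℚ.* seq y N ∣                ≡⟨ ≡.cong ℚ.∣_∣ (ℚ.+-identityʳ (seq x N ℚ.* seq y N)) ⟨
    ℚ.∣ seq x N ℚ.* seq y N ℚ.- 0ℚ ∣         <⟨ proj₂ (h N ℕ.≤-refl) ⟩
    c ℚ.* d ∎)

p≤∣p∣ : ∀ p → p ℚ.≤ ℚ.∣ p ∣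
p≤∣p∣ p with ℚ.≤-total 0ℚ p
... | inj₁ 0≤p = ℚ.≤-reflexive (≡.sym (ℚ.0≤p⇒∣p∣≡p 0≤p))
... | inj₂ p≤0 = ℚ.≤-trans p≤0 (ℚ.0≤∣p∣ p)

-- For q < 0 the choice ε = - q fails at every term, since x² - q is at least - q there.
square-nonNegative : ∀ {x q} → x ℝ-ring.* x ≈ᴿ fromℚ q → 0ℚ ℚ.≤ q
square-nonNegative {x} {q} x²≈q = ℚ.≮⇒≥ λ q<0 →
  let N , h = x²≈q (ℚ.- q) (ℚ.neg-antimono-< q<0) in
  ℚ.<-irrefl ≡.refl (begin-strict
    ℚ.- q                                       ≡⟨ ℚ.+-identityˡ (ℚ.- q) ⟨
    0ℚ ℚ.- q                                    ≤⟨ ℚ.+-monoˡ-≤ (ℚ.- q) (square≥0 (seq x N)) ⟩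
    seq x N ℚ.* seq x N ℚ.- q                   ≤⟨ p≤∣p∣ _ ⟩
    ℚ.∣ seq x N ℚ.* seq x N ℚ.- q ∣             <⟨ h N ℕ.≤-refl ⟩
    ℚ.- q ∎)
  where
  open ℚ.≤-Reasoning
  square≥0 : ∀ p → 0ℚ ℚ.≤ p ℚ.* p
  square≥0 p with ℚ.∣p∣≡p∨∣p∣≡-p p
  ... | inj₁ e = ≡.subst (0ℚ ℚ.≤_) (≡.trans (ℚ.∣p*q∣≡∣p∣*∣q∣ p p) (≡.cong₂ ℚ._*_ e e)) (ℚ.0≤∣p∣ (p ℚ.* p))
  ... | inj₂ e = ≡.subst (0ℚ ℚ.≤_) (≡.trans (ℚ.∣p*q∣≡∣p∣*∣q∣ p p) (≡.trans (≡.cong₂ ℚ._*_ e e)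
    (ℚ-Solver.solve 1 (λ p → ℚ-Solver.:- p ℚ-Solver.:* ℚ-Solver.:- p ℚ-Solver.:= p ℚ-Solver.:* p) ≡.refl p))) (ℚ.0≤∣p∣ (p ℚ.* p))

-- The defining equation k (1/√k)² = 1.

module InverseSquareRoot (k : ℕ) where
  K : ℕ
  K = suc k

  scaledSquare : ℕ → ℕ → ℚᵘ.ℚᵘ
  scaledSquare j n = mkℚᵘ (+ K) 0 ℚᵘ.* (mkℚᵘ (+ j) n ℚᵘ.* mkℚᵘ (+ j) n)

  toℚᵘ-scaledSquare : ∀ j n →
    toℚᵘ ((+ K ℚ./ 1) ℚ.* ((+ j ℚ./ suc n) ℚ.* (+ j ℚ./ suc n))) ℚᵘ.≃ scaledSquare j n
  toℚᵘ-scaledSquare j n = begin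
    toℚᵘ ((+ K ℚ./ 1) ℚ.* ((+ j ℚ./ suc n) ℚ.* (+ j ℚ./ suc n)))
      ≈⟨ ℚ.toℚᵘ-homo-* (+ K ℚ./ 1) ((+ j ℚ./ suc n) ℚ.* (+ j ℚ./ suc n)) ⟩
    toℚᵘ (+ K ℚ./ 1) ℚᵘ.* toℚᵘ ((+ j ℚ./ suc n) ℚ.* (+ j ℚ./ suc n))
      ≈⟨ ℚᵘ.*-cong (ℚ.toℚᵘ-fromℚᵘ (mkℚᵘ (+ K) 0)) (ℚᵘ.≃-trans (ℚ.toℚᵘ-homo-* (+ j ℚ./ suc n) (+ j ℚ./ suc n))
           (ℚᵘ.*-cong (ℚ.toℚᵘ-fromℚᵘ (mkℚᵘ (+ j) n)) (ℚ.toℚᵘ-fromℚᵘ (mkℚᵘ (+ j) n)))) ⟩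
    scaledSquare j n ∎
    where open import Relation.Binary.Reasoning.Setoid ℚᵘ.≃-setoid

  numerator : ∀ j → + (K ℕ.* (j ℕ.* j) ℕ.* 1) ≡ + K ℤ.* (+ j ℤ.* + j) ℤ.* + 1
  numerator j = ≡.trans (ℤ.pos-* (K ℕ.* (j ℕ.* j)) 1) (≡.cong (ℤ._* + 1)
    (≡.trans (ℤ.pos-* K (j ℕ.* j)) (≡.cong (+ K ℤ.*_) (ℤ.pos-* j j))))

  rearrange : ∀ j → j ℕ.* j ℕ.* K ≡ K ℕ.* (j ℕ.* j) ℕ.* 1
  rearrange j = ℕ-Solver.solve 2 (λ j k → j ⊛ j ⊛ k ⊜ k ⊛ (j ⊛ j) ⊛ ℕ-Solver.con 1) ≡.refl j K
    where open ℕ-Solver using () renaming (_:*_ to infixl 7 _⊛_; _:=_ to infix 4 _⊜_)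

  rearrange′ : ∀ N → N ℕ.* N ≡ 1 ℕ.* (1 ℕ.* (N ℕ.* N))
  rearrange′ N = ≡.sym (≡.trans (ℕ.*-identityˡ _) (ℕ.*-identityˡ _))

  lower : ∀ j n → j ℕ.* j ℕ.* K ℕ.≤ suc n ℕ.* suc n →
    (+ K ℚ./ 1) ℚ.* ((+ j ℚ./ suc n) ℚ.* (+ j ℚ./ suc n)) ℚ.≤ 1ℚ
  lower j n h = ℚ.toℚᵘ-cancel-≤ (ℚᵘ.≤-respˡ-≃ (ℚᵘ.≃-sym (toℚᵘ-scaledSquare j n))
    (*≤* (≡.subst₂ ℤ._≤_ (numerator j) (ℤ.pos-* 1 (1 ℕ.* (suc n ℕ.* suc n)))
      (+≤+ (≡.subst₂ ℕ._≤_ (rearrange j) (rearrange′ (suc n)) h)))))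

  upper : ∀ j n → suc n ℕ.* suc n ℕ.< j ℕ.* j ℕ.* K →
    1ℚ ℚ.< (+ K ℚ./ 1) ℚ.* ((+ j ℚ./ suc n) ℚ.* (+ j ℚ./ suc n))
  upper j n h = ℚ.toℚᵘ-cancel-< (ℚᵘ.<-respʳ-≃ (ℚᵘ.≃-sym (toℚᵘ-scaledSquare j n))
    (*<* (≡.subst₂ ℤ._<_ (ℤ.pos-* 1 (1 ℕ.* (suc n ℕ.* suc n))) (numerator j)
      (+<+ (≡.subst₂ ℕ._<_ (rearrange′ (suc n)) (rearrange j) h)))))

  /-suc : ∀ j n → + suc j ℚ./ suc n ≡ (+ j ℚ./ suc n) ℚ.+ (+ 1 ℚ./ suc n)
  /-suc j n = ℚ.toℚᵘ-injective (begin
    toℚᵘ (+ suc j ℚ./ suc n)                        ≈⟨ ℚ.toℚᵘ-fromℚᵘ (mkℚᵘ (+ suc j) n) ⟩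
    mkℚᵘ (+ suc j) n                                ≈⟨ sum-≃ ⟩
    mkℚᵘ (+ j) n ℚᵘ.+ mkℚᵘ (+ 1) n
      ≈⟨ ℚᵘ.+-cong (ℚ.toℚᵘ-fromℚᵘ (mkℚᵘ (+ j) n)) (ℚ.toℚᵘ-fromℚᵘ (mkℚᵘ (+ 1) n)) ⟨
    toℚᵘ (+ j ℚ./ suc n) ℚᵘ.+ toℚᵘ (+ 1 ℚ./ suc n)   ≈⟨ ℚ.toℚᵘ-homo-+ (+ j ℚ./ suc n) (+ 1 ℚ./ suc n) ⟨
    toℚᵘ ((+ j ℚ./ suc n) ℚ.+ (+ 1 ℚ./ suc n))       ∎)
    where
    open import Relation.Binary.Reasoning.Setoid ℚᵘ.≃-setoid
    sum-≃ : mkℚᵘ (+ suc j) n ℚᵘ.≃ mkℚᵘ (+ j) n ℚᵘ.+ mkℚᵘ (+ 1) n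
    sum-≃ = *≡* (≡.trans
      (≡.cong (ℤ._* (+ suc n ℤ.* + suc n)) (≡.cong +_ (≡.sym (ℕ.+-comm j 1))))
      (≡.trans (≡.sym (ℤ.*-assoc (+ j ℤ.+ + 1) (+ suc n) (+ suc n)))
             (≡.cong (ℤ._* + suc n) (ℤ.*-distribʳ-+ (+ suc n) (+ j) (+ 1)))))

  0<1/ : ∀ n → 0ℚ ℚ.< + 1 ℚ./ suc n
  0<1/ n = ℚ.toℚᵘ-cancel-< (ℚᵘ.<-respʳ-≃ (ℚᵘ.≃-sym (ℚ.toℚᵘ-fromℚᵘ (mkℚᵘ (+ 1) n))) (*<* (+<+ (ℕ.s≤s ℕ.z≤n))))

  -- Added to the rounded-down j / (n + 1), it gives (j + 1) / (n + 1), an approximation of 1/√K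
  -- from above that represents the same real number.
  1/n : ℝ
  1/n = mkℝ (λ n → + 1 ℚ./ suc n) λ ε 0<ε →
    let N , h = archimedean ε 0<ε
        bound = λ m n N≤m → diff-< (+ 1 ℚ./ suc m) (+ 1 ℚ./ suc n) (+ 1 ℚ./ suc m)
          (≡.subst (ℚ._< (+ 1 ℚ./ suc n) ℚ.+ (+ 1 ℚ./ suc m)) (ℚ.+-identityˡ _) (ℚ.+-monoˡ-< (+ 1 ℚ./ suc m) (0<1/ n))) (h m N≤m)
    in N , λ m n p q → abs-< (+ 1 ℚ./ suc m) (+ 1 ℚ./ suc n) (bound m n p) (bound n m q)

  1/n≈0 : 1/n ≈ᴿ ℝ-ring.0#
  1/n≈0 ε 0<ε = let N , h = archimedean (½ ℚ.* ε) (½*-pos 0<ε) in N , λ n p → begin-strict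
    ℚ.∣ (+ 1 ℚ./ suc n) ℚ.- 0ℚ ∣   ≡⟨ ≡.cong ℚ.∣_∣ (ℚ.+-identityʳ (+ 1 ℚ./ suc n)) ⟩
    ℚ.∣ + 1 ℚ./ suc n ∣            ≡⟨ ℚ.0≤p⇒∣p∣≡p (ℚ.<⇒≤ (0<1/ n)) ⟩
    + 1 ℚ./ suc n                  ≤⟨ h n p ⟩
    ½ ℚ.* ε                        ≡⟨ ℚ.+-identityʳ _ ⟨
    ½ ℚ.* ε ℚ.+ 0ℚ                 <⟨ ℚ.+-monoʳ-< (½ ℚ.* ε) (½*-pos 0<ε) ⟩
    ½ ℚ.* ε ℚ.+ ½ ℚ.* ε            ≡⟨ ½+½ ε ⟩
    ε ∎
    where open ℚ.≤-Reasoning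

  open ℝ-CR using (_+_; _*_; 1#)

  x = 1/√ K
  y = x + 1/n

  y≈x : y ≈ᴿ x
  y≈x = ℝ-CR.trans {y} {x + ℝ-ring.0#} {x} (ℝ-CR.+-cong {x} {x} {1/n} {ℝ-ring.0#} (ℝ-CR.refl {x}) 1/n≈0) (ℝ-CR.+-identityʳ x)

  -- K x² ≤ 1 < K y² holds termwise for the approximations x from below and y from above.
  1/√-square : fromℕ K * (x * x) ≈ᴿ 1#
  1/√-square ε 0<ε = mapEventually close (*ᴿ-cong {fromℕ K} {fromℕ K} {y * y} {x * x} (ℝ-CR.refl {fromℕ K})
      (*ᴿ-cong {y} {x} {y} {x} y≈x y≈x) ε 0<ε)
    where
    open ℚ.≤-Reasoning
    close : ∀ n → ℚ.∣ seq (fromℕ K * (y * y)) n ℚ.- seq (fromℕ K * (x * x)) n ∣ ℚ.< ε →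
      ℚ.∣ seq (fromℕ K * (x * x)) n ℚ.- 1ℚ ∣ ℚ.< ε
    close n d<ε = abs-< a 1ℚ
      (begin-strict
        a ℚ.- 1ℚ     ≤⟨ ℚ.+-monoˡ-≤ (ℚ.- 1ℚ) a≤1 ⟩
        1ℚ ℚ.- 1ℚ    ≡⟨⟩
        0ℚ           <⟨ 0<ε ⟩
        ε            ∎)
      (begin-strict
        1ℚ ℚ.- a     <⟨ ℚ.+-monoˡ-< (ℚ.- a) 1<b ⟩
        b ℚ.- a      ≤⟨ p≤∣p∣ (b ℚ.- a) ⟩
        ℚ.∣ b ℚ.- a ∣ <⟨ d<ε ⟩
        ε            ∎)
      where
      j = ⌊ suc n /√ K ⌋
      a = seq (fromℕ K * (x * x)) n
      b = seq (fromℕ K * (y * y)) n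
      a≤1 : a ℚ.≤ 1ℚ
      a≤1 = lower j n (search-lower K (suc n) (suc n))
      1<b : 1ℚ ℚ.< b
      1<b = ≡.subst (λ t → 1ℚ ℚ.< (+ K ℚ./ 1) ℚ.* (t ℚ.* t)) (/-suc j n) (upper (suc j) n (⌊/√⌋-upper k (suc n)))

-- From the characteristic polynomial to the size of A and the trace of A².

module SpectrumEvaluation (S : CommutativeRing 0ℓ 0ℓ) {g : ℝ → CommutativeRing.Carrier S}
    (isHom : RingMorphisms.IsRingHomomorphism ℝ-rawRing (CommutativeRing.rawRing S) g)
    (s : CommutativeRing.Carrier S) where
  open CommutativeRing S
  open Matrices rawRing using (Matrix; Id; det; _•_; _-ᴹ_)
  open Evaluation ℝ-commutativeRing S isHom s
  open Polynomials ℝ-rawRing using (Poly; polyRing; X; C)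
  open DeterminantHomomorphism polyRing S eval-isRingHomomorphism using (det-homo; δ-homo)
  open Determinants S using (det-cong)
  private module P = RawRing polyRing

  ∏[s-_] : List ℝ → Carrier
  ∏[s- Λ ] = foldr (λ a p → (s - g a) * p) 1# Λ

  -- Evaluation is a homomorphism and therefore commutes with the determinant, so the factorisation
  -- of the characteristic polynomial may be read at any element of any target ring.
  eval-charPoly : ∀ {n} (A : Matrices.Matrix ℝ-rawRing (Fin n) (Fin n)) {Λ} → HasSpectrum A Λ →
    det (s • Id -ᴹ (λ i j → g (A i j))) ≈ ∏[s- Λ ]
  eval-charPoly {n} A {Λ} spectrum =
    trans (det-cong λ i j → sym (entry i j))
    (trans (sym (det-homo M))
    (trans (eval-cong (charPoly A) (product Λ) spectrum) (eval-product Λ)))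
    where
    M : Matrices.Matrix polyRing (Fin n) (Fin n)
    M i j = X P.* Matrices.δ polyRing i j P.+ P.- C (A i j)
    entry : ∀ i j → eval (M i j) ≈ (s • Id -ᴹ (λ i j → g (A i j))) i j
    entry i j = trans (eval-+ (X P.* Matrices.δ polyRing i j) (P.- C (A i j)))
      (+-cong (trans (eval-* X (Matrices.δ polyRing i j)) (*-cong eval-X (δ-homo i j)))
              (trans (eval-neg (C (A i j))) (-‿cong (eval-C (A i j)))))
    product : List ℝ → Poly
    product = foldr (λ a p → (X P.+ P.- C a) P.* p) P.1#
    eval-product : ∀ Λ → eval (product Λ) ≈ ∏[s- Λ ]
    eval-product []      = RingMorphisms.IsRingHomomorphism.1#-homo eval-isRingHomomorphism
    eval-product (a ∷ Λ) = trans (eval-* (X P.+ P.- C a) (product Λ)) (*-cong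
      (trans (eval-+ X (P.- C a)) (+-cong eval-X (trans (eval-neg (C a)) (-‿cong (eval-C a))))) (eval-product Λ))

module QuadraticIdentities (R : CommutativeRing 0ℓ 0ℓ) where
  open CommutativeRing R
  open IntegerSolver R using (solve; _:+_; _:*_; _:-_; :-_; _:=_; con)

  oppositeFactors : ∀ x a p q {c} → a * a ≈ c → (x - a) * p * ((- x - a) * q) ≈ (c - x * x) * (p * q) + 0#
  oppositeFactors x a p q a²≈c = trans
    (solve 4 (λ x a p q → (x :- a) :* p :* ((:- x :- a) :* q) := (a :* a :- x :* x) :* (p :* q) :+ con (+ 0)) refl x a p q)
    (+-congʳ (*-congʳ (+-congʳ a²≈c)))

  firstTerm : ∀ {m c} d e → m ≈ c → 1# * (m * d) + e ≈ c * d + e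
  firstTerm d e m≈c = +-congʳ (trans (*-identityˡ _) (*-congʳ m≈c))

  constantTimes : ∀ c x p → (c - x * x) * p ≈ c * p + - (x * (x * p))
  constantTimes = solve 3 (λ c x p → (c :- x :* x) :* p := c :* p :+ :- (x :* (x :* p))) refl

module TopCoefficients (R : CommutativeRing 0ℓ 0ℓ) where
  open CommutativeRing R hiding (zero)
  open Algebra.Properties.Ring ring
  open Algebra.Definitions.RawSemiring (RawRing.rawSemiring rawRing) using (_^_; sum)
  open IntegerSolver R using (solve; _:+_; _:*_; _:-_; :-_; _:=_; con)
  open PolynomialRing R using (coeff-+; coeff-neg; coeff-*; coeff-C*; _⋆_; ⋆-zeroˡ; C-isRingHomomorphism)
    renaming (commutativeRing to P)
  open Polynomials rawRing using (Poly; coeff; X; C)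
  private
    module P = CommutativeRing P
    module PQ = QuadraticIdentities P
    module PD = Determinants P
    module PA = MatrixAlgebra P
    module PM = Matrices P.rawRing
    module CH = RingMorphisms.IsRingHomomorphism C-isRingHomomorphism
  open Algebra.Definitions.RawSemiring (RawRing.rawSemiring P.rawRing) using () renaming (_^_ to _^ᴾ_; sum to sumᴾ)
  open Relation.Binary.Reasoning.Setoid setoid

  Degree≤ : ℕ → Poly → Set
  Degree≤ d p = ∀ i → d ℕ.< i → coeff p i ≈ 0#

  ⋆-support : ∀ d e f g → (∀ i → d ℕ.< i → f i ≈ 0#) → (∀ i → e ℕ.< i → g i ≈ 0#) →
    ∀ i → d ℕ.+ e ℕ.< i → (f ⋆ g) i ≈ 0#
  ⋆-support zero e f g f≈0 g≈0 (suc i) e<i = trans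
    (+-cong (trans (*-congˡ (g≈0 (suc i) e<i)) (zeroʳ _)) (⋆-zeroˡ g (λ j → f≈0 (suc j) (s≤s z≤n)) i))
    (+-identityˡ 0#)
  ⋆-support (suc d) e f g f≈0 g≈0 (suc i) (s≤s d+e<i) = trans
    (+-cong (trans (*-congˡ (g≈0 (suc i) (s≤s (ℕ.≤-trans (ℕ.m≤n+m e d) (ℕ.<⇒≤ d+e<i))))) (zeroʳ _))
            (⋆-support d e (f ∘ suc) g (λ j d<j → f≈0 (suc j) (s≤s d<j)) g≈0 i d+e<i))
    (+-identityˡ 0#)

  Degree≤-* : ∀ {d e} p q → Degree≤ d p → Degree≤ e q → Degree≤ (d ℕ.+ e) (p P.* q)
  Degree≤-* {d} {e} p q dp dq i d+e<i = trans (coeff-* p q i) (⋆-support d e (coeff p) (coeff q) dp dq i d+e<i)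

  Degree≤-sum : ∀ {d n} (f : Fin n → Poly) → (∀ j → Degree≤ d (f j)) → Degree≤ d (sumᴾ f)
  Degree≤-sum {n = zero}  f df i d<i = refl
  Degree≤-sum {n = suc n} f df i d<i = trans (coeff-+ (f zero) (sumᴾ (f ∘ suc)) i)
    (trans (+-cong (df zero i d<i) (Degree≤-sum (f ∘ suc) (df ∘ suc) i d<i)) (+-identityˡ 0#))

  Degree≤-^ : ∀ p → Degree≤ 0 p → ∀ n → Degree≤ 0 (p ^ᴾ n)
  Degree≤-^ p dp zero    (suc i) _ = refl
  Degree≤-^ p dp (suc n) i       h = Degree≤-* p (p ^ᴾ n) dp (Degree≤-^ p dp n) i h

  Degree≤-sgn : ∀ {n} (j : Fin n) → Degree≤ 0 (PD.sgn j)
  Degree≤-sgn j = Degree≤-^ (P.- P.1#) (λ { (suc i) _ → refl }) (toℕ j)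

  Degree≤-det : ∀ {n} (M : PM.Matrix (Fin n) (Fin n)) → (∀ i j → Degree≤ 2 (M i j)) → Degree≤ (double n) (PM.det M)
  Degree≤-det {zero}  M dM (suc i) _ = refl
  Degree≤-det {suc n} M dM = Degree≤-sum (λ j → PD.sgn j P.* (M zero j P.* PM.det (PD.minor M j))) λ j →
    Degree≤-* (PD.sgn j) (M zero j P.* PM.det (PD.minor M j)) (Degree≤-sgn j)
      (Degree≤-* (M zero j) (PM.det (PD.minor M j)) (dM zero j) (Degree≤-det (PD.minor M j) (λ i l → dM (suc i) (punchIn j l))))

  -- A constant row contributes nothing to the degree, which lowers the general bound by 2.
  Degree≤-det-constantRow : ∀ {n} (M : PM.Matrix (Fin (suc n)) (Fin (suc n))) r →
    (∀ i j → Degree≤ 2 (M i j)) → (∀ j → Degree≤ 0 (M r j)) → Degree≤ (double n) (PM.det M)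
  Degree≤-det-constantRow {n} M zero dM dr =
    Degree≤-sum (λ j → PD.sgn j P.* (M zero j P.* PM.det (PD.minor M j))) λ j →
      Degree≤-* (PD.sgn j) (M zero j P.* PM.det (PD.minor M j)) (Degree≤-sgn j)
        (Degree≤-* (M zero j) (PM.det (PD.minor M j)) (dr j) (Degree≤-det (PD.minor M j) (λ i l → dM (suc i) (punchIn j l))))
  Degree≤-det-constantRow {suc n} M (suc r) dM dr =
    Degree≤-sum (λ j → PD.sgn j P.* (M zero j P.* PM.det (PD.minor M j))) λ j →
      Degree≤-* (PD.sgn j) (M zero j P.* PM.det (PD.minor M j)) (Degree≤-sgn j)
        (Degree≤-* (M zero j) (PM.det (PD.minor M j)) (dM zero j)
          (Degree≤-det-constantRow (PD.minor M j) r (λ i l → dM (suc i) (punchIn j l)) (λ l → dr (punchIn j l))))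

  -- The coefficients of X² p. At `double n` this is the coefficient of p two places below, without
  -- a truncated subtraction and with value 0 for n = 0.
  shift² : Poly → ℕ → Carrier
  shift² p zero          = 0#
  shift² p (suc zero)    = 0#
  shift² p (suc (suc i)) = coeff p i

  coeff-X*-zero : ∀ p → coeff (X P.* p) zero ≈ 0#
  coeff-X*-zero p = trans (coeff-* X p zero) (zeroˡ _)

  coeff-X*-suc : ∀ p i → coeff (X P.* p) (suc i) ≈ coeff p i
  coeff-X*-suc p i = begin
    coeff (X P.* p) (suc i)                              ≈⟨ coeff-* X p (suc i) ⟩
    0# * coeff p (suc i) + (coeff (C 1#) ⋆ coeff p) i    ≈⟨ +-cong (zeroˡ _) (sym (coeff-* (C 1#) p i)) ⟩
    0# + coeff (C 1# P.* p) i                            ≈⟨ trans (+-identityˡ _) (coeff-C* 1# p i) ⟩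
    1# * coeff p i                                       ≈⟨ *-identityˡ _ ⟩
    coeff p i                                            ∎

  coeff-quadratic : ∀ b p i → coeff ((C b P.- X P.* X) P.* p) i ≈ b * coeff p i - shift² p i
  coeff-quadratic b p i = begin
    coeff ((C b P.- X P.* X) P.* p) i
      ≈⟨ PQ.constantTimes (C b) X p i ⟩
    coeff (C b P.* p P.+ P.- (X P.* (X P.* p))) i
      ≈⟨ trans (coeff-+ (C b P.* p) (P.- (X P.* (X P.* p))) i)
           (+-cong (coeff-C* b p i) (trans (coeff-neg (X P.* (X P.* p)) i) (-‿cong (shifted i)))) ⟩
    b * coeff p i - shift² p i ∎
    where
    shifted : ∀ i → coeff (X P.* (X P.* p)) i ≈ shift² p i
    shifted zero          = coeff-X*-zero (X P.* p)
    shifted (suc zero)    = trans (coeff-X*-suc (X P.* p) zero) (coeff-X*-zero p)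
    shifted (suc (suc i)) = trans (coeff-X*-suc (X P.* p) (suc i)) (coeff-X*-suc p i)

  -- p = (-1)ⁿ X²ⁿ - (-1)ⁿ t X²ⁿ⁻² + …, where the coefficient of X²ⁿ⁻¹ is left unspecified.
  record Leading (n : ℕ) (t : Carrier) (p : Poly) : Set where
    field
      degree : Degree≤ (double n) p
      first  : coeff p (double n) ≈ (- 1#) ^ n
      second : shift² p (double n) ≈ - ((- 1#) ^ n * t)

  leading-cong : ∀ {n t p q} → p P.≈ q → Leading n t p → Leading n t q
  leading-cong {n} {t} {p} {q} p≈q L = record
    { degree = λ i h → trans (sym (p≈q i)) (degree i h)
    ; first  = trans (sym (p≈q _)) first
    ; second = trans (sym (shift-cong (double n))) second
    }
    where
    open Leading L
    shift-cong : ∀ i → shift² p i ≈ shift² q i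
    shift-cong zero          = refl
    shift-cong (suc zero)    = refl
    shift-cong (suc (suc i)) = p≈q i

  leading-one : Leading 0 0# P.1#
  leading-one = record
    { degree = λ { (suc i) _ → refl } ; first = refl
    ; second = sym (trans (-‿cong (zeroʳ _)) -0#≈0#) }

  -- The factor b - X² reverses the sign and adds b to the trace term. The error `e` has only
  -- coefficients below 2 n and so misses the two recorded ones, which now sit at 2 n + 2 and 2 n.
  leading-step : ∀ {n t p q} b e → Leading n t p → (∀ i → double n ℕ.≤ i → coeff e i ≈ 0#) →
    q P.≈ (C b P.- X P.* X) P.* p P.+ e → Leading (suc n) (b + t) q
  leading-step {n} {t} {p} {q} b e L e≈0 q≈ = record
    { degree = λ { (suc (suc i)) (s≤s (s≤s h)) → begin
        coeff q (suc (suc i))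
          ≈⟨ formula _ (ℕ.≤-trans (ℕ.<⇒≤ h) (ℕ.m≤n+m i 2)) ⟩
        b * coeff p (suc (suc i)) - coeff p i
          ≈⟨ +-cong (*-congˡ (degree (suc (suc i)) (ℕ.≤-trans h (ℕ.m≤n+m i 2)))) (-‿cong (degree i h)) ⟩
        b * 0# - 0#
          ≈⟨ solve 1 (λ b → b :* con (+ 0) :- con (+ 0) := con (+ 0)) refl b ⟩
        0# ∎ }
    ; first = begin
        coeff q (suc (suc (double n)))
          ≈⟨ formula _ (ℕ.m≤n+m (double n) 2) ⟩
        b * coeff p (suc (suc (double n))) - coeff p (double n)
          ≈⟨ +-cong (*-congˡ (degree _ (ℕ.m≤n+m (suc (double n)) 1))) (-‿cong first) ⟩
        b * 0# - (- 1#) ^ n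
          ≈⟨ solve 2 (λ b s → b :* con (+ 0) :- s := :- con (+ 1) :* s) refl b ((- 1#) ^ n) ⟩
        - 1# * (- 1#) ^ n ∎
    ; second = begin
        coeff q (double n)
          ≈⟨ formula _ ℕ.≤-refl ⟩
        b * coeff p (double n) - shift² p (double n)
          ≈⟨ +-cong (*-congˡ first) (-‿cong second) ⟩
        b * (- 1#) ^ n - - ((- 1#) ^ n * t)
          ≈⟨ solve 3 (λ b s t → b :* s :- :- (s :* t) := :- (:- con (+ 1) :* s :* (b :+ t))) refl b ((- 1#) ^ n) t ⟩
        - (- 1# * (- 1#) ^ n * (b + t)) ∎
    }
    where
    open Leading L
    formula : ∀ i → double n ℕ.≤ i → coeff q i ≈ b * coeff p i - shift² p i
    formula i h = trans (q≈ i) (trans (coeff-+ ((C b P.- X P.* X) P.* p) e i)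
      (trans (+-cong (coeff-quadratic b p i) (e≈0 i h)) (+-identityʳ _)))

  Degree≤-C : ∀ b → Degree≤ 0 (C b)
  Degree≤-C b (suc i) _ = refl

  -- In the expansion along the first row, the first term is b₀₀ - X² times the next principal
  -- minor. Every other term starts with a constant entry, and its minor has lost a column but kept
  -- the row whose diagonal entry stood there; that row is constant, so the degree stays below 2 n.
  leading-det : ∀ {n} (M : PM.Matrix (Fin n) (Fin n)) (b : Fin n → Fin n → Carrier) →
    (∀ i → M i i P.≈ C (b i i) P.- X P.* X) → (∀ {i j} → i ≢ j → M i j P.≈ C (b i j)) →
    Leading n (sum (λ i → b i i)) (PM.det M)
  leading-det {zero}  M b diagonal off = leading-one
  leading-det {suc n} M b diagonal off = leading-step (b zero zero) (sumᴾ e)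
    (leading-det (PD.minor M zero) (λ i j → b (suc i) (suc j)) (diagonal ∘ suc) (λ i≢j → off (i≢j ∘ Fin.suc-injective)))
    sum-vanish
    (PQ.firstTerm {M zero zero} {C (b zero zero) P.- X P.* X} (PM.det (PD.minor M zero)) (sumᴾ e) (diagonal zero))
    where
    e : Fin n → Poly
    e j = PD.sgn (suc j) P.* (M zero (suc j) P.* PM.det (PD.minor M (suc j)))
    entry-degree : ∀ i j → Degree≤ 2 (M i j)
    entry-degree i j k h = entry k h (toSum (i Fin.≟ j))
      where
      entry : ∀ k → 2 ℕ.< k → (i ≡ j) ⊎ (i ≢ j) → coeff (M i j) k ≈ 0#
      entry (suc k) h (inj₂ i≢j)    = off i≢j (suc k)
      entry (suc (suc (suc k))) h (inj₁ ≡.refl) = trans (diagonal i (suc (suc (suc k))))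
        (trans (coeff-+ (C (b i i)) (P.- (X P.* X)) (suc (suc (suc k)))) (trans (+-identityˡ _) (trans (coeff-neg (X P.* X) (suc (suc (suc k))))
          (trans (-‿cong (trans (coeff-X*-suc X (suc (suc k))) refl)) -0#≈0#))))
      entry (suc zero) (s≤s ()) (inj₁ _)
      entry (suc (suc zero)) (s≤s (s≤s ())) (inj₁ _)
    off-degree : ∀ {i j} → i ≢ j → Degree≤ 0 (M i j)
    off-degree {i} {j} i≢j k h = trans (off i≢j k) (Degree≤-C (b i j) k h)
    term : ∀ {m} (j : Fin m) (N : PM.Matrix (Fin m) (Fin m)) q → Degree≤ 0 q → (∀ i l → Degree≤ 2 (N i l)) →
      (∀ l → Degree≤ 0 (N j l)) → ∀ i → double m ℕ.≤ i → coeff (PD.sgn (suc j) P.* (q P.* PM.det N)) i ≈ 0#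
    term {suc m} j N q dq dN dj i h = Degree≤-* (PD.sgn (suc j)) (q P.* PM.det N) (Degree≤-sgn (suc j))
      (Degree≤-* q (PM.det N) dq (Degree≤-det-constantRow N j dN dj)) i (ℕ.≤-trans (ℕ.m≤n+m (suc (double m)) 1) h)
    sum-vanish : ∀ i → double n ℕ.≤ i → coeff (sumᴾ e) i ≈ 0#
    sum-vanish i h = Degree≤-sum-at e (λ j → term j (PD.minor M (suc j)) (M zero (suc j)) (off-degree (λ ()))
      (λ r l → entry-degree (suc r) (punchIn (suc j) l))
      (λ l → off-degree (Fin.punchInᵢ≢i (suc j) l ∘ ≡.sym)) i h)
      where
      Degree≤-sum-at : ∀ {m} (f : Fin m → Poly) → (∀ j → coeff (f j) i ≈ 0#) → coeff (sumᴾ f) i ≈ 0#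
      Degree≤-sum-at {zero}  f f≈0 = refl
      Degree≤-sum-at {suc m} f f≈0 = trans (coeff-+ (f zero) (sumᴾ (f ∘ suc)) i)
        (trans (+-cong (f≈0 zero) (Degree≤-sum-at (f ∘ suc) (f≈0 ∘ suc))) (+-identityˡ 0#))

  linearFactors : Poly → List Carrier → Poly
  linearFactors s = foldr (λ a p → (s P.- C a) P.* p) P.1#

  sumOfSquares : List Carrier → Carrier
  sumOfSquares = foldr (λ a t → a * a + t) 0#

  leading-factors : ∀ Λ → Leading (length Λ) (sumOfSquares Λ) (linearFactors X Λ P.* linearFactors (P.- X) Λ)
  leading-factors []      = leading-cong {p = P.1#} {P.1# P.* P.1#} (P.sym {P.1# P.* P.1#} {P.1#} (P.*-identityˡ P.1#)) leading-one
  leading-factors (a ∷ Λ) = leading-step (a * a) P.0# (leading-factors Λ) (λ _ _ → refl)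
    (PQ.oppositeFactors X (C a) (linearFactors X Λ) (linearFactors (P.- X) Λ) {C (a * a)}
      (P.sym {C (a * a)} {C a P.* C a} (CH.*-homo a a)))

  sign-square : ∀ n → (- 1#) ^ n * (- 1#) ^ n ≈ 1#
  sign-square zero    = *-identityˡ 1#
  sign-square (suc n) = trans
    (solve 1 (λ s → :- con (+ 1) :* s :* (:- con (+ 1) :* s) := s :* s) refl ((- 1#) ^ n)) (sign-square n)

  -- A top coefficient with square 1 cannot vanish, which makes the degrees agree; being its own
  -- inverse, it then cancels from the second coefficients.
  leading-unique : ∀ {n m s t p} → ¬ (1# ≈ 0#) → Leading n s p → Leading m t p → n ≡ m × s ≈ t
  leading-unique {n} {m} {s} {t} {p} 1≉0 Ls Lt = compare (ℕ.<-cmp n m)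
    where
    module Ls = Leading Ls
    module Lt = Leading Lt
    double-mono-< : ∀ {n m} → n ℕ.< m → double n ℕ.< double m
    double-mono-< {zero}  {suc m} _         = s≤s z≤n
    double-mono-< {suc n} {suc m} (s≤s n<m) = s≤s (s≤s (double-mono-< n<m))
    sign≉0 : ∀ k → ¬ ((- 1#) ^ k ≈ 0#)
    sign≉0 k s≈0 = 1≉0 (trans (sym (sign-square k)) (trans (*-congʳ s≈0) (zeroˡ _)))
    cancel : ∀ {k x y} → (- 1#) ^ k * x ≈ (- 1#) ^ k * y → x ≈ y
    cancel {k} {x} {y} eq = begin
      x                                      ≈⟨ trans (*-congʳ (sign-square k)) (*-identityˡ x) ⟨
      (- 1#) ^ k * (- 1#) ^ k * x            ≈⟨ trans (*-assoc _ _ _) (trans (*-congˡ eq) (sym (*-assoc _ _ _))) ⟩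
      (- 1#) ^ k * (- 1#) ^ k * y            ≈⟨ trans (*-congʳ (sign-square k)) (*-identityˡ y) ⟩
      y                                      ∎
    compare : Tri (n ℕ.< m) (n ≡ m) (m ℕ.< n) → n ≡ m × s ≈ t
    compare (tri< n<m _ _) = ⊥-elim (sign≉0 m (trans (sym Lt.first) (Ls.degree (double m) (double-mono-< n<m))))
    compare (tri> _ _ m<n) = ⊥-elim (sign≉0 n (trans (sym Ls.first) (Lt.degree (double n) (double-mono-< m<n))))
    compare (tri≈ _ ≡.refl _) = ≡.refl , cancel {n} (-‿injective (trans (sym Ls.second) Lt.second))

  -- Both sides of det (A² - X²) = ∏ (λ² - X²) are compared in their two top coefficients. The size
  -- of the matrix comes out as well; this is the source of n = 2 + 2 M.
  squareTrace : ∀ {n} (A : Fin n → Fin n → Carrier) Λ → ¬ (1# ≈ 0#) →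
    PM.det (X PM.• PM.Id PM.-ᴹ (λ i j → C (A i j))) P.≈ linearFactors X Λ →
    PM.det ((P.- X) PM.• PM.Id PM.-ᴹ (λ i j → C (A i j))) P.≈ linearFactors (P.- X) Λ →
    n ≡ length Λ × sum (λ i → sum (λ l → A i l * A l i)) ≈ sumOfSquares Λ
  squareTrace {n} A Λ 1≉0 det₊ det₋ = leading-unique 1≉0
    (leading-det N b (λ i → PA.oppositeShifts-diagonal X A′ {C (b i i)} i (A′² i i))
                     (λ {i} {j} i≢j → PA.oppositeShifts-off X A′ {C (b i j)} i≢j (A′² i j)))
    (leading-cong {p = linearFactors X Λ P.* linearFactors (P.- X) Λ} {PM.det N}
      (PA.det-oppositeShifts X A′ {linearFactors X Λ} {linearFactors (P.- X) Λ} det₊ det₋) (leading-factors Λ))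
    where
    open DeterminantHomomorphism rawRing P C-isRingHomomorphism using (sum-homo)
    A′ N : PM.Matrix (Fin n) (Fin n)
    A′ i j = C (A i j)
    N = PA.oppositeShifts X A′
    b : Fin n → Fin n → Carrier
    b i j = sum (λ l → A i l * A l j)
    A′² : ∀ i j → (A′ PM.· A′) i j P.≈ C (b i j)
    A′² i j = P.sym {C (b i j)} {(A′ PM.· A′) i j} (P.trans {C (b i j)} {sumᴾ (λ l → C (A i l * A l j))} {(A′ PM.· A′) i j}
      (sum-homo (λ l → A i l * A l j))
      (PA.sumOver-cong {f = λ l → C (A i l * A l j)} {g = λ l → C (A i l) P.* C (A l j)} (λ l → CH.*-homo (A i l) (A l j))))

-- Chebyshev polynomials and the Grover walk.

module ChebyshevPolynomials (R : RawRing 0ℓ 0ℓ) where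
  open RawRing R

  chebyshev : Carrier → ℕ → Carrier
  chebyshev x zero          = 1#
  chebyshev x (suc zero)    = x
  chebyshev x (suc (suc j)) = (1# + 1#) * x * chebyshev x (suc j) + - chebyshev x j

module ChebyshevHomomorphism (S : RawRing 0ℓ 0ℓ) (R : CommutativeRing 0ℓ 0ℓ)
    {h : RawRing.Carrier S → CommutativeRing.Carrier R}
    (isHom : RingMorphisms.IsRingHomomorphism S (CommutativeRing.rawRing R) h) where
  open CommutativeRing R
  open RingMorphisms.IsRingHomomorphism isHom
  open ChebyshevPolynomials
  private module S = RawRing S

  chebyshev-homo : ∀ x {y} → h x ≈ y → ∀ j → h (chebyshev S x j) ≈ chebyshev rawRing y j
  chebyshev-homo x hx≈y zero          = 1#-homo
  chebyshev-homo x hx≈y (suc zero)    = hx≈y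
  chebyshev-homo x hx≈y (suc (suc j)) = trans (+-homo _ _) (+-cong
    (trans (*-homo _ _) (*-cong (trans (*-homo _ _) (*-cong (trans (+-homo S.1# S.1#) (+-cong 1#-homo 1#-homo)) hx≈y))
                                (chebyshev-homo x hx≈y (suc j))))
    (trans (-‿homo _) (-‿cong (chebyshev-homo x hx≈y j))))

module Walk (R : CommutativeRing 0ℓ 0ℓ) where
  open CommutativeRing R hiding (zero)
  open Algebra.Properties.Ring ring
  open Algebra.Definitions.RawSemiring (RawRing.rawSemiring rawRing) using (_^_)
  open IntegerSolver R using (solve; _:+_; _:*_; _:-_; :-_; _:=_; con)
  open Matrices rawRing
  open MatrixAlgebra R
  open Determinants R using (det-cong; det-*)
  open ChebyshevPolynomials rawRing

  -- This is T₂ⱼ = Tⱼ ∘ T₂. Values at even index depend only on x², so at θ / k they are rational as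
  -- soon as θ² is.
  chebyshev-double : ∀ x j → chebyshev x (double j) ≈ chebyshev ((1# + 1#) * x * x - 1#) j
  chebyshev-double x zero          = refl
  chebyshev-double x (suc zero)    = refl
  chebyshev-double x (suc (suc j)) = trans
    (solve 3 (λ x a b → two :* x :* (two :* x :* (two :* x :* b :- a) :- b) :- (two :* x :* b :- a)
       := two :* (two :* x :* x :- con (+ 1)) :* (two :* x :* b :- a) :- a) refl x (chebyshev x (double j)) (chebyshev x (suc (double j))))
    (+-cong (*-congˡ (chebyshev-double x (suc j))) (-‿cong (chebyshev-double x j)))
    where two = con (+ 1) :+ con (+ 1)

  matrixSetoid : Set → Set → Setoid 0ℓ 0ℓ
  matrixSetoid I J = record
    { Carrier = Matrix I J ; _≈_ = _≈ᴹ_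
    ; isEquivalence = record
      { refl = λ {A} → ≈ᴹ-refl {A = A} ; sym = λ {A} {B} → ≈ᴹ-sym {A = A} {B}
      ; trans = λ {A} {B} {C} → ≈ᴹ-trans {A = A} {B} {C} } }

  module _ {E : Set} {n : ℕ} {{_ : Finite E}} (d : Matrix (Fin n) E) (P : Matrix E (Fin n)) (S : Matrix E E)
      (T : Matrix (Fin n) (Fin n))
      (dP≈Id : d · P ≈ᴹ Id) (SS≈Id : S · S ≈ᴹ Id) (dSP≈T : d · (S · P) ≈ᴹ T) where
    private
      module W = Relation.Binary.Reasoning.Setoid (matrixSetoid E (Fin n))
      2T : Matrix (Fin n) (Fin n)
      2T = (1# + 1#) • T
      G U : Matrix E E
      G = (1# + 1#) • (P · d) -ᴹ Id
      U = S · G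
      Q : Matrix E (Fin n)
      Q = S · P

    G-·  : ∀ (M : Matrix E (Fin n)) → G · M ≈ᴹ (1# + 1#) • (P · (d · M)) -ᴹ M
    G-· M e x = trans (·-distribʳ--ᴹ ((1# + 1#) • (P · d)) Id M e x)
      (+-cong (trans (•-·-assoc (1# + 1#) (P · d) M e x) (*-congˡ (·-assoc P d M e x))) (-‿cong (·-identityˡ M e x)))

    U-P : U · P ≈ᴹ Q
    U-P = W.begin
      U · P                                      W.≈⟨ ·-assoc S G P ⟩
      S · (G · P)                                W.≈⟨ ·-cong {A = S} (≈ᴹ-refl {A = S}) G-P ⟩
      S · P                                      W.∎
      where
      G-P : G · P ≈ᴹ P
      G-P e x = trans (G-· P e x) (trans (+-congʳ (*-congˡ (trans
        (·-cong {A = P} (≈ᴹ-refl {A = P}) dP≈Id e x) (·-identityʳ P e x))))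
        (solve 1 (λ p → (con (+ 1) :+ con (+ 1)) :* p :- p := p) refl (P e x)))

    -- The coin `G` sends Q to P · 2T - Q because d Q = T; the shift then turns P into Q and, being
    -- an involution, Q back into P.
    U-Q : U · Q ≈ᴹ Q · 2T -ᴹ P
    U-Q = W.begin
      U · Q                                      W.≈⟨ ·-assoc S G Q ⟩
      S · (G · Q)                                W.≈⟨ ·-cong {A = S} (≈ᴹ-refl {A = S}) G-Q ⟩
      S · (P · 2T -ᴹ Q)                          W.≈⟨ ·-distribˡ--ᴹ S (P · 2T) Q ⟩
      S · (P · 2T) -ᴹ S · Q
        W.≈⟨ -ᴹ-cong {B = S · Q} {P} (≈ᴹ-sym {A = Q · 2T} (·-assoc S P 2T)) SQ ⟩
      Q · 2T -ᴹ P                                W.∎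
      where
      G-Q : G · Q ≈ᴹ P · 2T -ᴹ Q
      G-Q e x = trans (G-· Q e x) (+-congʳ (trans (*-congˡ (·-cong {A = P} (≈ᴹ-refl {A = P}) dSP≈T e x))
        (sym (·-•-comm (1# + 1#) P T e x))))
      SQ : S · Q ≈ᴹ P
      SQ e x = trans (sym (·-assoc S S P e x)) (trans (·-cong {B = P} SS≈Id (≈ᴹ-refl {A = P}) e x) (·-identityˡ P e x))

    F : ℕ → Matrix E (Fin n)
    F zero    = P
    F (suc j) = U · F j

    -- The walk multiplies on the left and `2T` on the right, so associativity carries the case of
    -- index 0 to all later ones.
    F-recurrence : ∀ j → F (suc (suc j)) ≈ᴹ F (suc j) · 2T -ᴹ F j
    F-recurrence zero = W.begin
      U · (U · P)             W.≈⟨ ·-cong {A = U} (≈ᴹ-refl {A = U}) U-P ⟩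
      U · Q                   W.≈⟨ U-Q ⟩
      Q · 2T -ᴹ P             W.≈⟨ -ᴹ-cong {B = P} (·-cong {B = 2T} (≈ᴹ-sym {A = U · P} U-P) (≈ᴹ-refl {A = 2T})) (≈ᴹ-refl {A = P}) ⟩
      (U · P) · 2T -ᴹ P       W.∎
    F-recurrence (suc j) = W.begin
      U · F (suc (suc j))                          W.≈⟨ ·-cong {A = U} (≈ᴹ-refl {A = U}) (F-recurrence j) ⟩
      U · (F (suc j) · 2T -ᴹ F j)                  W.≈⟨ ·-distribˡ--ᴹ U (F (suc j) · 2T) (F j) ⟩
      U · (F (suc j) · 2T) -ᴹ U · F j
        W.≈⟨ -ᴹ-cong {B = F (suc j)} (≈ᴹ-sym {A = (U · F (suc j)) · 2T} (·-assoc U (F (suc j)) 2T)) (≈ᴹ-refl {A = F (suc j)}) ⟩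
      F (suc (suc j)) · 2T -ᴹ F (suc j)            W.∎

    F-power : ∀ j → F j ≈ᴹ (U ^ᴹ j) · P
    F-power zero    = ≈ᴹ-sym {A = Id · P} (·-identityˡ P)
    F-power (suc j) = W.begin
      U · F j               W.≈⟨ ·-cong {A = U} (≈ᴹ-refl {A = U}) (F-power j) ⟩
      U · (U ^ᴹ j · P)      W.≈⟨ ·-assoc U (U ^ᴹ j) P ⟨
      (U · U ^ᴹ j) · P      W.∎

    -- Powers of the walk restricted to the vertices are Chebyshev polynomials in T, so modulo
    -- left multiples of N they agree with the Chebyshev polynomials at the eigenvalue σ.
    module _ (N B : Matrix (Fin n) (Fin n)) (σ : Carrier) (T-σ : T -ᴹ σ • Id ≈ᴹ N · B) where

      Congruent : Matrix (Fin n) (Fin n) → Carrier → Set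
      Congruent M s = Σ[ C ∈ Matrix (Fin n) (Fin n) ] M -ᴹ s • Id ≈ᴹ N · C

      -- The matrices N · C are stable under multiplication on the right: M′ · 2T is congruent to s′
      -- · 2T, and replacing T by σ there gives the Chebyshev recurrence. The witness `C″` adds up
      -- the three cofactors involved.
      congruent-step : ∀ {M M′ s s′} → Congruent M′ s′ → Congruent M s →
        Congruent (M′ · 2T -ᴹ M) ((1# + 1#) * σ * s′ - s)
      congruent-step {M} {M′} {s} {s′} (C′ , p′) (C , p) = C″ , λ i j → begin
        ((M′ · 2T) i j - M i j) - ((1# + 1#) * σ * s′ - s) * δ i j
          ≈⟨ regroup i j ⟩
        ((M′ -ᴹ s′ • Id) · 2T) i j + ((1# + 1#) * s′ * (T -ᴹ σ • Id) i j - (M -ᴹ s • Id) i j)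
          ≈⟨ +-cong (trans (·-cong {B = 2T} p′ (≈ᴹ-refl {A = 2T}) i j) (·-assoc N C′ 2T i j))
               (+-cong (trans (*-congˡ (T-σ i j)) (sym (·-•-comm ((1# + 1#) * s′) N B i j))) (-‿cong (p i j))) ⟩
        (N · (C′ · 2T)) i j + ((N · (((1# + 1#) * s′) • B)) i j - (N · C) i j)
          ≈⟨ collect i j ⟨
        (N · C″) i j ∎
        where
        open Relation.Binary.Reasoning.Setoid setoid
        D = C -ᴹ ((1# + 1#) * s′) • B
        C″ = C′ · 2T -ᴹ D
        collect : ∀ i j → (N · C″) i j ≈ (N · (C′ · 2T)) i j + ((N · (((1# + 1#) * s′) • B)) i j - (N · C) i j)
        collect i j = trans (·-distribˡ--ᴹ N (C′ · 2T) D i j) (+-congˡ (trans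
          (-‿cong (·-distribˡ--ᴹ N C (((1# + 1#) * s′) • B) i j))
          (solve 2 (λ a b → :- (a :- b) := b :- a) refl _ _)))
        regroup : ∀ i j → ((M′ · 2T) i j - M i j) - ((1# + 1#) * σ * s′ - s) * δ i j ≈
          ((M′ -ᴹ s′ • Id) · 2T) i j + ((1# + 1#) * s′ * (T -ᴹ σ • Id) i j - (M -ᴹ s • Id) i j)
        regroup i j = trans
          (solve 7 (λ a m σ s′ s δ t → let two = con (+ 1) :+ con (+ 1) in
              (a :- m) :- (two :* σ :* s′ :- s) :* δ
                := (a :- s′ :* (two :* t)) :+ (two :* s′ :* (t :- σ :* δ) :- (m :- s :* δ)))
            refl ((M′ · 2T) i j) (M i j) σ s′ s (δ i j) (T i j))
          (+-congʳ (sym (trans (·-distribʳ--ᴹ M′ (s′ • Id) 2T i j)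
            (+-congˡ (-‿cong (trans (•-·-assoc s′ Id 2T i j) (*-congˡ (·-identityˡ 2T i j))))))))

      congruent-resp : ∀ {M M′ s} → M′ ≈ᴹ M → Congruent M s → Congruent M′ s
      congruent-resp M′≈M (C , p) = C , λ i j → trans (+-congʳ (M′≈M i j)) (p i j)

      -- Two consecutive indices are carried along because the recurrence reaches back two steps.
      walk-congruent : ∀ j → Congruent (d · F j) (chebyshev σ j) × Congruent (d · F (suc j)) (chebyshev σ (suc j))
      walk-congruent zero =
          congruent-resp dP≈Id ((λ _ _ → 0#) , λ i j → trans
            (solve 1 (λ δ → δ :- con (+ 1) :* δ := con (+ 0)) refl (δ i j))
            (sym (trans (sumOver-cong (λ l → zeroʳ (N i l))) (sumOver-zero {J = Fin n}))))
        , congruent-resp (λ i j → trans (·-cong {A = d} (≈ᴹ-refl {A = d}) U-P i j) (dSP≈T i j)) (B , T-σ)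
      walk-congruent (suc j) = let p , p′ = walk-congruent j in p′ ,
        congruent-resp (λ x y → trans (·-cong {A = d} (≈ᴹ-refl {A = d}) (F-recurrence j) x y)
            (trans (·-distribˡ--ᴹ d (F (suc j) · 2T) (F j) x y) (+-congʳ (sym (·-assoc d (F (suc j)) 2T x y)))))
          (congruent-step p′ p)

      -- The determinant does the work of an eigenvector: (1 - c) Id = N · C has determinant 0, and
      -- the left side contributes (1 - c)ⁿ. Two periods are used in order to obtain an even
      -- Chebyshev index.
      periodic⇒chebyshev : det N ≈ 0# → ∀ τ → U ^ᴹ τ ≈ᴹ Id → (1# - chebyshev σ (double τ)) ^ n ≈ 0#
      periodic⇒chebyshev detN≈0 τ Uτ≈Id = begin
        (1# - c) ^ n             ≈⟨ det-scalar n (1# - c) ⟨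
        det {n} ((1# - c) • Id)
          ≈⟨ det-cong (λ i j → trans (solve 2 (λ c δ → (con (+ 1) :- c) :* δ := δ :- c :* δ) refl c (δ i j))
               (trans (+-congʳ (sym (dF≈Id i j))) (eq i j))) ⟩
        det (N · C)              ≈⟨ det-* N C ⟩
        det N * det C            ≈⟨ trans (*-congʳ detN≈0) (zeroˡ _) ⟩
        0#                       ∎
        where
        open Relation.Binary.Reasoning.Setoid setoid
        c = chebyshev σ (double τ)
        C = proj₁ (proj₁ (walk-congruent (double τ)))
        eq : d · F (double τ) -ᴹ c • Id ≈ᴹ N · C
        eq = proj₂ (proj₁ (walk-congruent (double τ)))
        F-τ : F τ ≈ᴹ P
        F-τ e x = trans (F-power τ e x) (trans (·-cong {B = P} Uτ≈Id (≈ᴹ-refl {A = P}) e x) (·-identityˡ P e x))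
        F-shift : ∀ j → F (j ℕ.+ τ) ≈ᴹ F j
        F-shift zero    = F-τ
        F-shift (suc j) = ·-cong {A = U} (≈ᴹ-refl {A = U}) (F-shift j)
        double≡ : ∀ m → double m ≡ m ℕ.+ m
        double≡ zero    = ≡.refl
        double≡ (suc m) = ≡.cong suc (≡.trans (≡.cong suc (double≡ m)) (≡.sym (ℕ.+-suc m m)))
        dF≈Id : d · F (double τ) ≈ᴹ Id
        dF≈Id x y = trans (·-cong {A = d} (≈ᴹ-refl {A = d}) F-2τ x y) (dP≈Id x y)
          where
          F-2τ : F (double τ) ≈ᴹ P
          F-2τ e x = trans (reflexive (≡.cong (λ m → F m e x) (double≡ τ))) (trans (F-shift τ e x) (F-τ e x))

-- Integrality of rational numbers at which a Chebyshev polynomial takes the value 1.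

fromℤ : ℤ → ℚ
fromℤ i = i ℚ./ 1

toℚᵘ-fromℤ : ∀ i → toℚᵘ (fromℤ i) ℚᵘ.≃ mkℚᵘ i 0
toℚᵘ-fromℤ i = ℚ.toℚᵘ-fromℚᵘ (mkℚᵘ i 0)

fromℤ-+ : ∀ i j → fromℤ (i ℤ.+ j) ≡ fromℤ i ℚ.+ fromℤ j
fromℤ-+ i j = ℚ.toℚᵘ-injective (begin
  toℚᵘ (fromℤ (i ℤ.+ j))                     ≈⟨ toℚᵘ-fromℤ (i ℤ.+ j) ⟩
  mkℚᵘ (i ℤ.+ j) 0                           ≈⟨ *≡* (≡.cong (ℤ._* + 1) (≡.cong₂ ℤ._+_ (≡.sym (ℤ.*-identityʳ i)) (≡.sym (ℤ.*-identityʳ j)))) ⟩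
  mkℚᵘ i 0 ℚᵘ.+ mkℚᵘ j 0                     ≈⟨ ℚᵘ.+-cong (toℚᵘ-fromℤ i) (toℚᵘ-fromℤ j) ⟨
  toℚᵘ (fromℤ i) ℚᵘ.+ toℚᵘ (fromℤ j)         ≈⟨ ℚ.toℚᵘ-homo-+ (fromℤ i) (fromℤ j) ⟨
  toℚᵘ (fromℤ i ℚ.+ fromℤ j)                 ∎)
  where open import Relation.Binary.Reasoning.Setoid ℚᵘ.≃-setoid

fromℤ-* : ∀ i j → fromℤ (i ℤ.* j) ≡ fromℤ i ℚ.* fromℤ j
fromℤ-* i j = ℚ.toℚᵘ-injective (begin
  toℚᵘ (fromℤ (i ℤ.* j))                     ≈⟨ toℚᵘ-fromℤ (i ℤ.* j) ⟩
  mkℚᵘ i 0 ℚᵘ.* mkℚᵘ j 0                     ≈⟨ ℚᵘ.*-cong (toℚᵘ-fromℤ i) (toℚᵘ-fromℤ j) ⟨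
  toℚᵘ (fromℤ i) ℚᵘ.* toℚᵘ (fromℤ j)         ≈⟨ ℚ.toℚᵘ-homo-* (fromℤ i) (fromℤ j) ⟨
  toℚᵘ (fromℤ i ℚ.* fromℤ j)                 ∎)
  where open import Relation.Binary.Reasoning.Setoid ℚᵘ.≃-setoid

fromℤ-neg : ∀ i → fromℤ (ℤ.- i) ≡ ℚ.- fromℤ i
fromℤ-neg i = begin
  fromℤ (ℤ.- i)                                        ≡⟨ solve 2 (λ a b → a := (a :+ b) :- b) ≡.refl (fromℤ (ℤ.- i)) (fromℤ i) ⟩
  fromℤ (ℤ.- i) ℚ.+ fromℤ i ℚ.- fromℤ i                ≡⟨ ≡.cong (ℚ._- fromℤ i) (≡.sym (fromℤ-+ (ℤ.- i) i)) ⟩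
  fromℤ (ℤ.- i ℤ.+ i) ℚ.- fromℤ i                      ≡⟨ ≡.cong (λ z → fromℤ z ℚ.- fromℤ i) (ℤ.+-inverseˡ i) ⟩
  0ℚ ℚ.- fromℤ i                                       ≡⟨ ℚ.+-identityˡ _ ⟩
  ℚ.- fromℤ i                                          ∎
  where
  open ≡.≡-Reasoning
  open ℚ-Solver

fromℤ-injective : ∀ {i j} → fromℤ i ≡ fromℤ j → i ≡ j
fromℤ-injective {i} {j} eq with *≡* i≡j ← ℚᵘ.≃-trans (ℚᵘ.≃-sym (toℚᵘ-fromℤ i)) (ℚᵘ.≃-trans (ℚᵘ.≃-reflexive (≡.cong toℚᵘ eq)) (toℚᵘ-fromℤ j)) =
  ≡.trans (≡.sym (ℤ.*-identityʳ i)) (≡.trans i≡j (ℤ.*-identityʳ j))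

fromℤ-isRingHomomorphism : RingMorphisms.IsRingHomomorphism ℤ.+-*-rawRing ℚ.+-*-rawRing fromℤ
fromℤ-isRingHomomorphism = record
  { isSemiringHomomorphism = record
    { isNearSemiringHomomorphism = record
      { +-isMonoidHomomorphism = record
        { isMagmaHomomorphism = record
          { isRelHomomorphism = record { cong = ≡.cong fromℤ }
          ; homo = fromℤ-+ }
        ; ε-homo = ≡.refl }
      ; *-homo = fromℤ-* }
    ; 1#-homo = ≡.refl }
  ; -‿homo = fromℤ-neg }

-- The coprimality proof inside a rational is irrelevant and has to be recomputed before it can be
-- used.
reduced : ∀ p → Coprime ℤ.∣ ↥ p ∣ (↧ₙ p)
reduced (mkℚ n d c) = coprime-recompute {ℤ.∣ n ∣} {suc d} c

*-denominator : ∀ p → p ℚ.* fromℤ (↧ p) ≡ fromℤ (↥ p)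
*-denominator p@(mkℚ n d _) = ℚ.toℚᵘ-injective (begin
  toℚᵘ (p ℚ.* fromℤ (+ suc d))             ≈⟨ ℚ.toℚᵘ-homo-* p (fromℤ (+ suc d)) ⟩
  mkℚᵘ n d ℚᵘ.* toℚᵘ (fromℤ (+ suc d))     ≈⟨ ℚᵘ.*-cong (ℚᵘ.≃-refl {mkℚᵘ n d}) (toℚᵘ-fromℤ (+ suc d)) ⟩
  mkℚᵘ n d ℚᵘ.* mkℚᵘ (+ suc d) 0
    ≈⟨ *≡* (≡.trans (ℤ.*-identityʳ _) (≡.cong (n ℤ.*_) (≡.cong +_ (≡.sym (ℕ.*-identityʳ (suc d)))))) ⟩
  mkℚᵘ n 0                                 ≈⟨ toℚᵘ-fromℤ n ⟨
  toℚᵘ (fromℤ n)                           ∎)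
  where open import Relation.Binary.Reasoning.Setoid ℚᵘ.≃-setoid

-- 2 Tⱼ (x / 2) is a monic integer polynomial in x, so a rational 2ρ with T_τ (ρ) = 1 is an algebraic
-- integer: clearing denominators, the denominator of 2ρ divides a power of its numerator.
module _ (ρ : ℚ) where
  open ChebyshevPolynomials ℚ.+-*-rawRing using (chebyshev)
  private
    w = (1ℚ ℚ.+ 1ℚ) ℚ.* ρ
    a b : ℤ
    a = ↥ w
    b = ↧ w

  -- The Dickson polynomials Dⱼ (a, b²), that is, 2 Tⱼ (w / 2) multiplied by bʲ for w = a / b.
  cleared : ℕ → ℤ
  cleared zero          = + 2
  cleared (suc zero)    = a
  cleared (suc (suc j)) = a ℤ.* cleared (suc j) ℤ.- b ℤ.* b ℤ.* cleared j

  fromℤ-cleared : ∀ j → fromℤ (cleared j) ≡ (1ℚ ℚ.+ 1ℚ) ℚ.* chebyshev ρ j ℚ.* fromℤ (b ℤ.^ j)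
  fromℤ-cleared zero       = ≡.refl
  fromℤ-cleared (suc zero) = ≡.trans (≡.sym (*-denominator w)) (≡.cong (λ z → w ℚ.* fromℤ z) (≡.sym (ℤ.^-identityʳ b)))
  fromℤ-cleared (suc (suc j)) = begin
    fromℤ (a ℤ.* cleared (suc j) ℤ.- b ℤ.* b ℤ.* cleared j)
      ≡⟨ ≡.trans (fromℤ-+ (a ℤ.* cleared (suc j)) (ℤ.- (b ℤ.* b ℤ.* cleared j))) (≡.cong₂ ℚ._+_ (fromℤ-* a (cleared (suc j)))
           (≡.trans (fromℤ-neg (b ℤ.* b ℤ.* cleared j)) (≡.cong ℚ.-_
             (≡.trans (fromℤ-* (b ℤ.* b) (cleared j)) (≡.cong (ℚ._* fromℤ (cleared j)) (fromℤ-* b b)))))) ⟩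
    fromℤ a ℚ.* fromℤ (cleared (suc j)) ℚ.- B ℚ.* B ℚ.* fromℤ (cleared j)
      ≡⟨ ≡.cong₂ ℚ._-_ (≡.cong₂ ℚ._*_ (≡.sym (*-denominator w))
           (≡.trans (fromℤ-cleared (suc j)) (≡.cong (two ℚ.* c′ ℚ.*_) (fromℤ-* b (b ℤ.^ j)))))
           (≡.cong (B ℚ.* B ℚ.*_) (fromℤ-cleared j)) ⟩
    two ℚ.* ρ ℚ.* B ℚ.* (two ℚ.* c′ ℚ.* (B ℚ.* Bʲ)) ℚ.- B ℚ.* B ℚ.* (two ℚ.* c ℚ.* Bʲ)
      ≡⟨ solve 5 (λ r B c′ c Bʲ → let two = con 1ℚ :+ con 1ℚ in
           two :* r :* B :* (two :* c′ :* (B :* Bʲ)) :- B :* B :* (two :* c :* Bʲ)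
           := two :* (two :* r :* c′ :+ :- c) :* (B :* (B :* Bʲ))) ≡.refl ρ B c′ c Bʲ ⟩
    two ℚ.* (two ℚ.* ρ ℚ.* c′ ℚ.+ ℚ.- c) ℚ.* (B ℚ.* (B ℚ.* Bʲ))
      ≡⟨ ≡.cong (two ℚ.* (two ℚ.* ρ ℚ.* c′ ℚ.+ ℚ.- c) ℚ.*_)
           (≡.sym (≡.trans (fromℤ-* b (b ℤ.^ suc j)) (≡.cong (B ℚ.*_) (fromℤ-* b (b ℤ.^ j))))) ⟩
    two ℚ.* chebyshev ρ (suc (suc j)) ℚ.* fromℤ (b ℤ.^ suc (suc j)) ∎
    where
    open ≡.≡-Reasoning
    open ℚ-Solver
    two = 1ℚ ℚ.+ 1ℚ
    B = fromℤ b
    Bʲ = fromℤ (b ℤ.^ j)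
    c = chebyshev ρ j
    c′ = chebyshev ρ (suc j)

  -- Monicity in homogeneous form: every term except the power of a carries a factor b.
  cleared-mod : ∀ j → ∃[ f ] cleared (suc j) ≡ a ℤ.^ suc j ℤ.+ b ℤ.* f
  cleared-mod zero = + 0 , ℤ-Solver.solve 2 (λ a b → a ⊜ a ⊛ ℤ-Solver.con (+ 1) ⊕ b ⊛ ℤ-Solver.con (+ 0)) ≡.refl a b
    where open ℤ-Solver using () renaming (_:*_ to infixl 7 _⊛_; _:=_ to infix 4 _⊜_; _:+_ to infixl 6 _⊕_)
  cleared-mod (suc j) with f , eq ← cleared-mod j = a ℤ.* f ℤ.- b ℤ.* cleared j ,
    ≡.trans (≡.cong (λ z → a ℤ.* z ℤ.- b ℤ.* b ℤ.* cleared j) eq)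
      (ℤ-Solver.solve 5 (λ a b f p c → a ⊛ (p ⊕ b ⊛ f) ⊖ b ⊛ b ⊛ c ⊜ a ⊛ p ⊕ b ⊛ (a ⊛ f ⊖ b ⊛ c)) ≡.refl a b f (a ℤ.^ suc j) (cleared j))
    where open ℤ-Solver using () renaming (_:*_ to infixl 7 _⊛_; _:=_ to infix 4 _⊜_; _:+_ to infixl 6 _⊕_; _:-_ to infixl 6 _⊖_)

  -- The index is positive because T₀ = 1 holds at every ρ. Coprimality with a removes the factors
  -- of aᵗ one by one until the denominator divides 1.
  chebyshev≡1⇒integral : ∀ τ → chebyshev ρ (suc τ) ≡ 1ℚ → (1ℚ ℚ.+ 1ℚ) ℚ.* ρ ≡ fromℤ (↥ ((1ℚ ℚ.+ 1ℚ) ℚ.* ρ))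
  chebyshev≡1⇒integral τ c≡1 = begin
    w                          ≡⟨ ℚ.*-identityʳ w ⟨
    w ℚ.* fromℤ (+ 1)          ≡⟨ ≡.cong (λ m → w ℚ.* fromℤ m) b≡1 ⟨
    w ℚ.* fromℤ b              ≡⟨ *-denominator w ⟩
    fromℤ a                    ∎
    where
    open ≡.≡-Reasoning
    cleared-τ : cleared (suc τ) ≡ + 2 ℤ.* b ℤ.^ suc τ
    cleared-τ = fromℤ-injective (≡.trans (fromℤ-cleared (suc τ)) (≡.trans
      (≡.cong (λ c → (1ℚ ℚ.+ 1ℚ) ℚ.* c ℚ.* fromℤ (b ℤ.^ suc τ)) c≡1) (≡.sym (fromℤ-* (+ 2) (b ℤ.^ suc τ)))))
    f = proj₁ (cleared-mod τ)
    aᵗ : a ℤ.^ suc τ ≡ b ℤ.* (+ 2 ℤ.* b ℤ.^ τ ℤ.- f)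
    aᵗ = begin
      a ℤ.^ suc τ
        ≡⟨ ℤ-Solver.solve 3 (λ p b f → p ⊜ p ⊕ b ⊛ f ⊖ b ⊛ f) ≡.refl (a ℤ.^ suc τ) b f ⟩
      a ℤ.^ suc τ ℤ.+ b ℤ.* f ℤ.- b ℤ.* f
        ≡⟨ ≡.cong (ℤ._- b ℤ.* f) (≡.trans (≡.sym (proj₂ (cleared-mod τ))) cleared-τ) ⟩
      + 2 ℤ.* (b ℤ.* b ℤ.^ τ) ℤ.- b ℤ.* f
        ≡⟨ ℤ-Solver.solve 3 (λ b p f → ℤ-Solver.con (+ 2) ⊛ (b ⊛ p) ⊖ b ⊛ f ⊜ b ⊛ (ℤ-Solver.con (+ 2) ⊛ p ⊖ f)) ≡.refl b (b ℤ.^ τ) f ⟩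
      b ℤ.* (+ 2 ℤ.* b ℤ.^ τ ℤ.- f) ∎
      where
      open ℤ-Solver using () renaming (_:*_ to infixl 7 _⊛_; _:=_ to infix 4 _⊜_; _:+_ to infixl 6 _⊕_; _:-_ to infixl 6 _⊖_)
    coprime : Coprime ℤ.∣ b ∣ ℤ.∣ a ∣
    coprime = coprime-sym {ℤ.∣ a ∣} {ℤ.∣ b ∣} (reduced w)
    ∣^∣ : ∀ i n → ℤ.∣ i ℤ.^ n ∣ ≡ ℤ.∣ i ∣ ℕ.^ n
    ∣^∣ i zero    = ≡.refl
    ∣^∣ i (suc n) = ≡.trans (ℤ.abs-* i (i ℤ.^ n)) (≡.cong (ℤ.∣ i ∣ ℕ.*_) (∣^∣ i n))
    b∣aᵗ : ℤ.∣ b ∣ ℕ.∣ ℤ.∣ a ∣ ℕ.^ suc τ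
    b∣aᵗ = ℕ.divides ℤ.∣ + 2 ℤ.* b ℤ.^ τ ℤ.- f ∣ (≡.trans (≡.sym (∣^∣ a (suc τ))) (≡.trans (≡.cong ℤ.∣_∣ aᵗ)
      (≡.trans (ℤ.abs-* b (+ 2 ℤ.* b ℤ.^ τ ℤ.- f)) (ℕ.*-comm ℤ.∣ b ∣ _))))
    cancelPowers : ∀ n → ℤ.∣ b ∣ ℕ.∣ ℤ.∣ a ∣ ℕ.^ n → ℤ.∣ b ∣ ≡ 1
    cancelPowers zero    b∣1 = ℕ.∣1⇒≡1 b∣1
    cancelPowers (suc n) b∣  = cancelPowers n (coprime-divisor coprime b∣)
    b≡1 : b ≡ + 1
    b≡1 = ≡.cong +_ (cancelPowers (suc τ) b∣aᵗ)

-- Sums over arcs and the walk of a regular graph.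

module ArcSums (R : CommutativeRing 0ℓ 0ℓ) where
  open CommutativeRing R hiding (zero)
  open Algebra.Properties.Semiring.Sum semiring using (sum; sum-cong-≋; sum-cong-≗)
  open Matrices rawRing using (sumOver)

  indicator : Bool → Carrier
  indicator b = if b then 1# else 0#

  sum-splitAt : ∀ m {k} (g : Fin m ⊎ Fin k → Carrier) →
    sum {m ℕ.+ k} (λ a → g (splitAt m a)) ≈ sum (g ∘ inj₁) + sum (g ∘ inj₂)
  sum-splitAt zero    g = sym (+-identityˡ _)
  sum-splitAt (suc m) {k} g = trans (+-congˡ (sum-splitAt m (g ∘ Sum.map₁ suc))) (sym (+-assoc _ _ _))

  sumOver-Σ : ∀ {n} {P : Fin n → Set} (F : ∀ i → Finite (P i)) (f : Σ (Fin n) P → Carrier) →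
    sumOver {{Finite-Σ F}} f ≈ sum (λ i → sumOver {{F i}} (λ p → f (i , p)))
  sumOver-Σ {zero}  F f = refl
  sumOver-Σ {suc n} {P} F f = trans (reflexive (sum-cong-≗ unfold)) (trans (sum-splitAt (Finite.size (F zero)) g)
    (+-congˡ (sumOver-Σ (F ∘ suc) (λ { (i , p) → f (suc i , p) }))))
    where
    tail = Finite-Σ (F ∘ suc)
    g : Fin (Finite.size (F zero)) ⊎ Fin (Finite.size tail) → Carrier
    g (inj₁ a) = f (zero , Inverse.to (Finite.enumeration (F zero)) a)
    g (inj₂ b) = let i , p = Inverse.to (Finite.enumeration tail) b in f (suc i , p)
    unfold : ∀ a → f (Inverse.to (Finite.enumeration (Finite-Σ F)) a) ≡ g (splitAt (Finite.size (F zero)) a)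
    unfold a with splitAt (Finite.size (F zero)) a
    ... | inj₁ _ = ≡.refl
    ... | inj₂ _ = ≡.refl

  sumOver-T : ∀ b c → sumOver {{Finite-T b}} (λ _ → c) ≈ indicator b * c
  sumOver-T true  c = trans (+-identityʳ c) (sym (*-identityˡ c))
  sumOver-T false c = sym (zeroˡ c)

  -- The map from the integers is a parameter since the same count is used in ℝ, ℂ and ℤ, each with
  -- its own embedding.
  sum-indicator : ∀ {A : Set} {ι : ℤ → Carrier} → RingMorphisms.IsRingHomomorphism ℤ.+-*-rawRing rawRing ι →
    ∀ (b : A → Bool) n (f : Fin n → A) →
    sum (λ i → indicator (b (f i))) ≈ ι (+ length (filter (T? ∘ b) (tabulate f)))
  sum-indicator isHom b zero    f = sym 0#-homo
    where open RingMorphisms.IsRingHomomorphism isHom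
  sum-indicator isHom b (suc n) f with b (f zero)
  ... | true  = trans (+-cong (sym 1#-homo) (sum-indicator isHom b n (f ∘ suc))) (sym (+-homo (+ 1) (+ length (filter (T? ∘ b) (tabulate (f ∘ suc))))))
    where open RingMorphisms.IsRingHomomorphism isHom
  ... | false = trans (+-identityˡ _) (sum-indicator isHom b n (f ∘ suc))

  module _ {n} (Γ : Graph n) where
    open Arc

    -- Arcs are enumerated as an iterated dependent sum whose innermost sum runs over proofs of
    -- `T b`; it has one term or none, which produces the indicator.
    sumOver-arcs : ∀ (g : Fin n → Fin n → Carrier) →
      sumOver {{Grover.Finite-Arc Γ}} (λ e → g (origin e) (terminus e)) ≈ sum (λ x → sum (λ y → indicator (adj Γ x y) * g x y))
    sumOver-arcs g = trans (sumOver-Σ (λ x → Finite-Σ (λ y → Finite-T (adj Γ x y))) (λ { (x , y , e) → g x y }))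
      (sum-cong-≋ (λ x → trans (sumOver-Σ (λ y → Finite-T (adj Γ x y)) (λ { (y , e) → g x y }))
        (sum-cong-≋ (λ y → sumOver-T (adj Γ x y) (g x y)))))

    sum-adjacent : ∀ {ι : ℤ → Carrier} → RingMorphisms.IsRingHomomorphism ℤ.+-*-rawRing rawRing ι →
      ∀ x → sum (λ y → indicator (adj Γ x y)) ≈ ι (+ deg Γ x)
    sum-adjacent isHom x = sum-indicator isHom (adj Γ x) n id

module RegularWalk (R : CommutativeRing 0ℓ 0ℓ) {n : ℕ} (Γ : Graph n) where
  open CommutativeRing R hiding (zero)
  open Algebra.Properties.Ring ring
  open Algebra.Properties.Semiring.Sum semiring using (sum; sum-cong-≋; ∑-comm; *-distribˡ-sum)
  open IntegerSolver R using (solve; _:+_; _:*_; _:-_; :-_; _:=_; con)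
  open Matrices rawRing
  open Determinants R using (δ-refl; δ-≢)
  open MatrixAlgebra R
  open ArcSums R
  open Arc
  open Grover Γ using (Finite-Arc; _⁻¹)
  open Relation.Binary.Reasoning.Setoid setoid

  δ-⇔ : ∀ {I J : Set} {{_ : Finite I}} {{_ : Finite J}} {i j : I} {k l : J} →
    (i ≡ j → k ≡ l) → (k ≡ l → i ≡ j) → δ i j ≈ δ k l
  δ-⇔ {i = i} {j} {k} {l} to from with toSum (i ≟ j)
  ... | inj₁ i≡j = trans (≡.subst (λ j → δ i j ≈ 1#) i≡j (δ-refl i)) (sym (≡.subst (λ l → δ k l ≈ 1#) (to i≡j) (δ-refl k)))
  ... | inj₂ i≢j = trans (δ-≢ i≢j) (sym (δ-≢ (i≢j ∘ from)))

  ⁻¹-involutive : ∀ e → (e ⁻¹) ⁻¹ ≡ e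
  ⁻¹-involutive e = ≡.cong (arc (origin e) (terminus e)) (T-irrelevant _ _)

  adjacency : Matrix (Fin n) (Fin n)
  adjacency x y = indicator (adj Γ x y)

  adjacency-sym : ∀ x y → adjacency x y ≈ adjacency y x
  adjacency-sym x y = reflexive (≡.cong indicator (Graph.symm Γ x y))

  shift : Matrix (Arc Γ) (Arc Γ)
  shift e f = δ e (f ⁻¹)

  shift-· : ∀ {K} (M : Matrix (Arc Γ) K) e k → (shift · M) e k ≈ M (e ⁻¹) k
  shift-· M e k = trans
    (sumOver-cong (λ f → trans (*-comm _ _) (*-congˡ {M f k} (δ-⇔ {i = e} {f ⁻¹} {f} {e ⁻¹}
      (λ e≡ → ≡.trans (≡.sym (⁻¹-involutive f)) (≡.cong _⁻¹ (≡.sym e≡)))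
      (λ f≡ → ≡.trans (≡.sym (⁻¹-involutive e)) (≡.cong _⁻¹ (≡.sym f≡)))))))
    (sumOver-δ (λ f → M f k) (e ⁻¹))

  shift-shift : shift · shift ≈ᴹ Id
  shift-shift e f = trans (shift-· shift e f) (δ-⇔ {i = e ⁻¹} {f ⁻¹} {e} {f}
    (λ eq → ≡.trans (≡.sym (⁻¹-involutive e)) (≡.trans (≡.cong _⁻¹ eq) (⁻¹-involutive f))) (≡.cong _⁻¹))

  module _ (a : Carrier) {d : Matrix (Fin n) (Arc Γ)} {P : Matrix (Arc Γ) (Fin n)}
      (d≈ : ∀ x e → d x e ≈ a * δ x (terminus e)) (P≈ : ∀ e x → P e x ≈ a * δ x (terminus e)) where

    -- Reversing an arc exchanges terminus and origin, so the entry at (x, y) counts the arcs from y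
    -- to x with weight a².
    boundary-shift : d · (shift · P) ≈ᴹ (a * a) • adjacency
    boundary-shift x y = begin
      sumOver (λ e → d x e * (shift · P) e y)
        ≈⟨ sumOver-cong (λ e → *-cong (d≈ x e) (trans (shift-· P e y) (P≈ (e ⁻¹) y))) ⟩
      sumOver (λ (e : Arc Γ) → a * δ x (terminus e) * (a * δ y (origin e)))
        ≈⟨ sumOver-arcs Γ (λ u v → a * δ x v * (a * δ y u)) ⟩
      sum (λ u → sum (λ v → adjacency u v * (a * δ x v * (a * δ y u))))
        ≈⟨ sum-cong-≋ (λ u → sum-cong-≋ (λ v → trans
             (solve 4 (λ g a p q → g :* (a :* p :* (a :* q)) := (a :* a :* g :* q) :* p) refl (adjacency u v) a (δ x v) (δ y u))
             (*-congˡ (δ-sym x v)))) ⟩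
      sum (λ u → sum (λ v → a * a * adjacency u v * δ y u * δ v x))
        ≈⟨ sum-cong-≋ (λ u → trans (sumOver-δ (λ v → a * a * adjacency u v * δ y u) x) (*-congˡ (δ-sym y u))) ⟩
      sum (λ u → a * a * adjacency u x * δ u y)
        ≈⟨ sumOver-δ (λ u → a * a * adjacency u x) y ⟩
      a * a * adjacency y x
        ≈⟨ *-congˡ (adjacency-sym y x) ⟩
      a * a * adjacency x y ∎

    -- Exactly deg v arcs end at v, and each contributes a² = 1 / deg v to the diagonal.
    boundary-boundary* : ∀ {ι : ℤ → Carrier} → RingMorphisms.IsRingHomomorphism ℤ.+-*-rawRing rawRing ι →
      (∀ x → a * a * ι (+ deg Γ x) ≈ 1#) → d · P ≈ᴹ Id
    boundary-boundary* {ι} isHom normalized x y = begin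
      sumOver (λ e → d x e * P e y)
        ≈⟨ sumOver-cong (λ e → *-cong (d≈ x e) (P≈ e y)) ⟩
      sumOver (λ (e : Arc Γ) → a * δ x (terminus e) * (a * δ y (terminus e)))
        ≈⟨ sumOver-arcs Γ (λ u v → a * δ x v * (a * δ y v)) ⟩
      sum (λ u → sum (λ v → adjacency u v * (a * δ x v * (a * δ y v))))
        ≈⟨ ∑-comm (λ u v → adjacency u v * (a * δ x v * (a * δ y v))) ⟩
      sum (λ v → sum (λ u → adjacency u v * (a * δ x v * (a * δ y v))))
        ≈⟨ sum-cong-≋ (λ v → begin
             sum (λ u → adjacency u v * (a * δ x v * (a * δ y v)))
               ≈⟨ sum-cong-≋ (λ u → trans (*-comm _ _) (*-congˡ (adjacency-sym u v))) ⟩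
             sum (λ u → a * δ x v * (a * δ y v) * adjacency v u)
               ≈⟨ *-distribˡ-sum (a * δ x v * (a * δ y v)) (adjacency v) ⟨
             a * δ x v * (a * δ y v) * sum (adjacency v)
               ≈⟨ *-cong (*-congˡ (*-congˡ (δ-sym y v))) (sum-adjacent Γ isHom v) ⟩
             a * δ x v * (a * δ v y) * ι (+ deg Γ v)
               ≈⟨ solve 4 (λ a p q k → a :* p :* (a :* q) :* k := (a :* a :* k) :* p :* q) refl a (δ x v) (δ v y) (ι (+ deg Γ v)) ⟩
             a * a * ι (+ deg Γ v) * δ x v * δ v y
               ≈⟨ *-congʳ (trans (*-congʳ (normalized v)) (*-identityˡ _)) ⟩
             δ x v * δ v y ∎) ⟩
      sum (λ v → δ x v * δ v y)
        ≈⟨ sumOver-δ (δ x) y ⟩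
      δ x y ∎

module PeriodicSpectrum (R : CommutativeRing 0ℓ 0ℓ) {h : ℚ → CommutativeRing.Carrier R}
    (isHom : RingMorphisms.IsRingHomomorphism ℚ.+-*-rawRing (CommutativeRing.rawRing R) h)
    {n : ℕ} (Γ : Graph n) (K : ℕ) (regular : Regular Γ K) where
  open CommutativeRing R hiding (zero)
  open Algebra.Properties.Ring ring
  open Algebra.Definitions.RawSemiring (RawRing.rawSemiring rawRing) using (_^_)
  open Algebra.Definitions.RawSemiring (RawRing.rawSemiring ℚ.+-*-rawRing) using () renaming (_^_ to _^ℚ_)
  open IntegerSolver R using (solve; _:+_; _:*_; _:-_; :-_; _:=_; con)
  open Matrices rawRing
  open MatrixAlgebra R
  open RegularWalk R Γ
  open Walk R using (periodic⇒chebyshev; chebyshev-double)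
  open ChebyshevPolynomials
  open ChebyshevHomomorphism ℚ.+-*-rawRing R isHom
  open DeterminantHomomorphism ℚ.+-*-rawRing R isHom using (^-homo)
  open Arc
  open Grover Γ using (Finite-Arc)
  open RingMorphisms.IsRingHomomorphism isHom
  open Relation.Binary.Reasoning.Setoid setoid

  fromℤ-isHom : RingMorphisms.IsRingHomomorphism ℤ.+-*-rawRing rawRing (h ∘ fromℤ)
  fromℤ-isHom = Composition.isRingHomomorphism trans fromℤ-isRingHomomorphism isHom

  module _ (a θ : Carrier) {d : Matrix (Fin n) (Arc Γ)} {P : Matrix (Arc Γ) (Fin n)}
      (d≈ : ∀ x e → d x e ≈ a * δ x (terminus e)) (P≈ : ∀ e x → P e x ≈ a * δ x (terminus e))
      (κ q : ℚ) (κK≡1 : κ ℚ.* fromℤ (+ K) ≡ 1ℚ) (a²K≈1 : h (fromℤ (+ K)) * (a * a) ≈ 1#) (θ²≈q : θ * θ ≈ h q) where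

    a²≈κ : a * a ≈ h κ
    a²≈κ = begin
      a * a                              ≈⟨ *-identityˡ _ ⟨
      1# * (a * a)                       ≈⟨ *-congʳ (trans (⟦⟧-cong κK≡1) 1#-homo) ⟨
      h (κ ℚ.* fromℤ (+ K)) * (a * a)    ≈⟨ *-congʳ (*-homo κ (fromℤ (+ K))) ⟩
      h κ * h (fromℤ (+ K)) * (a * a)    ≈⟨ *-assoc _ _ _ ⟩
      h κ * (h (fromℤ (+ K)) * (a * a))  ≈⟨ *-congˡ a²K≈1 ⟩
      h κ * 1#                           ≈⟨ *-identityʳ _ ⟩
      h κ                                ∎

    -- With κ = 1 / k and q = θ² this is T₂ (θ / k), the rational point at which T_τ is evaluated.
    ρ : ℚ
    ρ = (1ℚ ℚ.+ 1ℚ) ℚ.* (κ ℚ.* κ ℚ.* q) ℚ.+ ℚ.- 1ℚ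

    ρ-homo : h ρ ≈ (1# + 1#) * (a * a * θ) * (a * a * θ) - 1#
    ρ-homo = begin
      h ρ
        ≈⟨ trans (+-homo _ _) (+-cong (trans (*-homo _ _) (*-cong (trans (+-homo _ _) (+-cong 1#-homo 1#-homo))
             (trans (*-homo _ _) (*-congʳ (*-homo κ κ))))) (trans (-‿homo _) (-‿cong 1#-homo))) ⟩
      (1# + 1#) * (h κ * h κ * h q) - 1#
        ≈⟨ +-congʳ (*-congˡ (*-cong (*-cong a²≈κ a²≈κ) θ²≈q)) ⟨
      (1# + 1#) * (a * a * (a * a) * (θ * θ)) - 1#
        ≈⟨ solve 2 (λ s t → let two = con (+ 1) :+ con (+ 1) in
             two :* (s :* s :* (t :* t)) :- con (+ 1) := two :* (s :* t) :* (s :* t) :- con (+ 1)) refl (a * a) θ ⟩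
      (1# + 1#) * (a * a * θ) * (a * a * θ) - 1# ∎

    periodic⇒chebyshev-rational : det (θ • Id -ᴹ adjacency) ≈ 0# → ∀ τ →
      (shift · ((1# + 1#) • (P · d) -ᴹ Id)) ^ᴹ τ ≈ᴹ Id → h ((1ℚ ℚ.+ ℚ.- chebyshev ℚ.+-*-rawRing ρ τ) ^ℚ n) ≈ 0#
    periodic⇒chebyshev-rational det≈0 τ Uτ≈Id = begin
      h ((1ℚ ℚ.+ ℚ.- c) ^ℚ n)
        ≈⟨ ^-homo (1ℚ ℚ.+ ℚ.- c) n ⟩
      h (1ℚ ℚ.+ ℚ.- c) ^ n
        ≈⟨ ^-cong (trans (+-homo _ _) (+-cong 1#-homo (trans (-‿homo c) (-‿cong
             (trans (chebyshev-homo ρ ρ-homo τ) (sym (chebyshev-double (a * a * θ) τ))))))) n ⟩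
      (1# - chebyshev rawRing (a * a * θ) (double τ)) ^ n
        ≈⟨ periodic⇒chebyshev d P shift ((a * a) • adjacency)
             (boundary-boundary* a d≈ P≈ fromℤ-isHom (λ x → trans (*-comm _ _)
               (trans (*-congʳ (reflexive (≡.cong (λ D → h (fromℤ (+ D))) (regular x)))) a²K≈1)))
             shift-shift (boundary-shift a d≈ P≈)
             (θ • Id -ᴹ adjacency) ((- (a * a)) • Id) (a * a * θ) eigen det≈0 τ Uτ≈Id ⟩
      0# ∎
      where
      c = chebyshev ℚ.+-*-rawRing ρ τ
      ^-cong : ∀ {x y} → x ≈ y → ∀ n → x ^ n ≈ y ^ n
      ^-cong x≈y zero    = refl
      ^-cong x≈y (suc n) = *-cong x≈y (^-cong x≈y n)
      -- Here T - σ is - a² times θ - A, so the cofactor `B` of the general statement is the scalar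
      -- - a².
      eigen : (a * a) • adjacency -ᴹ (a * a * θ) • Id ≈ᴹ (θ • Id -ᴹ adjacency) · ((- (a * a)) • Id)
      eigen i j = sym (trans (·-•-comm (- (a * a)) (θ • Id -ᴹ adjacency) Id i j)
        (trans (*-congˡ (·-identityʳ (θ • Id -ᴹ adjacency) i j))
          (solve 4 (λ s t δ g → :- s :* (t :* δ :- g) := s :* g :- s :* t :* δ) refl (a * a) θ (δ i j) (adjacency i j))))

-- Trace and determinant computed from the prescribed list of eigenvalues.

module Squares (R : CommutativeRing 0ℓ 0ℓ) {ι : ℤ → CommutativeRing.Carrier R}
    (isHom : RingMorphisms.IsRingHomomorphism ℤ.+-*-rawRing (CommutativeRing.rawRing R) ι) where
  open CommutativeRing R hiding (zero)
  open Algebra.Properties.Ring ring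
  open Algebra.Definitions.RawSemiring (RawRing.rawSemiring rawRing) using (_^_)
  open Algebra.Properties.Semiring.Sum semiring using (sum; sum-cong-≋)
  open IntegerSolver R using (solve; _:+_; _:*_; _:-_; :-_; _:=_; con)
  open RingMorphisms.IsRingHomomorphism isHom
  open ArcSums R using (indicator; sum-adjacent)
  open TopCoefficients R using (sumOfSquares)
  open Relation.Binary.Reasoning.Setoid setoid

  solveLinear : ∀ {μ i t s x q} → i * μ ≈ 1# → t ≈ s + μ * x → i * (t - s) ≈ q → x ≈ q
  solveLinear {μ} {i} {t} {s} {x} {q} iμ≈1 t≈ q≈ = begin
    x                      ≈⟨ *-identityˡ x ⟨
    1# * x                 ≈⟨ *-congʳ iμ≈1 ⟨
    i * μ * x              ≈⟨ solve 4 (λ i μ x s → i :* μ :* x := i :* (s :+ μ :* x :- s)) refl i μ x s ⟩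
    i * (s + μ * x - s)    ≈⟨ *-congˡ (+-congʳ t≈) ⟨
    i * (t - s)            ≈⟨ q≈ ⟩
    q                      ∎

  differenceOfSquares : ∀ {x y} → x * x ≈ y * y → (x - y) * (x - - y) ≈ 0#
  differenceOfSquares {x} {y} x²≈y² = begin
    (x - y) * (x - - y)    ≈⟨ solve 2 (λ x y → (x :- y) :* (x :- :- y) := x :* x :- y :* y) refl x y ⟩
    x * x - y * y          ≈⟨ +-congʳ x²≈y² ⟩
    y * y - y * y          ≈⟨ -‿inverseʳ _ ⟩
    0#                     ∎

  scaledSquare : ∀ c x → c * x * (c * x) ≈ c * c * (x * x)
  scaledSquare = solve 2 (λ c x → c :* x :* (c :* x) := c :* c :* (x :* x)) refl

  zeroFactor₃ : ∀ {x y z w} → z ≈ 0# → x * (y * (z * w)) ≈ 0#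
  zeroFactor₃ {x} {y} {z} {w} z≈0 = trans (*-congˡ (*-congˡ (trans (*-congʳ z≈0) (zeroˡ w))))
    (trans (*-congˡ (zeroʳ y)) (zeroʳ x))

  negatedIndicator : ∀ x b → ι (if b then ℤ.-1ℤ else ℤ.0ℤ) ≈ 0# * x - indicator b
  negatedIndicator x true  = trans (trans (-‿homo (+ 1)) (-‿cong 1#-homo))
    (solve 1 (λ x → :- con (+ 1) := con (+ 0) :* x :- con (+ 1)) refl x)
  negatedIndicator x false = trans 0#-homo (solve 1 (λ x → con (+ 0) := con (+ 0) :* x :- con (+ 0)) refl x)

  sum-constant : ∀ n K → sum {n} (λ _ → ι (+ K)) ≈ ι (+ (n ℕ.* K))
  sum-constant zero    K = sym 0#-homo
  sum-constant (suc n) K = trans (+-congˡ (sum-constant n K)) (sym (+-homo (+ K) (+ (n ℕ.* K))))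

  -- For a symmetric matrix of zeros and ones the diagonal of the square holds the row sums, here
  -- the degrees.
  trace-square : ∀ {n K} (Γ : Graph n) → Regular Γ K →
    sum (λ x → sum (λ y → indicator (adj Γ x y) * indicator (adj Γ y x))) ≈ ι (+ (n ℕ.* K))
  trace-square {n} {K} Γ regular = trans
    (sum-cong-≋ (λ x → trans (sum-cong-≋ (λ y → trans (*-congˡ (reflexive (≡.cong indicator (Graph.symm Γ y x)))) (idempotent (adj Γ x y))))
      (trans (sum-adjacent Γ isHom x) (reflexive (≡.cong (λ D → ι (+ D)) (regular x))))))
    (sum-constant n K)
    where
    idempotent : ∀ b → indicator b * indicator b ≈ indicator b
    idempotent true  = *-identityˡ 1#
    idempotent false = zeroˡ 0#

  sumOfSquares-replicate : ∀ m x Λ → sumOfSquares (replicate m x ++ Λ) ≈ ι (+ m) * (x * x) + sumOfSquares Λ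
  sumOfSquares-replicate zero    x Λ = sym (trans (+-congʳ (trans (*-congʳ 0#-homo) (zeroˡ _))) (+-identityˡ _))
  sumOfSquares-replicate (suc m) x Λ = begin
    x * x + sumOfSquares (replicate m x ++ Λ)
      ≈⟨ +-congˡ (sumOfSquares-replicate m x Λ) ⟩
    x * x + (ι (+ m) * (x * x) + sumOfSquares Λ)
      ≈⟨ solve 3 (λ x m s → x :+ (m :* x :+ s) := (con (+ 1) :+ m) :* x :+ s) refl (x * x) (ι (+ m)) (sumOfSquares Λ) ⟩
    (1# + ι (+ m)) * (x * x) + sumOfSquares Λ
      ≈⟨ +-congʳ (*-congʳ (trans (+-homo (+ 1) (+ m)) (+-congʳ 1#-homo))) ⟨
    ι (+ suc m) * (x * x) + sumOfSquares Λ ∎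

  spectrum : ℕ → ℕ → Carrier → List Carrier
  spectrum K m θ = ι (+ K) ∷ - ι (+ K) ∷ replicate m θ ++ replicate m (- θ)

  sumOfSquares-spectrum : ∀ K m θ → sumOfSquares (spectrum K m θ) ≈ ι (+ (2 ℕ.* (K ℕ.* K))) + ι (+ (2 ℕ.* m)) * (θ * θ)
  sumOfSquares-spectrum K m θ = begin
    k * k + (- k * - k + sumOfSquares (replicate m θ ++ replicate m (- θ)))
      ≈⟨ +-congˡ (+-congˡ (trans (sumOfSquares-replicate m θ (replicate m (- θ)))
           (+-congˡ (trans (reflexive (≡.cong sumOfSquares (≡.sym (++-identityʳ (replicate m (- θ))))))
             (sumOfSquares-replicate m (- θ) []))))) ⟩
    k * k + (- k * - k + (μ * (θ * θ) + (μ * (- θ * - θ) + 0#)))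
      ≈⟨ solve 3 (λ k μ θ → k :* k :+ (:- k :* :- k :+ (μ :* (θ :* θ) :+ (μ :* (:- θ :* :- θ) :+ con (+ 0))))
           := two :* (k :* k) :+ two :* μ :* (θ :* θ)) refl k μ θ ⟩
    (1# + 1#) * (k * k) + (1# + 1#) * μ * (θ * θ)
      ≈⟨ +-cong (trans (twice (K ℕ.* K)) (*-congˡ (trans (reflexive (≡.cong ι (ℤ.pos-* K K))) (*-homo (+ K) (+ K))))) (*-congʳ (twice m)) ⟨
    ι (+ (2 ℕ.* (K ℕ.* K))) + ι (+ (2 ℕ.* m)) * (θ * θ) ∎
    where
    two = con (+ 1) :+ con (+ 1)
    k = ι (+ K)
    μ = ι (+ m)
    twice : ∀ j → ι (+ (2 ℕ.* j)) ≈ (1# + 1#) * ι (+ j)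
    twice j = trans (reflexive (≡.cong ι (ℤ.pos-* 2 j))) (trans (*-homo (+ 2) (+ j))
      (*-congʳ (trans (+-homo (+ 1) (+ 1)) (+-cong 1#-homo 1#-homo))))

  product-replicate : ∀ s m x Λ → foldr (λ a p → (s - a) * p) 1# (replicate m x ++ Λ) ≈
    (s - x) ^ m * foldr (λ a p → (s - a) * p) 1# Λ
  product-replicate s zero    x Λ = sym (*-identityˡ _)
  product-replicate s (suc m) x Λ = trans (*-congˡ (product-replicate s m x Λ)) (sym (*-assoc _ _ _))

  -- The value at 0, which will be det (- A). Pairing θ with - θ gives - θ² for each pair, so the
  -- product depends only on the rational number θ².
  product-spectrum : ∀ K m θ → foldr (λ a p → (0# - a) * p) 1# (spectrum K m θ) ≈
    - (ι (+ (K ℕ.* K)) * (- (θ * θ)) ^ m)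
  product-spectrum K m θ = begin
    (0# - k) * ((0# - - k) * foldr (λ a p → (0# - a) * p) 1# (replicate m θ ++ replicate m (- θ)))
      ≈⟨ *-congˡ (*-congˡ (trans (product-replicate 0# m θ (replicate m (- θ)))
           (*-congˡ (trans (reflexive (≡.cong (foldr (λ a p → (0# - a) * p) 1#) (≡.sym (++-identityʳ (replicate m (- θ))))))
             (product-replicate 0# m (- θ) []))))) ⟩
    (0# - k) * ((0# - - k) * ((0# - θ) ^ m * ((0# - - θ) ^ m * 1#)))
      ≈⟨ solve 3 (λ k x y → (con (+ 0) :- k) :* ((con (+ 0) :- :- k) :* (x :* (y :* con (+ 1)))) := :- (k :* k :* (x :* y)))
           refl k ((0# - θ) ^ m) ((0# - - θ) ^ m) ⟩
    - (k * k * ((0# - θ) ^ m * (0# - - θ) ^ m))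
      ≈⟨ -‿cong (*-cong (sym (trans (reflexive (≡.cong ι (ℤ.pos-* K K))) (*-homo (+ K) (+ K)))) (powers m)) ⟩
    - (ι (+ (K ℕ.* K)) * (- (θ * θ)) ^ m) ∎
    where
    k = ι (+ K)
    powers : ∀ m → (0# - θ) ^ m * (0# - - θ) ^ m ≈ (- (θ * θ)) ^ m
    powers zero    = *-identityˡ 1#
    powers (suc m) = trans
      (solve 3 (λ θ x y → (con (+ 0) :- θ) :* x :* ((con (+ 0) :- :- θ) :* y) := :- (θ :* θ) :* (x :* y))
        refl θ ((0# - θ) ^ m) ((0# - - θ) ^ m))
      (*-congˡ (powers m))

fromℤ-ℝ-isRingHomomorphism : RingMorphisms.IsRingHomomorphism ℤ.+-*-rawRing ℝ-rawRing (fromℚ ∘ fromℤ)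
fromℤ-ℝ-isRingHomomorphism = Composition.isRingHomomorphism (λ {x} {y} {z} → ≈ᴿ-trans {x} {y} {z}) fromℤ-isRingHomomorphism fromℚ-isRingHomomorphism

fromℚ-ℂ-isRingHomomorphism : RingMorphisms.IsRingHomomorphism ℚ.+-*-rawRing ℂ-rawRing (fromℝ ∘ fromℚ)
fromℚ-ℂ-isRingHomomorphism = Composition.isRingHomomorphism
  (λ {x} {y} {z} → CommutativeRing.trans ℂ-commutativeRing {x} {y} {z}) fromℚ-isRingHomomorphism fromℝ-isRingHomomorphism

ν : ℕ → ℚ
ν j = fromℤ (+ j)

ν-+ : ∀ i j → ν (i ℕ.+ j) ≡ ν i ℚ.+ ν j
ν-+ i j = fromℤ-+ (+ i) (+ j)

ν-* : ∀ i j → ν (i ℕ.* j) ≡ ν i ℚ.* ν j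
ν-* i j = ≡.trans (≡.cong fromℤ (ℤ.pos-* i j)) (fromℤ-* (+ i) (+ j))

ν-injective : ∀ {i j} → ν i ≡ ν j → i ≡ j
ν-injective eq = ℤ.+-injective (fromℤ-injective eq)

abstract
  -- Kept abstract: later proofs use only `ν-inverse`, and the normalisation by a greatest common
  -- divisor inside the quotient never unfolds.
  inverse : ℕ → ℚ
  inverse j = + 1 ℚ./ suc j

  ν-inverse : ∀ j → inverse j ℚ.* ν (suc j) ≡ 1ℚ
  ν-inverse j = ℚ.toℚᵘ-injective (begin
    toℚᵘ ((+ 1 ℚ./ suc j) ℚ.* ν (suc j))               ≈⟨ ℚ.toℚᵘ-homo-* (+ 1 ℚ./ suc j) (ν (suc j)) ⟩
    toℚᵘ (+ 1 ℚ./ suc j) ℚᵘ.* toℚᵘ (ν (suc j))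
      ≈⟨ ℚᵘ.*-cong (ℚ.toℚᵘ-fromℚᵘ (mkℚᵘ (+ 1) j)) (toℚᵘ-fromℤ (+ suc j)) ⟩
    mkℚᵘ (+ 1) j ℚᵘ.* mkℚᵘ (+ suc j) 0
      ≈⟨ *≡* (≡.trans (ℤ.*-identityʳ _) (≡.trans (ℤ.*-identityˡ _) (≡.trans (≡.cong +_ (≡.sym (ℕ.*-identityʳ (suc j))))
           (≡.sym (ℤ.*-identityˡ _))))) ⟩
    mkℚᵘ (+ 1) 0                                       ∎)
    where open import Relation.Binary.Reasoning.Setoid ℚᵘ.≃-setoid

fromℤ-nonNegative : ∀ i → 0ℚ ℚ.≤ fromℤ i → + 0 ℤ.≤ i
fromℤ-nonNegative i 0≤i with *≤* h ← ℚᵘ.≤-respʳ-≃ (toℚᵘ-fromℤ i) (ℚ.toℚᵘ-mono-≤ 0≤i) = ≡.subst (+ 0 ℤ.≤_) (ℤ.*-identityʳ i) h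

module _ where
  open Algebra.Definitions.RawSemiring (RawRing.rawSemiring ℚ.+-*-rawRing) using (_^_)

  ℚ-^-zero : ∀ x n → x ^ n ≡ 0ℚ → x ≡ 0ℚ
  ℚ-^-zero x zero    ()
  ℚ-^-zero x (suc n) eq with x ℚ.≟ 0ℚ
  ... | yes x≡0 = x≡0
  ... | no x≢0 = ℚ-^-zero x n (begin
    x ^ n                          ≡⟨ ℚ.*-identityˡ _ ⟨
    1ℚ ℚ.* x ^ n                   ≡⟨ ≡.cong (ℚ._* x ^ n) (ℚ.*-inverseˡ x) ⟨
    ℚ.1/ x ℚ.* x ℚ.* x ^ n         ≡⟨ ℚ.*-assoc (ℚ.1/ x) x (x ^ n) ⟩
    ℚ.1/ x ℚ.* (x ℚ.* x ^ n)       ≡⟨ ≡.cong (ℚ.1/ x ℚ.*_) eq ⟩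
    ℚ.1/ x ℚ.* 0ℚ                  ≡⟨ ℚ.*-zeroʳ (ℚ.1/ x) ⟩
    0ℚ                             ∎)
    where
    open ≡.≡-Reasoning
    instance x-nonZero = ℚ.≢-nonZero x≢0

-- The given graph: rationality of θ² and integrality of 4 θ² / k².

module RegularBoundary {n : ℕ} (Γ : Graph n) (k : ℕ) (regular : Regular Γ (suc k)) where
  open ℝ-CR using (_+_; _*_; -_; 0#; 1#)
  open Grover Γ using (boundary; boundary*; Finite-Arc)
  open Arc
  private
    module A = ℝ-CR
    module ℂR = CommutativeRing ℂ-commutativeRing
    module ℂM = Matrices ℂ-rawRing
    K = suc k

  boundary-entry : ∀ x e → boundary x e ℂR.≈ fromℝ (1/√ K) ℂR.* ℂM.δ x (terminus e)
  boundary-entry x e = ℂR.reflexive (≡.cong (λ D → fromℝ (1/√ D) ℂR.* ℂM.δ x (terminus e)) (regular x))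

  -- The entries are real, but their imaginary part is an expression merely equivalent to 0, so
  -- invariance under conjugation is not definitional.
  boundary*-entry : ∀ e x → boundary* e x ℂR.≈ fromℝ (1/√ K) ℂR.* ℂM.δ x (terminus e)
  boundary*-entry e x = ℂR.trans {boundary* e x} {boundary x e} {fromℝ (1/√ K) ℂR.* ℂM.δ x (terminus e)} (A.refl {re (boundary x e)} , real) (boundary-entry x e)
    where
    r = 1/√ (deg Γ x)
    imaginary : ∀ b → im (fromℝ r ℂR.* (if b then ℂR.1# else ℂR.0#)) ≈ᴿ 0#
    imaginary true  = A.sym {0#} {r * 0# + 0# * 1#} (ComplexIdentities.im-real ℝ-commutativeRing r 1#)
    imaginary false = A.sym {0#} {r * 0# + 0# * 0#} (ComplexIdentities.im-real ℝ-commutativeRing r 0#)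
    im≈0 : im (boundary x e) ≈ᴿ 0#
    im≈0 = imaginary (does (x ≟ terminus e))
    real : - im (boundary x e) ≈ᴿ im (boundary x e)
    real = A.trans { - im (boundary x e)} { - 0#} {im (boundary x e)} (A.-‿cong {im (boundary x e)} {0#} im≈0)
      (A.trans { - 0#} {0#} {im (boundary x e)} (pointwise { - 0#} {0#} (λ _ → ≡.refl)) (A.sym {im (boundary x e)} {0#} im≈0))

  inverse-degree : fromℝ (fromℚ (ν K)) ℂR.* (fromℝ (1/√ K) ℂR.* fromℝ (1/√ K)) ℂR.≈ ℂR.1#
  inverse-degree = ℂR.trans {fromℝ (fromℕ K) ℂR.* (fromℝ r ℂR.* fromℝ r)} {fromℝ (fromℕ K * (r * r))} {ℂR.1#}
    (ℂR.sym {fromℝ (fromℕ K * (r * r))} {fromℝ (fromℕ K) ℂR.* (fromℝ r ℂR.* fromℝ r)}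
      (ℂR.trans {fromℝ (fromℕ K * (r * r))} {fromℝ (fromℕ K) ℂR.* fromℝ (r * r)} {fromℝ (fromℕ K) ℂR.* (fromℝ r ℂR.* fromℝ r)}
        (H.*-homo (fromℕ K) (r * r)) (ℂR.*-congˡ {fromℝ (fromℕ K)} {fromℝ (r * r)} {fromℝ r ℂR.* fromℝ r} (H.*-homo r r))))
    (InverseSquareRoot.1/√-square k , A.refl {0#})
    where
    r = 1/√ K
    module H = RingMorphisms.IsRingHomomorphism fromℝ-isRingHomomorphism

module RegularSpectrum {n : ℕ} (Γ : Graph n) (k m : ℕ) (θ : ℝ) (regular : Regular Γ (suc k))
    (hasSpectrum : HasSpectrum (adjacencyMatrix Γ)
      (fromℕ (suc k) ∷ (ℝ-ring.- fromℕ (suc k)) ∷ replicate (suc m) θ ++ replicate (suc m) (ℝ-ring.- θ))) where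
  K M : ℕ
  K = suc k
  M = suc m

  open ℝ-CR using (_+_; _*_; -_; 0#; 1#)
  private module A = ℝ-CR
  open Squares ℝ-commutativeRing fromℤ-ℝ-isRingHomomorphism using (spectrum; trace-square; sumOfSquares-spectrum; solveLinear)

  Λ : List ℝ
  Λ = spectrum K M θ

  1≉0 : ¬ (1# ≈ᴿ 0#)
  1≉0 1≈0 with fromℚ-injective {1ℚ} {0ℚ} 1≈0
  ... | ()

  traces : n ≡ length Λ × Algebra.Properties.Semiring.Sum.sum A.semiring (λ x → Algebra.Properties.Semiring.Sum.sum A.semiring
      (λ y → adjacencyMatrix Γ x y * adjacencyMatrix Γ y x)) ≈ᴿ TopCoefficients.sumOfSquares ℝ-commutativeRing Λ
  traces = TopCoefficients.squareTrace ℝ-commutativeRing (adjacencyMatrix Γ) Λ 1≉0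
    (SpectrumEvaluation.eval-charPoly P C-isRingHomomorphism X (adjacencyMatrix Γ) {Λ} hasSpectrum)
    (SpectrumEvaluation.eval-charPoly P C-isRingHomomorphism (CommutativeRing.-_ P X) (adjacencyMatrix Γ) {Λ} hasSpectrum)
    where
    open PolynomialRing ℝ-commutativeRing using (C-isRingHomomorphism) renaming (commutativeRing to P)
    open Polynomials ℝ-rawRing using (X)

  n≡ : n ≡ 2 ℕ.+ 2 ℕ.* M
  n≡ = ≡.trans (proj₁ traces) (≡.cong (2 ℕ.+_) (≡.trans (length-++ (replicate M θ))
    (≡.cong₂ ℕ._+_ (length-replicate M) (≡.trans (length-replicate M) (≡.sym (ℕ.+-identityʳ M))))))

  trace-θ : fromℚ (ν (n ℕ.* K)) ≈ᴿ fromℚ (ν (2 ℕ.* (K ℕ.* K))) + fromℚ (ν (2 ℕ.* M)) * (θ * θ)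
  trace-θ = A.trans {fromℚ (ν (n ℕ.* K))} {t} {fromℚ (ν (2 ℕ.* (K ℕ.* K))) + fromℚ (ν (2 ℕ.* M)) * (θ * θ)}
    (A.sym {t} {fromℚ (ν (n ℕ.* K))} (trace-square Γ regular))
    (A.trans {t} {TopCoefficients.sumOfSquares ℝ-commutativeRing Λ} {fromℚ (ν (2 ℕ.* (K ℕ.* K))) + fromℚ (ν (2 ℕ.* M)) * (θ * θ)}
      (proj₂ traces) (sumOfSquares-spectrum K M θ))
    where
    open Algebra.Properties.Semiring.Sum A.semiring using (sum)
    t = sum (λ x → sum (λ y → adjacencyMatrix Γ x y * adjacencyMatrix Γ y x))

  1/2M q : ℚ
  -- `inverse` divides by the successor of its argument, and 2 * M reduces to suc (m + 1 * M).
  1/2M = inverse (m ℕ.+ 1 ℕ.* M)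
  q = 1/2M ℚ.* (ν (n ℕ.* K) ℚ.- ν (2 ℕ.* (K ℕ.* K)))

  q-equation : ν (2 ℕ.* M) ℚ.* q ℚ.+ ν (2 ℕ.* (K ℕ.* K)) ≡ ν (n ℕ.* K)
  q-equation = begin
    μ ℚ.* (1/2M ℚ.* (t ℚ.- s)) ℚ.+ s     ≡⟨ solve 4 (λ μ i t s → μ :* (i :* (t :- s)) :+ s := i :* μ :* (t :- s) :+ s) ≡.refl μ 1/2M t s ⟩
    1/2M ℚ.* μ ℚ.* (t ℚ.- s) ℚ.+ s       ≡⟨ ≡.cong (λ z → z ℚ.* (t ℚ.- s) ℚ.+ s) (ν-inverse (m ℕ.+ 1 ℕ.* M)) ⟩
    1ℚ ℚ.* (t ℚ.- s) ℚ.+ s               ≡⟨ solve 2 (λ t s → con 1ℚ :* (t :- s) :+ s := t) ≡.refl t s ⟩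
    t                                    ∎
    where
    open ≡.≡-Reasoning
    open ℚ-Solver
    μ = ν (2 ℕ.* M)
    t = ν (n ℕ.* K)
    s = ν (2 ℕ.* (K ℕ.* K))

  θ²≈q : θ * θ ≈ᴿ fromℚ q
  θ²≈q = solveLinear {fromℚ (ν (2 ℕ.* M))} {fromℚ 1/2M} {fromℚ (ν (n ℕ.* K))} {fromℚ (ν (2 ℕ.* (K ℕ.* K)))} {θ * θ} {fromℚ q}
      (A.trans {fromℚ 1/2M * fromℚ (ν (2 ℕ.* M))} {fromℚ (1/2M ℚ.* ν (2 ℕ.* M))} {1#}
        (pointwise {fromℚ 1/2M * fromℚ (ν (2 ℕ.* M))} {fromℚ (1/2M ℚ.* ν (2 ℕ.* M))} (λ _ → ≡.refl))
        (A.reflexive (≡.cong fromℚ (ν-inverse (m ℕ.+ 1 ℕ.* M)))))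
      trace-θ
      (pointwise {fromℚ 1/2M * (fromℚ (ν (n ℕ.* K)) A.- fromℚ (ν (2 ℕ.* (K ℕ.* K))))} {fromℚ q} (λ _ → ≡.refl))

  private
    module ℂR = CommutativeRing ℂ-commutativeRing
    module ℂM = Matrices ℂ-rawRing
    module ℂS = Squares ℂ-commutativeRing
      (Composition.isRingHomomorphism (λ {x} {y} {z} → ℂR.trans {x} {y} {z}) fromℤ-isRingHomomorphism fromℚ-ℂ-isRingHomomorphism)
    module ℂW = RegularWalk ℂ-commutativeRing Γ
    module Q = Algebra.Definitions.RawSemiring (RawRing.rawSemiring ℚ.+-*-rawRing)
  open Grover Γ using (boundary; boundary*; Finite-Arc)
  open RegularBoundary Γ k regular

  -- Because M = suc m, the list contains θ in third place, and the third factor at s = θ is θ - θ.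
  det-eigenvalue : ℂM.det (fromℝ θ ℂM.• ℂM.Id ℂM.-ᴹ ℂW.adjacency) ℂR.≈ ℂR.0#
  det-eigenvalue = ℂR.trans {d} {d′} {ℂR.0#}
    (Determinants.det-cong ℂ-commutativeRing {n}
      {fromℝ θ ℂM.• ℂM.Id ℂM.-ᴹ ℂW.adjacency} {fromℝ θ ℂM.• ℂM.Id ℂM.-ᴹ (λ i j → fromℝ (adjacencyMatrix Γ i j))} (λ i j → ℂR.+-congˡ {fromℝ θ ℂR.* ℂM.δ i j} {ℂR.- ℂW.adjacency i j} {ℂR.- fromℝ (adjacencyMatrix Γ i j)}
        (ℂR.-‿cong {ℂW.adjacency i j} {fromℝ (adjacencyMatrix Γ i j)} (entry (adj Γ i j)))))
    (ℂR.trans {d′} {E.∏[s- Λ ]} {ℂR.0#} (E.eval-charPoly (adjacencyMatrix Γ) {Λ} hasSpectrum)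
      (ℂS.zeroFactor₃ {fromℝ θ ℂR.- fromℝ (fromℕ K)} {fromℝ θ ℂR.- fromℝ (- fromℕ K)} {fromℝ θ ℂR.- fromℝ θ}
        {E.∏[s- replicate m θ ++ replicate M (- θ) ]} (ℂR.-‿inverseʳ (fromℝ θ))))
    where
    module E = SpectrumEvaluation ℂ-commutativeRing fromℝ-isRingHomomorphism (fromℝ θ)
    d = ℂM.det (fromℝ θ ℂM.• ℂM.Id ℂM.-ᴹ ℂW.adjacency)
    d′ = ℂM.det (fromℝ θ ℂM.• ℂM.Id ℂM.-ᴹ (λ i j → fromℝ (adjacencyMatrix Γ i j)))
    entry : ∀ b → (if b then ℂR.1# else ℂR.0#) ℂR.≈ fromℝ (if b then 1# else 0#)
    entry true  = ℂR.refl {ℂR.1#}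
    entry false = ℂR.refl {ℂR.0#}

  κ : ℚ
  κ = inverse k

  private
    module PS = PeriodicSpectrum ℂ-commutativeRing fromℚ-ℂ-isRingHomomorphism Γ K regular

  θ²≈q-ℂ : fromℝ θ ℂR.* fromℝ θ ℂR.≈ fromℝ (fromℚ q)
  θ²≈q-ℂ = ℂR.trans {fromℝ θ ℂR.* fromℝ θ} {fromℝ (θ * θ)} {fromℝ (fromℚ q)}
    (ℂR.sym {fromℝ (θ * θ)} {fromℝ θ ℂR.* fromℝ θ} (RingMorphisms.IsRingHomomorphism.*-homo fromℝ-isRingHomomorphism θ θ))
    (θ²≈q , A.refl {0#})

  -- For x = θ² / k² one has 4 x = 2 (2 x - 1) + 2 = 2 T₂ (θ / k) + 2, and twice the rational number
  -- T₂ (θ / k) is an algebraic integer.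
  integral : Periodic Γ → ∃[ i ] ν 4 ℚ.* (κ ℚ.* κ ℚ.* q) ≡ fromℤ i
  integral (suc τ , _ , Uτ≈Id) = ↥two ℤ.+ + 2 , (begin
      ν 4 ℚ.* x
        ≡⟨ solve 1 (λ x → con (ν 4) :* x := (con 1ℚ :+ con 1ℚ) :* ((con 1ℚ :+ con 1ℚ) :* x :+ :- con 1ℚ) :+ con (ν 2)) ≡.refl x ⟩
      (1ℚ ℚ.+ 1ℚ) ℚ.* ((1ℚ ℚ.+ 1ℚ) ℚ.* x ℚ.+ ℚ.- 1ℚ) ℚ.+ ν 2
        ≡⟨ ≡.cong (ℚ._+ ν 2) (chebyshev≡1⇒integral ρ τ c≡1) ⟩
      fromℤ ↥two ℚ.+ ν 2
        ≡⟨ fromℤ-+ ↥two (+ 2) ⟨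
      fromℤ (↥two ℤ.+ + 2) ∎)
    where
    open ≡.≡-Reasoning
    open ℚ-Solver
    x ρ c : ℚ
    x = κ ℚ.* κ ℚ.* q
    ρ = (1ℚ ℚ.+ 1ℚ) ℚ.* x ℚ.+ ℚ.- 1ℚ
    c = ChebyshevPolynomials.chebyshev ℚ.+-*-rawRing ρ (suc τ)
    ↥two : ℤ
    ↥two = ℚ.↥ ((1ℚ ℚ.+ 1ℚ) ℚ.* ρ)
    power≡0 : (1ℚ ℚ.+ ℚ.- c) Q.^ n ≡ 0ℚ
    -- The real part of the complex equation compares two rational constants.
    power≡0 = fromℚ-injective (proj₁ (PS.periodic⇒chebyshev-rational (fromℝ (1/√ K)) (fromℝ θ) {boundary} {boundary*} boundary-entry boundary*-entry κ q
      (ν-inverse k) inverse-degree θ²≈q-ℂ det-eigenvalue (suc τ) Uτ≈Id))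
    c≡1 : c ≡ 1ℚ
    c≡1 = ≡.trans (solve 1 (λ c → c := con 1ℚ :- (con 1ℚ :- c)) ≡.refl c)
      (≡.cong (λ z → 1ℚ ℚ.- z) (ℚ-^-zero (1ℚ ℚ.+ ℚ.- c) n power≡0))

-- The equation reads M (4 - Y K) = 4 (K - 1). For K at least 2 the right side is positive, which
-- forces Y K < 4, hence Y = 1 and K = 2 or 3, and then M is determined. In the excluded cases one
-- side equals the other plus a successor.
degreeCases : ∀ m y k → let M = suc m; Y = suc y; K = suc k in
  M ℕ.* Y ℕ.* K ℕ.+ 4 ℕ.* K ≡ 2 ℕ.* (2 ℕ.+ 2 ℕ.* M) → K ≡ 1 ⊎ (K ≡ 2 × M ≡ 2) ⊎ (K ≡ 3 × M ≡ 8)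
degreeCases m y 0 eq = inj₁ ≡.refl
degreeCases m zero 1 eq = inj₂ (inj₁ (≡.refl , ≡.sym (ℕ.*-cancelˡ-≡ 2 (suc m) 2
  (ℕ.+-cancelˡ-≡ (2 ℕ.* suc m ℕ.+ 4) 4 (2 ℕ.* suc m) (≡.trans
    (solve 1 (λ M → con 2 :* M :+ con 4 :+ con 4 := M :* con 1 :* con 2 :+ con 8) ≡.refl (suc m)) (≡.trans eq
    (solve 1 (λ M → con 2 :* (con 2 :+ con 2 :* M) := con 2 :* M :+ con 4 :+ con 2 :* M) ≡.refl (suc m))))))))
  where open ℕ-Solver
degreeCases m (suc y) 1 eq = ⊥-elim (ℕ.m≢1+m+n (2 ℕ.* (2 ℕ.+ 2 ℕ.* suc m)) (≡.trans (≡.sym eq)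
  (solve 2 (λ M y → M :* (con 2 :+ y) :* con 2 :+ con 8 := con 1 :+ (con 2 :* (con 2 :+ con 2 :* M) :+ (con 3 :+ con 2 :* M :* y)))
    ≡.refl (suc m) y)))
  where open ℕ-Solver
degreeCases m zero 2 eq = inj₂ (inj₂ (≡.refl , ≡.sym
  (ℕ.+-cancelˡ-≡ (3 ℕ.* suc m ℕ.+ 4) 8 (suc m) (≡.trans
    (solve 1 (λ M → con 3 :* M :+ con 4 :+ con 8 := M :* con 1 :* con 3 :+ con 12) ≡.refl (suc m)) (≡.trans eq
    (solve 1 (λ M → con 2 :* (con 2 :+ con 2 :* M) := con 3 :* M :+ con 4 :+ M) ≡.refl (suc m)))))))
  where open ℕ-Solver
degreeCases m (suc y) 2 eq = ⊥-elim (ℕ.m≢1+m+n (2 ℕ.* (2 ℕ.+ 2 ℕ.* suc m)) (≡.trans (≡.sym eq)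
  (solve 2 (λ M y → M :* (con 2 :+ y) :* con 3 :+ con 12 :=
      con 1 :+ (con 2 :* (con 2 :+ con 2 :* M) :+ (con 7 :+ con 2 :* M :+ con 3 :* M :* y)))
    ≡.refl (suc m) y)))
  where open ℕ-Solver
degreeCases m y (suc (suc (suc k))) eq = ⊥-elim (ℕ.m≢1+m+n (2 ℕ.* (2 ℕ.+ 2 ℕ.* suc m)) (≡.trans (≡.sym eq)
  (solve 3 (λ M y k → M :* (con 1 :+ y) :* (con 4 :+ k) :+ con 4 :* (con 4 :+ k) :=
      con 1 :+ (con 2 :* (con 2 :+ con 2 :* M) :+ (con 11 :+ con 4 :* k :+ M :* k :+ M :* y :* (con 4 :+ k))))
    ≡.refl (suc m) y k)))
  where open ℕ-Solver

-- The left side is divisible by 2³², while 9 · 36⁸ contains only 2¹⁶.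
9/4-notIntegral : ∀ D → D ℤ.* (+ 16) ℤ.^ 8 ≡ ℤ.- (+ 9 ℤ.* (+ 36) ℤ.^ 8) → ⊥
9/4-notIntegral D eq = from-no (16 ℕ.^ 8 ℕ.∣? 9 ℕ.* 36 ℕ.^ 8)
  (ℕ.divides ℤ.∣ D ∣ (≡.sym (≡.trans (≡.sym (ℤ.abs-* D ((+ 16) ℤ.^ 8))) (≡.cong ℤ.∣_∣ eq))))

private
  module Q = Algebra.Definitions.RawSemiring (RawRing.rawSemiring ℚ.+-*-rawRing)

-- The even exponent absorbs the sign of - q, and multiplication by aᵉ turns the rational equation
-- into one between integers.
clearPower : ∀ j e a b c q D → e ≡ j ℕ.+ j → ν a ℚ.* q ≡ ν b → fromℤ D ≡ ℚ.- (ν c ℚ.* (ℚ.- q) Q.^ e) →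
  D ℤ.* (+ a) ℤ.^ e ≡ ℤ.- (+ c ℤ.* (+ b) ℤ.^ e)
clearPower j e a b c q D ≡.refl aq≡b D≡ = fromℤ-injective (begin
  fromℤ (D ℤ.* (+ a) ℤ.^ (j ℕ.+ j))
    ≡⟨ fromℤ-* D ((+ a) ℤ.^ (j ℕ.+ j)) ⟩
  fromℤ D ℚ.* fromℤ ((+ a) ℤ.^ (j ℕ.+ j))
    ≡⟨ ≡.cong₂ ℚ._*_ D≡ (power (j ℕ.+ j) a) ⟩
  ℚ.- (ν c ℚ.* (ℚ.- q) Q.^ (j ℕ.+ j)) ℚ.* (ν a) Q.^ (j ℕ.+ j)
    ≡⟨ solve 3 (λ c x y → :- (c :* x) :* y := :- (c :* (x :* y))) ≡.refl (ν c) ((ℚ.- q) Q.^ (j ℕ.+ j)) (ν a Q.^ (j ℕ.+ j)) ⟩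
  ℚ.- (ν c ℚ.* ((ℚ.- q) Q.^ (j ℕ.+ j) ℚ.* (ν a) Q.^ (j ℕ.+ j)))
    ≡⟨ ≡.cong (λ z → ℚ.- (ν c ℚ.* z)) (≡.trans (evenPower j) (≡.sym (power (j ℕ.+ j) b))) ⟩
  ℚ.- (ν c ℚ.* fromℤ ((+ b) ℤ.^ (j ℕ.+ j)))
    ≡⟨ ≡.trans (fromℤ-neg (+ c ℤ.* (+ b) ℤ.^ (j ℕ.+ j))) (≡.cong ℚ.-_ (fromℤ-* (+ c) ((+ b) ℤ.^ (j ℕ.+ j)))) ⟨
  fromℤ (ℤ.- (+ c ℤ.* (+ b) ℤ.^ (j ℕ.+ j))) ∎)
  where
  open ≡.≡-Reasoning
  open ℚ-Solver
  power : ∀ j a → fromℤ ((+ a) ℤ.^ j) ≡ ν a Q.^ j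
  power zero    a = ≡.refl
  power (suc j) a = ≡.trans (fromℤ-* (+ a) ((+ a) ℤ.^ j)) (≡.cong (ν a ℚ.*_) (power j a))
  evenPower : ∀ j → (ℚ.- q) Q.^ (j ℕ.+ j) ℚ.* ν a Q.^ (j ℕ.+ j) ≡ ν b Q.^ (j ℕ.+ j)
  evenPower zero = ≡.refl
  evenPower (suc j) rewrite ℕ.+-suc j j = begin
    ℚ.- q ℚ.* (ℚ.- q ℚ.* x) ℚ.* (ν a ℚ.* (ν a ℚ.* z))
      ≡⟨ solve 4 (λ q t x z → :- q :* (:- q :* x) :* (t :* (t :* z)) := t :* q :* (t :* q :* (x :* z))) ≡.refl q (ν a) x z ⟩
    ν a ℚ.* q ℚ.* (ν a ℚ.* q ℚ.* (x ℚ.* z))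
      ≡⟨ ≡.cong₂ (λ t p → t ℚ.* (t ℚ.* p)) aq≡b (evenPower j) ⟩
    ν b ℚ.* (ν b ℚ.* ν b Q.^ (j ℕ.+ j)) ∎
    where
    x = (ℚ.- q) Q.^ (j ℕ.+ j)
    z = ν a Q.^ (j ℕ.+ j)

-- Here n = 18, and the trace equation 16 q + 18 = 54 gives θ² = 36 / 16. For `D` = det (- A) the
-- product of eigenvalues would be - 9 (9 / 4)⁸, not an integer.
cubicImpossible : ∀ D q {K M} → K ≡ 3 → M ≡ 8 →
  ν (2 ℕ.* M) ℚ.* q ℚ.+ ν (2 ℕ.* (K ℕ.* K)) ≡ ν ((2 ℕ.+ 2 ℕ.* M) ℕ.* K) →
  fromℤ D ≡ ℚ.- (ν (K ℕ.* K) ℚ.* (ℚ.- q) Q.^ M) → ⊥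
cubicImpossible D q ≡.refl ≡.refl q-equation D≡ = 9/4-notIntegral D (clearPower 4 8 16 36 9 q D ≡.refl 16q≡36 D≡)
  where
  open ≡.≡-Reasoning
  open ℚ-Solver
  16q≡36 : ν 16 ℚ.* q ≡ ν 36
  16q≡36 = begin
    ν 16 ℚ.* q                             ≡⟨ solve 2 (λ a b → a := a :+ b :- b) ≡.refl (ν 16 ℚ.* q) (ν 18) ⟩
    ν 16 ℚ.* q ℚ.+ ν 18 ℚ.- ν 18           ≡⟨ ≡.cong (ℚ._- ν 18) q-equation ⟩
    ν 54 ℚ.- ν 18                          ≡⟨⟩
    ν 36                                   ∎

-- The possible degrees of a periodic graph with the given spectrum.

module PeriodicRegularSpectrum {n : ℕ} (Γ : Graph n) (k m : ℕ) (θ : ℝ) (regular : Regular Γ (suc k))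
    (hasSpectrum : HasSpectrum (adjacencyMatrix Γ)
      (fromℕ (suc k) ∷ (ℝ-ring.- fromℕ (suc k)) ∷ replicate (suc m) θ ++ replicate (suc m) (ℝ-ring.- θ)))
    (k≉θ : fromℕ (suc k) ≉ᴿ θ) (-k≉θ : ℝ-ring.- fromℕ (suc k) ≉ᴿ θ) (θ≉-θ : θ ≉ᴿ ℝ-ring.- θ)
    (periodic : Periodic Γ) where
  open RegularSpectrum Γ k m θ regular hasSpectrum
  open ℝ-CR using (_+_; _*_; -_; 0#; 1#)
  private module A = ℝ-CR
  open Squares ℝ-commutativeRing fromℤ-ℝ-isRingHomomorphism

  θ≉0 : θ ≉ᴿ 0#
  θ≉0 θ≈0 = θ≉-θ (A.trans {θ} {0#} { - θ} θ≈0 (A.trans {0#} { - 0#} { - θ} (pointwise {0#} { - 0#} (λ _ → ≡.refl))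
    (A.-‿cong {0#} {θ} (A.sym {θ} {0#} θ≈0))))

  q≢0 : q ≢ 0ℚ
  q≢0 q≡0 = noZeroDivisors {θ} {θ} (A.trans {θ * θ} {fromℚ q} {0#} θ²≈q (A.reflexive (≡.cong fromℚ q≡0))) θ≉0 θ≉0

  i : ℤ
  i = proj₁ (integral periodic)

  i≡ : ν 4 ℚ.* (κ ℚ.* κ ℚ.* q) ≡ fromℤ i
  i≡ = proj₂ (integral periodic)

  4q≡ : ν 4 ℚ.* q ≡ fromℤ i ℚ.* (ν K ℚ.* ν K)
  4q≡ = begin
    ν 4 ℚ.* q
      ≡⟨ solve 1 (λ q → con (ν 4) :* q := con (ν 4) :* (con 1ℚ :* con 1ℚ :* q)) ≡.refl q ⟩
    ν 4 ℚ.* (1ℚ ℚ.* 1ℚ ℚ.* q)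
      ≡⟨ ≡.cong (λ z → ν 4 ℚ.* (z ℚ.* z ℚ.* q)) (≡.sym (ν-inverse k)) ⟩
    ν 4 ℚ.* (κ ℚ.* ν K ℚ.* (κ ℚ.* ν K) ℚ.* q)
      ≡⟨ solve 3 (λ κ K q → con (ν 4) :* (κ :* K :* (κ :* K) :* q) := con (ν 4) :* (κ :* κ :* q) :* (K :* K)) ≡.refl κ (ν K) q ⟩
    ν 4 ℚ.* (κ ℚ.* κ ℚ.* q) ℚ.* (ν K ℚ.* ν K)
      ≡⟨ ≡.cong (ℚ._* (ν K ℚ.* ν K)) i≡ ⟩
    fromℤ i ℚ.* (ν K ℚ.* ν K) ∎
    where
    open ≡.≡-Reasoning
    open ℚ-Solver

  -- The integer is the square of the real number 2 θ / k, hence not negative, and it is not 0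
  -- because θ and - θ differ.
  positive : ∃[ y ] i ≡ + suc y
  positive = cases i (fromℤ-nonNegative i (square-nonNegative {x} x²≈i)) i≢0
    where
    c : ℚ
    c = ν 2 ℚ.* κ
    x : ℝ
    x = fromℚ c * θ
    c²q≡ : c ℚ.* c ℚ.* q ≡ fromℤ i
    c²q≡ = ≡.trans (ℚ-Solver.solve 2 (λ κ q → con (ν 2) :* κ :* (con (ν 2) :* κ) :* q := con (ν 4) :* (κ :* κ :* q)) ≡.refl κ q) i≡
      where open ℚ-Solver
    x²≈i : x * x ≈ᴿ fromℚ (fromℤ i)
    x²≈i = A.trans {x * x} {fromℚ c * fromℚ c * (θ * θ)} {fromℚ (fromℤ i)} (scaledSquare (fromℚ c) θ)
      (A.trans {fromℚ c * fromℚ c * (θ * θ)} {fromℚ c * fromℚ c * fromℚ q} {fromℚ (fromℤ i)}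
        (A.*-congˡ {fromℚ c * fromℚ c} {θ * θ} {fromℚ q} θ²≈q)
        (A.trans {fromℚ c * fromℚ c * fromℚ q} {fromℚ (c ℚ.* c ℚ.* q)} {fromℚ (fromℤ i)}
          (pointwise {fromℚ c * fromℚ c * fromℚ q} {fromℚ (c ℚ.* c ℚ.* q)} (λ _ → ≡.refl))
          (A.reflexive (≡.cong fromℚ c²q≡))))
    i≢0 : i ≢ + 0
    i≢0 i≡0 = q≢0 (begin
      q                                       ≡⟨ ℚ.*-identityˡ q ⟨
      1ℚ ℚ.* q                                ≡⟨ ≡.cong (ℚ._* q) (≡.sym (ν-inverse 3)) ⟩
      inverse 3 ℚ.* ν 4 ℚ.* q                 ≡⟨ ℚ.*-assoc (inverse 3) (ν 4) q ⟩
      inverse 3 ℚ.* (ν 4 ℚ.* q)               ≡⟨ ≡.cong (inverse 3 ℚ.*_) 4q≡ ⟩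
      inverse 3 ℚ.* (fromℤ i ℚ.* (ν K ℚ.* ν K)) ≡⟨ ≡.cong (λ i → inverse 3 ℚ.* (fromℤ i ℚ.* (ν K ℚ.* ν K))) i≡0 ⟩
      inverse 3 ℚ.* (0ℚ ℚ.* (ν K ℚ.* ν K))
        ≡⟨ ≡.trans (≡.cong (inverse 3 ℚ.*_) (ℚ.*-zeroˡ (ν K ℚ.* ν K))) (ℚ.*-zeroʳ (inverse 3)) ⟩
      0ℚ                                      ∎)
      where open ≡.≡-Reasoning
    cases : ∀ j → + 0 ℤ.≤ j → j ≢ + 0 → ∃[ y ] j ≡ + suc y
    cases (+ zero)  _ j≢0 = ⊥-elim (j≢0 ≡.refl)
    cases (+ suc y) _ _   = y , ≡.refl

  y Y : ℕ
  y = proj₁ positive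
  Y = suc y

  -- Four times the trace equation 2 M q + 2 K² = n K, with 4 q = Y K² and n = 2 + 2 M inserted,
  -- divided by 2 K.
  degreeEquation : M ℕ.* Y ℕ.* K ℕ.+ 4 ℕ.* K ≡ 2 ℕ.* (2 ℕ.+ 2 ℕ.* M)
  degreeEquation = ℕ.*-cancelˡ-≡ _ _ (2 ℕ.* K) (begin
    2 ℕ.* K ℕ.* (M ℕ.* Y ℕ.* K ℕ.+ 4 ℕ.* K)
      ≡⟨ solve 3 (λ M Y K → con 2 :* K :* (M :* Y :* K :+ con 4 :* K)
           := con 2 :* M :* (Y :* (K :* K)) :+ con 4 :* (con 2 :* (K :* K))) ≡.refl M Y K ⟩
    2 ℕ.* M ℕ.* (Y ℕ.* (K ℕ.* K)) ℕ.+ 4 ℕ.* (2 ℕ.* (K ℕ.* K))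
      ≡⟨ ν-injective rational ⟩
    4 ℕ.* (n ℕ.* K)
      ≡⟨ ≡.cong (λ n → 4 ℕ.* (n ℕ.* K)) n≡ ⟩
    4 ℕ.* ((2 ℕ.+ 2 ℕ.* M) ℕ.* K)
      ≡⟨ solve 2 (λ N K → con 4 :* (N :* K) := con 2 :* K :* (con 2 :* N)) ≡.refl (2 ℕ.+ 2 ℕ.* M) K ⟩
    2 ℕ.* K ℕ.* (2 ℕ.* (2 ℕ.+ 2 ℕ.* M)) ∎)
    where
    open ≡.≡-Reasoning
    open ℕ-Solver
    rational : ν (2 ℕ.* M ℕ.* (Y ℕ.* (K ℕ.* K)) ℕ.+ 4 ℕ.* (2 ℕ.* (K ℕ.* K))) ≡ ν (4 ℕ.* (n ℕ.* K))
    rational = begin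
      ν (2 ℕ.* M ℕ.* (Y ℕ.* (K ℕ.* K)) ℕ.+ 4 ℕ.* (2 ℕ.* (K ℕ.* K)))
        ≡⟨ ≡.trans (ν-+ (2 ℕ.* M ℕ.* (Y ℕ.* (K ℕ.* K))) (4 ℕ.* (2 ℕ.* (K ℕ.* K)))) (≡.cong₂ ℚ._+_
             (≡.trans (ν-* (2 ℕ.* M) (Y ℕ.* (K ℕ.* K))) (≡.cong (ν (2 ℕ.* M) ℚ.*_)
               (≡.trans (ν-* Y (K ℕ.* K)) (≡.cong₂ ℚ._*_ (≡.cong fromℤ (≡.sym (proj₂ positive))) (ν-* K K)))))
             (ν-* 4 (2 ℕ.* (K ℕ.* K)))) ⟩
      ν (2 ℕ.* M) ℚ.* (fromℤ i ℚ.* (ν K ℚ.* ν K)) ℚ.+ ν 4 ℚ.* ν (2 ℕ.* (K ℕ.* K))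
        ≡⟨ ≡.cong (λ z → ν (2 ℕ.* M) ℚ.* z ℚ.+ ν 4 ℚ.* ν (2 ℕ.* (K ℕ.* K))) (≡.sym 4q≡) ⟩
      ν (2 ℕ.* M) ℚ.* (ν 4 ℚ.* q) ℚ.+ ν 4 ℚ.* ν (2 ℕ.* (K ℕ.* K))
        ≡⟨ S.solve 3 (λ μ q s → μ S.:* (S.con (ν 4) S.:* q) S.:+ S.con (ν 4) S.:* s S.:= S.con (ν 4) S.:* (μ S.:* q S.:+ s)) ≡.refl
             (ν (2 ℕ.* M)) q (ν (2 ℕ.* (K ℕ.* K))) ⟩
      ν 4 ℚ.* (ν (2 ℕ.* M) ℚ.* q ℚ.+ ν (2 ℕ.* (K ℕ.* K)))
        ≡⟨ ≡.cong (ν 4 ℚ.*_) q-equation ⟩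
      ν 4 ℚ.* ν (n ℕ.* K)
        ≡⟨ ν-* 4 (n ℕ.* K) ⟨
      ν (4 ℕ.* (n ℕ.* K)) ∎
      where module S = ℚ-Solver

  -- For K = 1 the trace equation becomes 2 M q = 2 M, so (θ - 1) (θ + 1) = 0 although θ differs
  -- from both k and - k.
  degree≢1 : K ≢ 1
  degree≢1 ≡.refl = noZeroDivisors {θ A.- 1#} {θ A.- - 1#}
    (differenceOfSquares {θ} {1#} (A.trans {θ * θ} {fromℚ q} {1# * 1#} θ²≈q
      (A.trans {fromℚ q} {1#} {1# * 1#} (A.reflexive (≡.cong fromℚ q≡1)) (A.sym {1# * 1#} {1#} (A.*-identityˡ 1#)))))
    (λ d≈0 → k≉θ (A.sym {θ} {1#} (≈0⇒≈ {θ} {1#} d≈0)))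
    (λ d≈0 → -k≉θ (A.sym {θ} { - 1#} (≈0⇒≈ {θ} { - 1#} d≈0)))
    where
    ≈0⇒≈ : ∀ {x y} → x A.- y ≈ᴿ 0# → x ≈ᴿ y
    ≈0⇒≈ {x} {y} = Algebra.Properties.Group.x∙y⁻¹≈ε⇒x≈y A.+-group x y
    q≡1 : q ≡ 1ℚ
    q≡1 = begin
      1/2M ℚ.* (ν (n ℕ.* 1) ℚ.- ν 2)
        ≡⟨ ≡.cong (λ t → 1/2M ℚ.* (t ℚ.- ν 2)) (≡.trans (≡.cong ν (≡.trans (ℕ.*-identityʳ n) n≡)) (ν-+ 2 (2 ℕ.* M))) ⟩
      1/2M ℚ.* (ν 2 ℚ.+ ν (2 ℕ.* M) ℚ.- ν 2)
        ≡⟨ ≡.cong (1/2M ℚ.*_) (solve 2 (λ s t → s :+ t :- s := t) ≡.refl (ν 2) (ν (2 ℕ.* M))) ⟩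
      1/2M ℚ.* ν (2 ℕ.* M)
        ≡⟨ ν-inverse (m ℕ.+ 1 ℕ.* M) ⟩
      1ℚ ∎
      where
      open ≡.≡-Reasoning
      open ℚ-Solver

  private
    module ZM = Matrices ℤ.+-*-rawRing
    module RM = Matrices ℝ-rawRing
    module RP = Algebra.Definitions.RawSemiring (RawRing.rawSemiring ℝ-rawRing)
    module E = SpectrumEvaluation ℝ-commutativeRing (Identity.isRingHomomorphism ℝ-rawRing (λ {x} → A.refl {x})) 0#

  -- Written over ℤ, so that its determinant is an integer by construction.
  negatedAdjacency : ZM.Matrix (Fin n) (Fin n)
  negatedAdjacency x y = if adj Γ x y then ℤ.-1ℤ else ℤ.0ℤ

  -- The characteristic polynomial at 0 is det (- A). It is the image of an integer determinant and
  -- equals a product that involves only θ², so the equation descends to ℚ.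
  determinant : fromℤ (ZM.det negatedAdjacency) ≡ ℚ.- (ν (K ℕ.* K) ℚ.* (ℚ.- q) Q.^ M)
  determinant = fromℚ-injective (A.trans {fromℚ (fromℤ (ZM.det negatedAdjacency))} {d} {r} det≈
      (A.trans {d} {E.∏[s- Λ ]} {r} (E.eval-charPoly (adjacencyMatrix Γ) {Λ} hasSpectrum)
        (A.trans {E.∏[s- Λ ]} { - (fromℚ (ν (K ℕ.* K)) * RP._^_ (- (θ * θ)) M)} {r} (product-spectrum K M θ)
          (A.trans { - (fromℚ (ν (K ℕ.* K)) * RP._^_ (- (θ * θ)) M)} { - (fromℚ (ν (K ℕ.* K)) * fromℚ ((ℚ.- q) Q.^ M))} {r}
            (A.-‿cong {fromℚ (ν (K ℕ.* K)) * RP._^_ (- (θ * θ)) M} {fromℚ (ν (K ℕ.* K)) * fromℚ ((ℚ.- q) Q.^ M)}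
              (A.*-congˡ {fromℚ (ν (K ℕ.* K))} {RP._^_ (- (θ * θ)) M} {fromℚ ((ℚ.- q) Q.^ M)} (squarePower M)))
            (pointwise { - (fromℚ (ν (K ℕ.* K)) * fromℚ ((ℚ.- q) Q.^ M))} {r} (λ _ → ≡.refl))))))
    where
    d = RM.det (0# RM.• RM.Id RM.-ᴹ adjacencyMatrix Γ)
    r = fromℚ (ℚ.- (ν (K ℕ.* K) ℚ.* (ℚ.- q) Q.^ M))
    det≈ : fromℚ (fromℤ (ZM.det negatedAdjacency)) ≈ᴿ d
    det≈ = A.trans {fromℚ (fromℤ (ZM.det negatedAdjacency))} {RM.det (λ x y → fromℚ (fromℤ (negatedAdjacency x y)))} {d}
      (DeterminantHomomorphism.det-homo ℤ.+-*-rawRing ℝ-commutativeRing fromℤ-ℝ-isRingHomomorphism negatedAdjacency)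
      (Determinants.det-cong ℝ-commutativeRing {n} {λ x y → fromℚ (fromℤ (negatedAdjacency x y))} {0# RM.• RM.Id RM.-ᴹ adjacencyMatrix Γ}
        (λ x y → negatedIndicator (RM.δ x y) (adj Γ x y)))
    squarePower : ∀ j → RP._^_ (- (θ * θ)) j ≈ᴿ fromℚ ((ℚ.- q) Q.^ j)
    squarePower zero    = A.refl {1#}
    squarePower (suc j) = A.trans { - (θ * θ) * RP._^_ (- (θ * θ)) j} {fromℚ (ℚ.- q) * fromℚ ((ℚ.- q) Q.^ j)} {fromℚ ((ℚ.- q) Q.^ suc j)}
      (A.*-cong { - (θ * θ)} {fromℚ (ℚ.- q)} {RP._^_ (- (θ * θ)) j} {fromℚ ((ℚ.- q) Q.^ j)}
        (A.trans { - (θ * θ)} { - fromℚ q} {fromℚ (ℚ.- q)} (A.-‿cong {θ * θ} {fromℚ q} θ²≈q)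
          (pointwise { - fromℚ q} {fromℚ (ℚ.- q)} (λ _ → ≡.refl)))
        (squarePower j))
      (pointwise {fromℚ (ℚ.- q) * fromℚ ((ℚ.- q) Q.^ j)} {fromℚ ((ℚ.- q) ℚ.* (ℚ.- q) Q.^ j)} (λ _ → ≡.refl))

  ¬cubic : ¬ (K ≡ 3 × M ≡ 8)
  ¬cubic (K≡3 , M≡8) = cubicImpossible (ZM.det negatedAdjacency) q K≡3 M≡8
    (≡.trans q-equation (≡.cong (λ n → ν (n ℕ.* K)) n≡)) determinant

  degree≡2 : K ≡ 2 × n ≡ 6
  degree≡2 = conclude (degreeCases m y k degreeEquation)
    where
    conclude : K ≡ 1 ⊎ (K ≡ 2 × M ≡ 2) ⊎ (K ≡ 3 × M ≡ 8) → K ≡ 2 × n ≡ 6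
    conclude (inj₁ K≡1)                = ⊥-elim (degree≢1 K≡1)
    conclude (inj₂ (inj₁ (K≡2 , M≡2))) = K≡2 , ≡.trans n≡ (≡.cong (λ M → 2 ℕ.+ 2 ℕ.* M) M≡2)
    conclude (inj₂ (inj₂ cubic))       = ⊥-elim (¬cubic cubic)

-- A connected bipartite 2-regular graph on six vertices is a hexagon.

injective⇒surjective : ∀ {n} (f : Fin n → Fin n) → (∀ {i j} → f i ≡ f j → i ≡ j) → ∀ x → ∃[ i ] f i ≡ x
injective⇒surjective {suc n} f inj x with Fin.any? (λ i → f i Fin.≟ x)
... | yes hit = hit
-- Pigeonhole: if x is missed, punching it out squeezes f injectively into a set with one element
-- less.
... | no miss = ⊥-elim (ℕ.1+n≰n (Fin.injective⇒≤ {f = λ i → punchOut {i = x} {j = f i} (λ x≡ → miss (i , ≡.sym x≡))}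
  (λ {i} {j} eq → inj (Fin.punchOut-injective {i = x} {j = f i} {k = f j} _ _ eq))))

covering⇒≤ : ∀ {n} (xs : List (Fin n)) → (∀ x → x ∈ xs) → n ℕ.≤ length xs
covering⇒≤ xs cover = Fin.injective⇒≤ {f = λ x → index (cover x)} λ {x} {y} eq →
  ≡.trans (lookup-index (cover x)) (≡.trans (≡.cong (List.lookup xs) eq) (≡.sym (lookup-index (cover y))))

module TwoRegular {n} (Γ : Graph n) (regular : Regular Γ 2) where
  open Graph Γ using (_~_; symm)

  ~-sym : ∀ {x y} → x ~ y → y ~ x
  ~-sym {x} {y} = ≡.subst T (symm x y)

  -- The continuation of a path that has entered x from y.
  record OtherNeighbour (x y : Fin n) : Set where
    field
      other    : Fin n
      distinct : other ≢ y
      adjacent : x ~ other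
      only     : ∀ {w} → x ~ w → w ≡ y ⊎ w ≡ other

  neighbours : Fin n → List (Fin n)
  neighbours x = filter (λ y → T? (adj Γ x y)) (allFin n)

  module _ (x : Fin n) where

    pair : ∀ ns → length ns ≡ 2 → AllPairs _≢_ ns → (∀ {w} → w ∈ ns → x ~ w) → (∀ {w} → x ~ w → w ∈ ns) →
      ∃[ y ] (x ~ y × OtherNeighbour x y)
    pair (y ∷ z ∷ []) _ ((y≢z ∷ []) ∷ _) sound complete = y , sound (here ≡.refl) , record
      { other = z ; distinct = y≢z ∘ ≡.sym ; adjacent = sound (there (here ≡.refl)) ; only = member ∘ complete }
      where
      member : ∀ {w} → w ∈ y ∷ z ∷ [] → w ≡ y ⊎ w ≡ z
      member (here w≡y)         = inj₁ w≡y
      member (there (here w≡z)) = inj₂ w≡z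

    twoNeighbours : ∃[ y ] (x ~ y × OtherNeighbour x y)
    twoNeighbours = pair (neighbours x) (regular x) (Unique.filter⁺ (λ y → T? (adj Γ x y)) (Unique.allFin⁺ n))
      (λ w∈ → proj₂ (∈-filter⁻ (λ y → T? (adj Γ x y)) {xs = allFin n} w∈))
      (λ {w} x~w → ∈-filter⁺ (λ y → T? (adj Γ x y)) (∈-allFin w) x~w)

  otherNeighbour : ∀ {x y} → x ~ y → OtherNeighbour x y
  otherNeighbour {x} {y} x~y with a , x~a , O ← twoNeighbours x = choose (O.only x~y)
    where
    module O = OtherNeighbour O
    choose : y ≡ a ⊎ y ≡ O.other → OtherNeighbour x y
    choose (inj₁ ≡.refl) = O
    choose (inj₂ ≡.refl) = record { other = a ; distinct = O.distinct ∘ ≡.sym ; adjacent = x~a ; only = Sum.swap ∘ O.only }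

successor predecessor : Fin 6 → Fin 6
successor 0F = 1F
successor 1F = 2F
successor 2F = 3F
successor 3F = 4F
successor 4F = 5F
successor 5F = 0F
predecessor 0F = 5F
predecessor 1F = 0F
predecessor 2F = 1F
predecessor 3F = 2F
predecessor 4F = 3F
predecessor 5F = 4F

-- Checked over all 36 pairs; from here on the arithmetic modulo 6 is replaced by two tables.
adj-cycle6 : ∀ i j → adj (cycle 6) i j ≡ does (j Fin.≟ predecessor i) ∨ does (j Fin.≟ successor i)
adj-cycle6 = from-yes (Fin.all? λ i → Fin.all? λ j → adj (cycle 6) i j Bool.≟ (does (j Fin.≟ predecessor i) ∨ does (j Fin.≟ successor i)))

module Hexagon (Γ : Graph 6) (connected : Connected Γ) (bipartite : Bipartite Γ) (regular : Regular Γ 2) where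
  open Graph Γ using (_~_)
  open TwoRegular Γ regular
  open import Relation.Binary.Construct.Closure.ReflexiveTransitive using (ε; _◅_)

  colour : Fin 6 → Bool
  colour = proj₁ bipartite

  -- Connectedness as an induction principle; it serves to exclude a component smaller than the
  -- whole graph.
  closed⇒all : (S : Fin 6 → Set) → (∀ {x y} → S x → x ~ y → S y) → S 0F → ∀ x → S x
  closed⇒all S closed S0 x = walk S0 (connected 0F x)
    where
    walk : ∀ {x y} → S x → Star _~_ x y → S y
    walk Sx ε        = Sx
    walk Sx (e ◅ es) = walk (closed Sx e) es

  opposite : ∀ {x y} → x ~ y → colour y ≡ not (colour x)
  opposite {x} {y} e = Bool.¬-not (λ eq → proj₂ bipartite x y e (≡.sym eq))

  -- A path from vertex 0 that leaves each vertex by the neighbour it did not come from. The goal is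
  -- that it first closes up at the sixth step.
  v₀ v₁ v₂ v₃ v₄ v₅ v₆ : Fin 6
  e₀₁ : v₀ ~ v₁
  O₀ : OtherNeighbour v₀ v₁
  O₁ : OtherNeighbour v₁ v₀
  O₂ : OtherNeighbour v₂ v₁
  O₃ : OtherNeighbour v₃ v₂
  O₄ : OtherNeighbour v₄ v₃
  O₅ : OtherNeighbour v₅ v₄
  module N₀ = OtherNeighbour O₀
  module N₁ = OtherNeighbour O₁
  module N₂ = OtherNeighbour O₂
  module N₃ = OtherNeighbour O₃
  module N₄ = OtherNeighbour O₄
  module N₅ = OtherNeighbour O₅
  v₀ = 0F
  v₁ = proj₁ (twoNeighbours v₀)
  e₀₁ = proj₁ (proj₂ (twoNeighbours v₀))
  O₀ = proj₂ (proj₂ (twoNeighbours v₀))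
  O₁ = otherNeighbour (~-sym e₀₁)
  v₂ = N₁.other
  O₂ = otherNeighbour (~-sym N₁.adjacent)
  v₃ = N₂.other
  O₃ = otherNeighbour (~-sym N₂.adjacent)
  v₄ = N₃.other
  O₄ = otherNeighbour (~-sym N₃.adjacent)
  v₅ = N₄.other
  O₅ = otherNeighbour (~-sym N₄.adjacent)
  v₆ = N₅.other

  sameColour : ∀ {x y z} → x ~ y → y ~ z → colour z ≡ colour x
  sameColour e e′ = ≡.trans (opposite e′) (≡.trans (≡.cong not (opposite e)) (Bool.not-involutive _))

  differ : ∀ {x y} → colour y ≡ not (colour x) → x ≢ y
  differ eq ≡.refl = Bool.not-¬ ≡.refl eq

  c₁ : colour v₁ ≡ not (colour v₀)
  c₁ = opposite e₀₁
  c₂ : colour v₂ ≡ colour v₀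
  c₂ = sameColour e₀₁ N₁.adjacent
  c₃ : colour v₃ ≡ not (colour v₀)
  c₃ = ≡.trans (opposite N₂.adjacent) (≡.cong not c₂)
  c₄ : colour v₄ ≡ colour v₀
  c₄ = ≡.trans (sameColour N₂.adjacent N₃.adjacent) c₂
  c₅ : colour v₅ ≡ not (colour v₀)
  c₅ = ≡.trans (opposite N₄.adjacent) (≡.cong not c₄)
  c₆ : colour v₆ ≡ colour v₀
  c₆ = ≡.trans (sameColour N₄.adjacent N₅.adjacent) c₄

  apart : ∀ {x y} → colour x ≡ colour v₀ → colour y ≡ not (colour v₀) → x ≢ y
  apart cx cy = differ (≡.trans cy (≡.cong not (≡.sym cx)))

  -- Otherwise the first four vertices form a quadrilateral closed under adjacency, and
  -- connectedness would make four vertices cover six.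
  v₄≢v₀ : v₄ ≢ v₀
  v₄≢v₀ v₄≡v₀ = ℕ.<⇒≱ (ℕ.≤-refl {5}) (ℕ.≤-trans (ℕ.n≤1+n 5) (covering⇒≤ square (closed⇒all (_∈ square) closed (here ≡.refl))))
    where
    square : List (Fin 6)
    square = v₀ ∷ v₁ ∷ v₂ ∷ v₃ ∷ []
    v₀~v₃ : v₀ ~ v₃
    v₀~v₃ = ≡.subst (_~ v₃) v₄≡v₀ (~-sym N₃.adjacent)
    v₃≡ : v₃ ≡ N₀.other
    v₃≡ = Sum.[ (λ v₃≡v₁ → ⊥-elim (N₂.distinct v₃≡v₁)) , id ]′ (N₀.only v₀~v₃)
    closed : ∀ {x y} → x ∈ square → x ~ y → y ∈ square
    closed (here ≡.refl) e = Sum.[ (λ p → there (here p)) , (λ p → there (there (there (here (≡.trans p (≡.sym v₃≡)))))) ]′ (N₀.only e)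
    closed (there (here ≡.refl)) e = Sum.[ here , (λ p → there (there (here p))) ]′ (N₁.only e)
    closed (there (there (here ≡.refl))) e = Sum.[ (λ p → there (here p)) , (λ p → there (there (there (here p)))) ]′ (N₂.only e)
    closed (there (there (there (here ≡.refl)))) e = Sum.[ (λ p → there (there (here p))) , (λ p → here (≡.trans p v₄≡v₀)) ]′ (N₃.only e)

  -- Otherwise `v₄` would be adjacent to `v₁`, hence equal to `v₀` or `v₂`.
  v₅≢v₁ : v₅ ≢ v₁
  v₅≢v₁ v₅≡v₁ = Sum.[ v₄≢v₀ , N₃.distinct ]′ (N₁.only (≡.subst (_~ v₄) v₅≡v₁ (~-sym N₄.adjacent)))

  v : Fin 6 → Fin 6
  v 0F = v₀
  v 1F = v₁
  v 2F = v₂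
  v 3F = v₃
  v 4F = v₄
  v 5F = v₅

  -- Colours separate even from odd positions. Positions two steps apart along the path differ
  -- because the path never turns back, and the pairs 0, 4 and 1, 5 were treated above.
  v-injective : ∀ {i j} → v i ≡ v j → i ≡ j
  v-injective {0F} {0F} _ = ≡.refl
  v-injective {1F} {1F} _ = ≡.refl
  v-injective {2F} {2F} _ = ≡.refl
  v-injective {3F} {3F} _ = ≡.refl
  v-injective {4F} {4F} _ = ≡.refl
  v-injective {5F} {5F} _ = ≡.refl
  v-injective {0F} {1F} p = ⊥-elim (apart ≡.refl c₁ p)
  v-injective {0F} {3F} p = ⊥-elim (apart ≡.refl c₃ p)
  v-injective {0F} {5F} p = ⊥-elim (apart ≡.refl c₅ p)
  v-injective {2F} {1F} p = ⊥-elim (apart c₂ c₁ p)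
  v-injective {2F} {3F} p = ⊥-elim (apart c₂ c₃ p)
  v-injective {2F} {5F} p = ⊥-elim (apart c₂ c₅ p)
  v-injective {4F} {1F} p = ⊥-elim (apart c₄ c₁ p)
  v-injective {4F} {3F} p = ⊥-elim (apart c₄ c₃ p)
  v-injective {4F} {5F} p = ⊥-elim (apart c₄ c₅ p)
  v-injective {1F} {0F} p = ⊥-elim (apart ≡.refl c₁ (≡.sym p))
  v-injective {3F} {0F} p = ⊥-elim (apart ≡.refl c₃ (≡.sym p))
  v-injective {5F} {0F} p = ⊥-elim (apart ≡.refl c₅ (≡.sym p))
  v-injective {1F} {2F} p = ⊥-elim (apart c₂ c₁ (≡.sym p))
  v-injective {3F} {2F} p = ⊥-elim (apart c₂ c₃ (≡.sym p))
  v-injective {5F} {2F} p = ⊥-elim (apart c₂ c₅ (≡.sym p))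
  v-injective {1F} {4F} p = ⊥-elim (apart c₄ c₁ (≡.sym p))
  v-injective {3F} {4F} p = ⊥-elim (apart c₄ c₃ (≡.sym p))
  v-injective {5F} {4F} p = ⊥-elim (apart c₄ c₅ (≡.sym p))
  v-injective {0F} {2F} p = ⊥-elim (N₁.distinct (≡.sym p))
  v-injective {2F} {0F} p = ⊥-elim (N₁.distinct p)
  v-injective {2F} {4F} p = ⊥-elim (N₃.distinct (≡.sym p))
  v-injective {4F} {2F} p = ⊥-elim (N₃.distinct p)
  v-injective {0F} {4F} p = ⊥-elim (v₄≢v₀ (≡.sym p))
  v-injective {4F} {0F} p = ⊥-elim (v₄≢v₀ p)
  v-injective {1F} {3F} p = ⊥-elim (N₂.distinct (≡.sym p))
  v-injective {3F} {1F} p = ⊥-elim (N₂.distinct p)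
  v-injective {3F} {5F} p = ⊥-elim (N₄.distinct (≡.sym p))
  v-injective {5F} {3F} p = ⊥-elim (N₄.distinct p)
  v-injective {1F} {5F} p = ⊥-elim (v₅≢v₁ (≡.sym p))
  v-injective {5F} {1F} p = ⊥-elim (v₅≢v₁ p)

  v⁻¹ : Fin 6 → Fin 6
  v⁻¹ x = proj₁ (injective⇒surjective v v-injective x)

  v∘v⁻¹ : ∀ x → v (v⁻¹ x) ≡ x
  v∘v⁻¹ x = proj₂ (injective⇒surjective v v-injective x)

  -- Six distinct vertices are all there are, and the colour leaves positions 0, 2 and 4. The last
  -- would be turning back, and `v₂` is full: its neighbours are `v₁` and `v₃`, neither of which is
  -- `v₅`.
  v₆≡v₀ : v₆ ≡ v₀
  v₆≡v₀ = locate (v⁻¹ v₆) (v∘v⁻¹ v₆)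
    where
    locate : ∀ i → v i ≡ v₆ → v₆ ≡ v₀
    locate 0F p = ≡.sym p
    locate 1F p = ⊥-elim (apart c₆ c₁ (≡.sym p))
    locate 2F p = ⊥-elim (Sum.[ v₅≢v₁ , N₄.distinct ]′ (N₂.only (≡.subst (_~ v₅) (≡.sym p) (~-sym N₅.adjacent))))
    locate 3F p = ⊥-elim (apart c₆ c₃ (≡.sym p))
    locate 4F p = ⊥-elim (N₅.distinct (≡.sym p))
    locate 5F p = ⊥-elim (apart c₆ c₅ (≡.sym p))

  v₀~v₅ : v₀ ~ v₅
  v₀~v₅ = ≡.subst (_~ v₅) v₆≡v₀ (~-sym N₅.adjacent)

  neighbour : ∀ i {w} → v i ~ w → w ≡ v (predecessor i) ⊎ w ≡ v (successor i)
  -- `O₀` singles out the successor `v₁`, unlike the later ones, which single out the predecessor;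
  -- hence the exchanged alternatives.
  neighbour 0F e = Sum.[ inj₂ , (λ p → inj₁ (≡.trans p (≡.sym v₅≡))) ]′ (N₀.only e)
    where
    v₅≡ : v₅ ≡ N₀.other
    v₅≡ = Sum.[ (λ p → ⊥-elim (v₅≢v₁ p)) , id ]′ (N₀.only v₀~v₅)
  neighbour 1F e = N₁.only e
  neighbour 2F e = N₂.only e
  neighbour 3F e = N₃.only e
  neighbour 4F e = N₄.only e
  neighbour 5F e = Sum.map₂ (λ p → ≡.trans p v₆≡v₀) (N₅.only e)

  v~successor : ∀ i → v i ~ v (successor i)
  v~successor 0F = e₀₁
  v~successor 1F = N₁.adjacent
  v~successor 2F = N₂.adjacent
  v~successor 3F = N₃.adjacent
  v~successor 4F = N₄.adjacent
  v~successor 5F = ~-sym v₀~v₅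

  v~predecessor : ∀ i → v i ~ v (predecessor i)
  v~predecessor 0F = v₀~v₅
  v~predecessor 1F = ~-sym (v~successor 0F)
  v~predecessor 2F = ~-sym (v~successor 1F)
  v~predecessor 3F = ~-sym (v~successor 2F)
  v~predecessor 4F = ~-sym (v~successor 3F)
  v~predecessor 5F = ~-sym (v~successor 4F)

  adj-v : ∀ i j → adj Γ (v i) (v j) ≡ adj (cycle 6) i j
  adj-v i j = ≡.trans (compare (j Fin.≟ predecessor i) (j Fin.≟ successor i)) (≡.sym (adj-cycle6 i j))
    where
    T⇒≡ : ∀ {b} → T b → b ≡ true
    T⇒≡ {true} _ = ≡.refl
    ¬T⇒≡ : ∀ {b} → ¬ T b → b ≡ false
    ¬T⇒≡ {false} _ = ≡.refl
    ¬T⇒≡ {true} ¬t = ⊥-elim (¬t tt)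
    compare : (p? : Dec (j ≡ predecessor i)) (s? : Dec (j ≡ successor i)) → adj Γ (v i) (v j) ≡ does p? ∨ does s?
    compare (yes ≡.refl) _ = T⇒≡ (v~predecessor i)
    compare (no _) (yes ≡.refl) = T⇒≡ (v~successor i)
    compare (no ¬p) (no ¬s) = ¬T⇒≡ (λ e → Sum.[ ¬p ∘ v-injective , ¬s ∘ v-injective ]′ (neighbour i e))

  hexagon : Γ ≅ cycle 6
  hexagon = mk↔ₛ′ v⁻¹ v (λ i → v-injective (v∘v⁻¹ (v i))) v∘v⁻¹ , λ x y →
    ≡.trans (≡.cong₂ (adj Γ) (≡.sym (v∘v⁻¹ x)) (≡.sym (v∘v⁻¹ y))) (adj-v (v⁻¹ x) (v⁻¹ y))

-- Periodicity of the walk on the hexagon.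

C₆ : Graph 6
C₆ = cycle 6

-- The neighbour of i in C₆ other than j.
around : Fin 6 → Fin 6 → Fin 6
around i j = if does (j Fin.≟ successor i) then predecessor i else successor i

-- The arc from i to j is sent to the other arc ending at i, so arcs move against their direction;
-- this is the position of the nonzero entry in a row of U.
rotate : Fin 6 × Fin 6 → Fin 6 × Fin 6
rotate (i , j) = around i j , i

around-adjacent : ∀ i j → T (adj C₆ i j) → T (adj C₆ (around i j) i)
around-adjacent = from-yes (Fin.all? λ i → Fin.all? λ j → T? (adj C₆ i j) →-dec T? (adj C₆ (around i j) i))

around-≢ : ∀ i j → T (adj C₆ i j) → around i j ≢ j
around-≢ = from-yes (Fin.all? λ i → Fin.all? λ j → T? (adj C₆ i j) →-dec ¬? (around i j Fin.≟ j))

around-only : ∀ i j l → T (adj C₆ i j) → T (adj C₆ l i) → l ≡ j ⊎ l ≡ around i j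
around-only = from-yes (Fin.all? λ i → Fin.all? λ j → Fin.all? λ l →
  T? (adj C₆ i j) →-dec T? (adj C₆ l i) →-dec ((l Fin.≟ j) ⊎-dec (l Fin.≟ around i j)))

rotate⁶ : ∀ i j → T (adj C₆ i j) → rotate (rotate (rotate (rotate (rotate (rotate (i , j)))))) ≡ (i , j)
rotate⁶ i j e = ≡.cong₂ _,_ (proj₁ (both i j e)) (proj₂ (both i j e))
  where
  R⁶ : Fin 6 × Fin 6 → Fin 6 × Fin 6
  R⁶ = rotate ∘ rotate ∘ rotate ∘ rotate ∘ rotate ∘ rotate
  both : ∀ i j → T (adj C₆ i j) → proj₁ (R⁶ (i , j)) ≡ i × proj₂ (R⁶ (i , j)) ≡ j
  both = from-yes (Fin.all? λ i → Fin.all? λ j → T? (adj C₆ i j) →-dec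
    ((proj₁ (R⁶ (i , j)) Fin.≟ i) ×-dec (proj₂ (R⁶ (i , j)) Fin.≟ j)))

module HexagonArcs {n} (Γ : Graph n) (iso : Γ ≅ C₆) where
  open Arc
  private module f = Inverse (proj₁ iso)

  f-adj : ∀ {x y} → T (adj Γ x y) → T (adj C₆ (f.to x) (f.to y))
  f-adj {x} {y} = ≡.subst T (proj₂ iso x y)

  f-injective : ∀ {x y} → f.to x ≡ f.to y → x ≡ y
  f-injective {x} {y} eq = ≡.trans (≡.sym (f.strictlyInverseʳ x)) (≡.trans (≡.cong f.from eq) (f.strictlyInverseʳ y))

  opposite : Arc Γ → Fin n
  opposite e = f.from (around (f.to (origin e)) (f.to (terminus e)))

  f-opposite : ∀ e → f.to (opposite e) ≡ around (f.to (origin e)) (f.to (terminus e))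
  f-opposite e = f.strictlyInverseˡ _

  rotateArc : Arc Γ → Arc Γ
  rotateArc e = arc (opposite e) (origin e) (≡.subst T (≡.sym (≡.trans (proj₂ iso (opposite e) (origin e))
    (≡.cong (λ i → adj C₆ i (f.to (origin e))) (f-opposite e))))
    (around-adjacent (f.to (origin e)) (f.to (terminus e)) (f-adj (isEdge e))))

  arc-≡ : {e g : Arc Γ} → origin e ≡ origin g → terminus e ≡ terminus g → e ≡ g
  arc-≡ {arc x y p} {arc _ _ q} ≡.refl ≡.refl = ≡.cong (arc x y) (T-irrelevant p q)

  ends : Arc Γ → Fin 6 × Fin 6
  ends e = f.to (origin e) , f.to (terminus e)

  ends-rotate : ∀ e → ends (rotateArc e) ≡ rotate (ends e)
  ends-rotate e = ≡.cong (λ i → i , f.to (origin e)) (f-opposite e)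

  rotateArc⁶ : ∀ e → rotateArc (rotateArc (rotateArc (rotateArc (rotateArc (rotateArc e))))) ≡ e
  rotateArc⁶ e = arc-≡ (f-injective (≡.cong proj₁ ends⁶)) (f-injective (≡.cong proj₂ ends⁶))
    where
    r = rotateArc
    step : ∀ g {p} → ends g ≡ p → ends (rotateArc g) ≡ rotate p
    step g eq = ≡.trans (ends-rotate g) (≡.cong rotate eq)
    ends⁶ : ends (rotateArc (rotateArc (rotateArc (rotateArc (rotateArc (rotateArc e)))))) ≡ ends e
    ends⁶ = ≡.trans (step (r (r (r (r (r e))))) (step (r (r (r (r e)))) (step (r (r (r e))) (step (r (r e)) (step (r e) (step e ≡.refl)))))) (rotate⁶ _ _ (f-adj (isEdge e)))

  opposite-≢ : ∀ e → opposite e ≢ terminus e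
  opposite-≢ e eq = around-≢ _ _ (f-adj (isEdge e)) (≡.trans (≡.sym (f-opposite e)) (≡.cong f.to eq))

  into-origin : (e g : Arc Γ) → origin e ≡ terminus g → origin g ≡ terminus e ⊎ origin g ≡ opposite e
  into-origin e g eq = Sum.map f-injective (λ p → f-injective (≡.trans p (≡.sym (f-opposite e))))
    (around-only _ _ _ (f-adj (isEdge e)) (≡.subst (λ x → T (adj C₆ (f.to (origin g)) (f.to x))) (≡.sym eq) (f-adj (isEdge g))))

  -- The degree is the length of a filtered list; rewritten as a sum of indicators it can be
  -- transported by the invariance of sums under permutation.
  deg≡2 : ∀ x → deg Γ x ≡ 2
  deg≡2 x = ℤ.+-injective (begin
    + deg Γ x
      ≡⟨ sum-adjacent Γ (Identity.isRingHomomorphism ℤ.+-*-rawRing ≡.refl) x ⟨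
    sum (λ y → indicator (adj Γ x y))
      ≡⟨ sum-cong-≗ (λ y → ≡.cong indicator (proj₂ iso x y)) ⟩
    sum (λ y → indicator (adj C₆ (f.to x) (f.to y)))
      ≡⟨ sum-permute (λ j → indicator (adj C₆ (f.to x) j)) (proj₁ iso) ⟨
    sum (λ j → indicator (adj C₆ (f.to x) j))
      ≡⟨ two (f.to x) ⟩
    + 2 ∎)
    where
    open ≡.≡-Reasoning
    open ArcSums ℤ.+-*-commutativeRing using (sum-adjacent; indicator)
    open Algebra.Properties.Semiring.Sum (CommutativeRing.semiring ℤ.+-*-commutativeRing) using (sum; sum-cong-≗; sum-permute)
    two : ∀ i → sum (λ j → indicator (adj C₆ i j)) ≡ + 2
    two = from-yes (Fin.all? λ i → sum (λ j → indicator (adj C₆ i j)) ℤ.≟ + 2)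

module HexagonWalk (R : CommutativeRing 0ℓ 0ℓ) {n} (Γ : Graph n) (iso : Γ ≅ C₆) where
  open CommutativeRing R hiding (zero)
  open Algebra.Properties.Ring ring
  open IntegerSolver R using (solve; _:+_; _:*_; _:-_; :-_; _:=_; con)
  open Matrices rawRing
  open Determinants R using (δ-refl; δ-≢)
  open MatrixAlgebra R
  open RegularWalk R Γ
  open HexagonArcs Γ iso
  open Arc
  open Grover Γ using (Finite-Arc; _⁻¹)
  open Relation.Binary.Reasoning.Setoid setoid

  module _ (a : Carrier) {d : Matrix (Fin n) (Arc Γ)} {P : Matrix (Arc Γ) (Fin n)}
      (d≈ : ∀ x e → d x e ≈ a * δ x (terminus e)) (P≈ : ∀ e x → P e x ≈ a * δ x (terminus e))
      (2a²≈1 : (1# + 1#) * (a * a) ≈ 1#) where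

    U : Matrix (Arc Γ) (Arc Γ)
    U = shift · ((1# + 1#) • (P · d) -ᴹ Id)

    -- Only two arcs end at the origin of e: its reverse and the rotated arc. Subtracting the
    -- reverse leaves the other.
    δ-difference : (e g : Arc Γ) → δ (origin e) (terminus g) - δ (e ⁻¹) g ≈ δ (rotateArc e) g
    δ-difference e g = cases (toSum (origin e ≟ terminus g))
      where
      cases : origin e ≡ terminus g ⊎ origin e ≢ terminus g → δ (origin e) (terminus g) - δ (e ⁻¹) g ≈ δ (rotateArc e) g
      cases (inj₂ o≢t) = trans (+-cong (δ-≢ o≢t) (-‿cong (δ-≢ {i = e ⁻¹} {g} (λ eq → o≢t (≡.cong terminus eq)))))
        (trans (-‿inverseʳ 0#) (sym (δ-≢ {i = rotateArc e} {g} (λ eq → o≢t (≡.cong terminus eq)))))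
      cases (inj₁ o≡t) = within (into-origin e g o≡t)
        where
        hit : δ (origin e) (terminus g) ≈ 1#
        hit = ≡.subst (λ y → δ (origin e) y ≈ 1#) o≡t (δ-refl (origin e))
        within : origin g ≡ terminus e ⊎ origin g ≡ opposite e → δ (origin e) (terminus g) - δ (e ⁻¹) g ≈ δ (rotateArc e) g
        within (inj₁ back) = trans (+-cong hit (-‿cong (≡.subst (λ h → δ (e ⁻¹) h ≈ 1#)
            (arc-≡ {e ⁻¹} {g} (≡.sym back) o≡t) (δ-refl (e ⁻¹)))))
          (trans (-‿inverseʳ 1#) (sym (δ-≢ {i = rotateArc e} {g} (λ eq → opposite-≢ e (≡.trans (≡.cong origin eq) back)))))
        within (inj₂ on) = trans (+-cong hit (-‿cong (δ-≢ {i = e ⁻¹} {g} (λ eq →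
            opposite-≢ e (≡.trans (≡.sym on) (≡.sym (≡.cong origin eq)))))))
          (trans (solve 0 (con (+ 1) :- con (+ 0) := con (+ 1)) refl)
            (sym (≡.subst (λ h → δ (rotateArc e) h ≈ 1#) (arc-≡ {rotateArc e} {g} (≡.sym on) o≡t) (δ-refl (rotateArc e)))))

    -- In degree 2 the reflected amplitude 2 / deg - 1 is 0 and the transmitted amplitude 2 / deg is
    -- 1, so the walk merely permutes the arcs.
    U-rotates : ∀ e g → U e g ≈ δ (rotateArc e) g
    U-rotates e g = begin
      U e g
        ≈⟨ shift-· ((1# + 1#) • (P · d) -ᴹ Id) e g ⟩
      (1# + 1#) * (P · d) (e ⁻¹) g - δ (e ⁻¹) g
        ≈⟨ +-congʳ (begin
             (1# + 1#) * sumOver (λ x → P (e ⁻¹) x * d x g)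
               ≈⟨ *-congˡ (sumOver-cong (λ x → trans (*-cong (P≈ (e ⁻¹) x) (d≈ x g)) (trans (*-congʳ (*-congˡ (δ-sym x (origin e))))
                    (solve 3 (λ a p q → a :* p :* (a :* q) := a :* a :* p :* q) refl a (δ (origin e) x) (δ x (terminus g)))))) ⟩
             (1# + 1#) * sumOver (λ x → a * a * δ (origin e) x * δ x (terminus g))
               ≈⟨ *-congˡ (sumOver-δ (λ x → a * a * δ (origin e) x) (terminus g)) ⟩
             (1# + 1#) * (a * a * δ (origin e) (terminus g))
               ≈⟨ trans (sym (*-assoc _ _ _)) (trans (*-congʳ 2a²≈1) (*-identityˡ _)) ⟩
             δ (origin e) (terminus g) ∎) ⟩
      δ (origin e) (terminus g) - δ (e ⁻¹) g
        ≈⟨ δ-difference e g ⟩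
      δ (rotateArc e) g ∎

    U-· : ∀ (M : Matrix (Arc Γ) (Arc Γ)) {h : Arc Γ → Arc Γ} → (∀ e g → M e g ≈ δ (h e) g) →
      ∀ e g → (U · M) e g ≈ δ (h (rotateArc e)) g
    U-· M M≈ e g = trans (sumOver-cong (λ u → trans (*-congʳ {M u g} (trans (U-rotates e u) (δ-sym (rotateArc e) u))) (*-comm (δ u (rotateArc e)) (M u g))))
      (trans (sumOver-δ (λ u → M u g) (rotateArc e)) (M≈ (rotateArc e) g))

    -- The exponent is a variable equal to 6, which keeps the sixfold matrix product folded in the
    -- type until the match.
    U⁶≈Id : ∀ {τ} → τ ≡ 6 → U ^ᴹ τ ≈ᴹ Id
    U⁶≈Id ≡.refl e g = trans
      (U-· (U ^ᴹ 5) {r ∘ r ∘ r ∘ r ∘ r} (U-· (U ^ᴹ 4) {r ∘ r ∘ r ∘ r} (U-· (U ^ᴹ 3) {r ∘ r ∘ r} (U-· (U ^ᴹ 2) {r ∘ r}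
        (U-· (U ^ᴹ 1) {r} (U-· (U ^ᴹ 0) {id} (λ e g → refl)))))) e g)
      (reflexive (≡.cong (λ h → δ h g) (rotateArc⁶ e)))
      where r = rotateArc

hexagon⇒periodic : ∀ {n} (Γ : Graph n) → Γ ≅ C₆ → Periodic Γ
hexagon⇒periodic Γ iso = 6 , s≤s z≤n , U^τ≈Id ≡.refl
  where
  open Grover Γ using (boundary; boundary*; Finite-Arc)
  open Matrices ℂ-rawRing using (_^ᴹ_; _≈ᴹ_; Id)
  open RegularBoundary Γ 1 (HexagonArcs.deg≡2 Γ iso)
  module ℂR = CommutativeRing ℂ-commutativeRing
  1+1≈2 : ℂR.1# ℂR.+ ℂR.1# ℂR.≈ fromℝ (fromℚ (ν 2))
  1+1≈2 = pointwise {1+1} {fromℚ (ν 2)} (λ _ → ≡.refl) , pointwise {0+0} {ℝ-ring.0#} (λ _ → ≡.refl)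
    where
    1+1 0+0 : ℝ
    1+1 = ℝ-ring.1# ℝ-ring.+ ℝ-ring.1#
    0+0 = ℝ-ring.0# ℝ-ring.+ ℝ-ring.0#
  a² : ℂ
  a² = fromℝ (1/√ 2) ℂR.* fromℝ (1/√ 2)
  2/2≈1 : (ℂR.1# ℂR.+ ℂR.1#) ℂR.* a² ℂR.≈ ℂR.1#
  2/2≈1 = ℂR.trans {(ℂR.1# ℂR.+ ℂR.1#) ℂR.* a²} {fromℝ (fromℚ (ν 2)) ℂR.* a²} {ℂR.1#}
    (ℂR.*-congʳ {a²} {ℂR.1# ℂR.+ ℂR.1#} {fromℝ (fromℚ (ν 2))} 1+1≈2) inverse-degree
  U^τ≈Id : ∀ {τ} → τ ≡ 6 → Grover.U Γ ^ᴹ τ ≈ᴹ Id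
  U^τ≈Id = HexagonWalk.U⁶≈Id ℂ-commutativeRing Γ iso (fromℝ (1/√ 2)) {boundary} {boundary*} boundary-entry boundary*-entry 2/2≈1

twoRegular⇒hexagon : ∀ {n k} (Γ : Graph n) → Connected Γ → Bipartite Γ → Regular Γ k → k ≡ 2 → n ≡ 6 → Γ ≅ C₆
twoRegular⇒hexagon Γ connected bipartite regular ≡.refl ≡.refl = Hexagon.hexagon Γ connected bipartite regular

-- The equivalence, first with a free multiplicity m and then with m = n / 2 - 1.

open ℝ-ring using (-_)

-- The multiplicity is a variable so that it can be matched as a successor; its relation to n is
-- recovered from the degree of the characteristic polynomial.
periodic⇔hexagon : ∀ n k m (Γ : Graph n) (θ : ℝ) →
  Connected Γ → Bipartite Γ → Regular Γ k →
  HasSpectrum (adjacencyMatrix Γ) (fromℕ k ∷ (- fromℕ k) ∷ replicate m θ ++ replicate m (- θ)) →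
  1 ≤ m →
  AllPairs _≉ᴿ_ (fromℕ k ∷ (- fromℕ k) ∷ θ ∷ (- θ) ∷ []) →
  Periodic Γ ⇔ Γ ≅ cycle 6
-- In degree 0 the eigenvalues k and - k would coincide.
periodic⇔hexagon n zero m Γ θ _ _ _ _ _ ((0≉-0 ∷ _) ∷ _) = ⊥-elim (0≉-0 (pointwise {fromℕ 0} { - fromℕ 0} (λ _ → ≡.refl)))
periodic⇔hexagon n (suc k) (suc m) Γ θ connected bipartite regular spectrum _
  ((_ ∷ k≉θ ∷ _) ∷ (-k≉θ ∷ _) ∷ (θ≉-θ ∷ _) ∷ _) = mk⇔
  (λ periodic → let
      k≡2 , n≡6 = PeriodicRegularSpectrum.degree≡2 Γ k m θ regular spectrum k≉θ -k≉θ θ≉-θ periodic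
    in twoRegular⇒hexagon Γ connected bipartite regular k≡2 n≡6)
  (hexagon⇒periodic Γ)

theorem1p2 : (n k : ℕ) (Γ : Graph n) (θ : ℝ) →
    Connected Γ → Bipartite Γ → Regular Γ k →
    HasSpectrum (adjacencyMatrix Γ)
    (fromℕ k ∷ (- fromℕ k) ∷ replicate (n / 2 ∸ 1) θ ++ replicate (n / 2 ∸ 1) (- θ)) →
    1 ≤ n / 2 ∸ 1 →
    AllPairs _≉ᴿ_ (fromℕ k ∷ (- fromℕ k) ∷ θ ∷ (- θ) ∷ []) →
    Periodic Γ ⇔ Γ ≅ cycle 6
theorem1p2 n k = periodic⇔hexagon n k (n / 2 ∸ 1)
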